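{- For any non-empty $P\subseteq\{3,4,\ldots,\omega\}$, the classes $\mathcal{T}^*_P$ and $\mathcal{F}^*_P$ are Ramsey classes.
   Context: $\omega$ is regarded as larger than every natural number. Trees are finite acyclic connected graphs; $ab$ denotes the path from $a$ to $b$ (a single vertex if $a=b$). $\mathcal{L}_P$ consists of a 4-ary symbol $D$ and unary symbols $K_p$, $p\in P$. $\mathcal{F}_P$: finite $\mathcal{L}_P$-structures whose universe is the vertex set of a finite tree with no vertex of degree 2, with $D(a,b,c,d)$ iff paths $ab,cd$ share no vertex, and each vertex $a$ satisfying $K_p(a)$ for exactly one $p\in P$, with the degree of $a$ at most $p$. Rooted tree $T$ with root $r$: $x\le_T y$ iff $x$ lies on the path $ry$; immediate successors and meets are with respect to $\le_T$. Class $\mathcal{T}^*_P$: language $\mathcal{L}_P\cup\{C,\prec,G_1,G_2,\ldots\}$ ($C$ ternary; $\prec$, $G_i$ binary; if $P$ is finite only $G_1,\ldots,G_{m-1}$, $m=\max(P\setminus\{\omega\})$). From $A\in\mathcal{F}_P$ obtain $T$: Step 1: either pick a vertex $r$ of $A$ whose degree is strictly less than the $p$ with $K_p^A(r)$, and let $T=A$ rooted at $r$; or pick an edge $[a,b]$ of $A$, replace it by a new vertex $r$ and edges $[a,r],[r,b]$, rooted at $r$. Let $D^T(a,b,c,d)$ iff paths $ab,cd$ in $T$ are disjoint, and $C^T(a,b,c)$ iff $D^T(a,b,c,r)$. Step 2: if $r\notin A$, choose $p\in P$ and declare $K_p^T(r)$. Step 3: for each $a\in T$ fix a strict linear order $a_1\prec_a\cdots\prec_a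 a_n$ of its immediate successors; put $c\prec^T d$ iff for some $a$ and $i<j$, $a_i\le_T c$ and $a_j\le_T d$. For each $a$ with $K^T_p(a)$, $p<\omega$, fix an increasing injection $k\colon\{1,\ldots,n\}\to\{1,\ldots,p-1\}$ and let $G^T_{k(i)}(a,b)$ iff $a_i\le_T b$ (all other instances false). $\mathcal{T}^*_P$ consists of all structures so obtained and their isomorphic copies. Class $\mathcal{F}^*_P$: language $\mathcal{L}_P\cup\{C,\prec,G_1,G_2,\ldots\}\cup\{R_p\}_{p\in P}\cup\{H_{ij}\}_{1\le i<j}$, new symbols binary. Given $A\in\mathcal{F}_P$ and $T$ obtained from $A$, restrict all relations of $T$ to the universe of $A$, and for $a,b\in A$ incomparable in $\le_T$ with meet $c$ set $R_p(a,b)$ iff $K_p^T(c)$ and $H_{ij}(a,b)$ iff $G_i^T(c,a)$ and $G_j^T(c,b)$. $\mathcal{F}^*_P$ consists of all structures so obtained and their isomorphic copies. An embedding is an injective map $f$ with $R(\bar a)\iff R(f(\bar a))$ for all relation symbols $R$; $A\le B$ means $A$ embeds into $B$, and $\binom{B}{A}$ is the set of embeddings of $A$ into $B$. A class $\mathcal{G}$ is a Ramsey class if for all $A,B\in\mathcal{G}$ with $A\le B$ and every $r\ge2$ there is $C\in\mathcal{G}$ such that for every coloring $c\colon\binom{C}{A}\to\{1,\ldots,r\}$ there is $h\in\binom{C}{B}$ with $\{h\circ f:f\in\binom{B}{A}\}$ monochromatic. -}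

module Defs where

open import Data.Nat using (ℕ; zero; suc; _≤_; _<_; _∸_)
open import Data.Fin as Fin using (Fin)
open import Data.Maybe using (Maybe; just; nothing)
open import Data.List using (List; []; _∷_; length; lookup)
open import Data.List.Membership.Propositional using (_∈_)
open import Data.List.Relation.Unary.Unique.Propositional using (Unique)
open import Data.Vec using (Vec; map) renaming (lookup to vlookup)
open import Data.Product using (Σ; ∃; _×_; _,_)
open import Data.Sum using (_⊎_)
open import Data.Empty using (⊥)
open import Data.Unit using (⊤)
open import Relation.Nullary using (¬_)
open import Relation.Binary.PropositionalEquality using (_≡_; _≢_)
open import Function.Bundles using (_⇔_)

data Deg : Set where
  fin : ℕ → Deg
  ω   : Deg

Admissible : Deg → Set
Admissible (fin k) = 3 ≤ k
Admissible ω       = ⊤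

_≤ᵈ_ : ℕ → Deg → Set
d ≤ᵈ fin p = d ≤ p
d ≤ᵈ ω     = ⊤

_<ᵈ_ : ℕ → Deg → Set
d <ᵈ fin p = d < p
d <ᵈ ω     = ⊤

module _ {V : Set} (E : V → V → Set) where

  data Walk : V → V → List V → Set where
    here : ∀ {a} → Walk a a (a ∷ [])
    step : ∀ {a b c l} → E a b → Walk b c l → Walk a c (a ∷ l)

  Path : V → V → List V → Set
  Path a b l = Walk a b l × Unique l

  OnPath : V → V → V → Set
  OnPath a b v = ∃ λ l → Path a b l × v ∈ l

  Disjoint : V → V → V → V → Set
  Disjoint a b c d = ¬ (∃ λ v → OnPath a b v × OnPath c d v)

  HasCycle : Set
  HasCycle = ∃ λ a → ∃ λ b → ∃ λ l → Path a b l × 3 ≤ length l × E b a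

  -- finite tree (finiteness comes from V being Fin n / Maybe (Fin n))
  record IsTree : Set where
    field
      nonempty  : V
      symm      : ∀ {a b} → E a b → E b a
      irrefl    : ∀ a → ¬ E a a
      connected : ∀ a b → ∃ λ l → Walk a b l
      acyclic   : ¬ HasCycle

  Degree : V → ℕ → Set
  Degree a d = Σ (List V) λ l → Unique l × (∀ x → (x ∈ l ⇔ E a x)) × length l ≡ d

  module _ (r : V) where

    Le : V → V → Set
    Le x y = OnPath r y x

    ImmSucc : V → V → Set
    ImmSucc a b = Le a b × a ≢ b × (∀ c → Le a c → Le c b → c ≡ a ⊎ c ≡ b)

    Meet : V → V → V → Set
    Meet a b c = Le c a × Le c b × (∀ d → Le d a → Le d b → Le d c)

    Incomparable : V → V → Set
    Incomparable a b = ¬ Le a b × ¬ Le b a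

-- language L_P ∪ {C, ≺, G_1, G_2, ...}
-- (K p is the symbol K_p; only p ∈ P are symbols of the language.
--  G i is the symbol G_i; only i ≥ 1 are symbols.)
record StrT (X : Set) : Set₁ where
  field
    D    : X → X → X → X → Set
    K    : Deg → X → Set
    C    : X → X → X → Set
    prec : X → X → Set
    G    : ℕ → X → X → Set

-- extended language with R_p (p ∈ P) and H_ij (1 ≤ i < j)
record StrF (X : Set) : Set₁ where
  field
    base : StrT X
    R    : Deg → X → X → Set
    H    : ℕ → ℕ → X → X → Set

open StrT
open StrF

record EmbT (P : Deg → Set) {X Y : Set} (A : StrT X) (B : StrT Y) (f : X → Y) : Set where
  field
    inj      : ∀ x y → f x ≡ f y → x ≡ y
    presD    : ∀ a b c d → (D A a b c d ⇔ D B (f a) (f b) (f c) (f d))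
    presK    : ∀ p → P p → ∀ a → (K A p a ⇔ K B p (f a))
    presC    : ∀ a b c → (C A a b c ⇔ C B (f a) (f b) (f c))
    presPrec : ∀ a b → (prec A a b ⇔ prec B (f a) (f b))
    presG    : ∀ i → 1 ≤ i → ∀ a b → (G A i a b ⇔ G B i (f a) (f b))

record EmbF (P : Deg → Set) {X Y : Set} (A : StrF X) (B : StrF Y) (f : X → Y) : Set where
  field
    embBase : EmbT P (base A) (base B) f
    presR   : ∀ p → P p → ∀ a b → (R A p a b ⇔ R B p (f a) (f b))
    presH   : ∀ i j → 1 ≤ i → i < j → ∀ a b → (H A i j a b ⇔ H B i j (f a) (f b))

Surjective : {X Y : Set} → (X → Y) → Set
Surjective {X} f = ∀ y → ∃ λ (x : X) → f x ≡ y

record FPData (P : Deg → Set) (n : ℕ) : Set₁ where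
  field
    E        : Fin n → Fin n → Set
    tree     : IsTree E
    label    : Fin n → Deg              -- K_p(a) iff label a ≡ p
    labelP   : ∀ a → P (label a)
    noDeg2   : ∀ a → ¬ Degree E a 2
    degBound : ∀ a d → Degree E a d → d ≤ᵈ label a

open FPData

data Choice {P : Deg → Set} {n : ℕ} (A : FPData P n) : Set where
  atVertex : (r : Fin n) → (∀ d → Degree (E A) r d → d <ᵈ label A r) → Choice A
  atEdge   : (a b : Fin n) → E A a b → (p : Deg) → P p → Choice A

module _ {P : Deg → Set} {n : ℕ} {A : FPData P n} where

  TV : Choice A → Set
  TV (atVertex _ _)      = Fin n
  TV (atEdge _ _ _ _ _)  = Maybe (Fin n)

  ι : (c : Choice A) → Fin n → TV c
  ι (atVertex _ _)     x = x
  ι (atEdge _ _ _ _ _) x = just x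

  TE : (c : Choice A) → TV c → TV c → Set
  TE (atVertex _ _) x y = E A x y
  TE (atEdge a b _ _ _) (just x) (just y) =
    E A x y × ¬ ((x ≡ a × y ≡ b) ⊎ (x ≡ b × y ≡ a))
  TE (atEdge a b _ _ _) nothing  (just y) = y ≡ a ⊎ y ≡ b
  TE (atEdge a b _ _ _) (just x) nothing  = x ≡ a ⊎ x ≡ b
  TE (atEdge a b _ _ _) nothing  nothing  = ⊥

  root : (c : Choice A) → TV c
  root (atVertex r _)     = r
  root (atEdge _ _ _ _ _) = nothing

  Tlabel : (c : Choice A) → TV c → Deg
  Tlabel (atVertex _ _)     x        = label A x
  Tlabel (atEdge _ _ _ _ _) (just x) = label A x
  Tlabel (atEdge _ _ _ p _) nothing = p

record Step3 {V : Set} (E : V → V → Set) (r : V) (lab : V → Deg) : Set where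
  field
    succs         : V → List V            -- a_1 ≺_a ... ≺_a a_n
    succsUnique   : ∀ a → Unique (succs a)
    succsComplete : ∀ a b → (b ∈ succs a ⇔ ImmSucc E r a b)
    k             : (a : V) → Fin (length (succs a)) → ℕ
    kRange        : ∀ a p → lab a ≡ fin p → ∀ i → 1 ≤ k a i × k a i ≤ p ∸ 1
    kIncr         : ∀ a p → lab a ≡ fin p → ∀ i j → i Fin.< j → k a i < k a j

open Step3

TStr : {V : Set} (E : V → V → Set) (r : V) (lab : V → Deg) → Step3 E r lab → StrT V
D    (TStr E r lab s) a b c d = Disjoint E a b c d
K    (TStr E r lab s) p a     = lab a ≡ p
C    (TStr E r lab s) a b c   = Disjoint E a b c r
prec (TStr E r lab s) c d     =
  ∃ λ a → ∃ λ i → ∃ λ j → i Fin.< j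
    × Le E r (lookup (succs s a) i) c × Le E r (lookup (succs s a) j) d
G    (TStr E r lab s) i a b   =
  ∃ λ p → lab a ≡ fin p × ∃ λ j → k s a j ≡ i × Le E r (lookup (succs s a) j) b

FStr : {P : Deg → Set} {n : ℕ} {A : FPData P n} (c : Choice A)
       → Step3 (TE c) (root c) (Tlabel c) → StrF (Fin n)
D    (base (FStr c s)) a b x y = D (TStr (TE c) (root c) (Tlabel c) s) (ι c a) (ι c b) (ι c x) (ι c y)
K    (base (FStr c s)) p a     = K (TStr (TE c) (root c) (Tlabel c) s) p (ι c a)
C    (base (FStr c s)) a b x   = C (TStr (TE c) (root c) (Tlabel c) s) (ι c a) (ι c b) (ι c x)
prec (base (FStr c s)) a b     = prec (TStr (TE c) (root c) (Tlabel c) s) (ι c a) (ι c b)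
G    (base (FStr c s)) i a b   = G (TStr (TE c) (root c) (Tlabel c) s) i (ι c a) (ι c b)
R    (FStr c s) p a b =
  Incomparable (TE c) (root c) (ι c a) (ι c b)
  × ∃ λ m → Meet (TE c) (root c) (ι c a) (ι c b) m × Tlabel c m ≡ p
H    (FStr c s) i j a b =
  Incomparable (TE c) (root c) (ι c a) (ι c b)
  × ∃ λ m → Meet (TE c) (root c) (ι c a) (ι c b) m
      × G (TStr (TE c) (root c) (Tlabel c) s) i m (ι c a)
      × G (TStr (TE c) (root c) (Tlabel c) s) j m (ι c b)

InTstar : (P : Deg → Set) (N : ℕ) → StrT (Fin N) → Set₁
InTstar P N S =
  Σ ℕ λ n → Σ (FPData P n) λ A → Σ (Choice A) λ c →
  Σ (Step3 (TE c) (root c) (Tlabel c)) λ s →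
  Σ (Fin N → TV c) λ g → EmbT P S (TStr (TE c) (root c) (Tlabel c) s) g × Surjective g

InFstar : (P : Deg → Set) (N : ℕ) → StrF (Fin N) → Set₁
InFstar P N S =
  Σ ℕ λ n → Σ (FPData P n) λ A → Σ (Choice A) λ c →
  Σ (Step3 (TE c) (root c) (Tlabel c)) λ s →
  Σ (Fin N → Fin n) λ g → EmbF P S (FStr c s) g × Surjective g

-- Ramsey classes
-- Maps Fin a → Fin c are represented by vectors; a colouring of the
-- embeddings takes the embedding proof as an irrelevant argument.

Ramsey : (S : Set → Set₁) → (∀ {X Y : Set} → S X → S Y → (X → Y) → Set)
       → ((N : ℕ) → S (Fin N) → Set₁) → Set₁
Ramsey S Emb Cls =
  ∀ (a b : ℕ) (A : S (Fin a)) (B : S (Fin b)) → Cls a A → Cls b B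
  → (∃ λ (f : Fin a → Fin b) → Emb A B f)
  → (r : ℕ) → 2 ≤ r
  → Σ ℕ λ c → Σ (S (Fin c)) λ C → Cls c C ×
      ((χ : (f : Vec (Fin c) a) → .(Emb A C (vlookup f)) → Fin r) →
        Σ (Vec (Fin c) b) λ h → Emb B C (vlookup h) ×
        Σ (Fin r) λ col →
          ∀ (f : Vec (Fin b) a) → Emb A B (vlookup f)
          → (e : Emb A C (vlookup (map (vlookup h) f)))
          → χ (map (vlookup h) f) e ≡ col)

{-# OPTIONS --safe #-}
module Submission where

-- Elements of both classes are encoded by labelled ordered trees, and embeddings by maps that preserve labels and
-- send the branches at a vertex, in order, into branches at its image. For two colours the Ramsey property of these
-- trees is proved by induction on the copied tree A = p(A₁, …, Aₖ), in the form of a red copy of B or a blue copy of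
-- B′, by a second induction on B and B′. At a node labelled p one takes as subtrees solutions for the pairs (Bᵢ, B′)
-- and (B, B′ᵢ), enlarged by the product Ramsey theorem for A₁, …, Aₖ so that all copies of A rooted at that node have
-- one colour, say red; then either some subtree has a blue B′, or each has a red Bᵢ, and these make up a red B.
-- At an ω-node the same argument runs along the list of subtrees.
--
-- The resulting tree is padded by leaves so that no inner vertex has a single child, and put above a new root with
-- exactly one child. Such a root is always a vertex of the unrooted tree, so the result serves for both classes: an
-- embedding of a structure of 𝓕* with missing root extends uniquely to its rooted tree.

open import Defs
open import Data.Bool using (Bool; true; false)
open import Data.Nat using (ℕ; zero; suc; _+_; _∸_; _≤_; _<_; z≤n; s≤s)
import Data.Nat.Properties as ℕ
open import Data.Fin as Fin using (Fin; zero; suc; toℕ)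
import Data.Fin.Properties as Fin
open import Data.Maybe using (Maybe; just; nothing)
import Data.Maybe.Properties as Maybe
open import Data.List using (List; []; _∷_; _++_; map; length; lookup; tabulate; concatMap; reverse)
import Data.List.Properties as List
open import Data.List.Membership.Propositional using (_∈_; _∉_)
open import Data.List.Membership.Propositional.Properties
  using (∈-map⁺; ∈-map⁻; ∈-++⁺ˡ; ∈-++⁺ʳ; ∈-++⁻; ∈-concatMap⁺; ∈-lookup; ∈-tabulate⁺)
open import Data.List.Relation.Unary.Any as Any using (Any; here; there)
open import Data.List.Relation.Unary.All as All using (All; []; _∷_)
import Data.List.Relation.Unary.All.Properties as All
open import Data.List.Relation.Unary.AllPairs using ([]; _∷_)
open import Data.List.Relation.Unary.Unique.Propositional using (Unique)
import Data.List.Relation.Unary.Unique.Propositional.Properties as Unique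
import Data.List.Relation.Unary.Any.Properties as Any
import Data.List.Membership.DecPropositional as DecMembership
open import Data.List.Membership.Propositional.Properties.WithK using (unique∧set⇒bag)
open import Data.List.Relation.Binary.BagAndSetEquality using (∼bag⇒↭)
open import Data.List.Relation.Binary.Permutation.Propositional.Properties using (↭-length)
open import Data.Vec as Vec using (Vec)
import Data.Vec.Properties as Vec
open import Data.Product using (Σ; ∃; _×_; _,_; proj₁; proj₂)
open import Data.Sum using (_⊎_; inj₁; inj₂; [_,_]′)
open import Data.Empty using (⊥; ⊥-elim)
open import Data.Unit using (⊤; tt)
open import Function using (_∘_; id)
open import Function.Bundles using (_⇔_; mk⇔; Equivalence)
open import Relation.Nullary using (¬_; Dec; yes; no)
open import Relation.Binary.PropositionalEquality
  using (_≡_; _≢_; refl; sym; trans; cong; cong₂; subst; subst₂; trans-assoc)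
open import Relation.Binary.Definitions using (tri<; tri≈; tri>; DecidableEquality)

-- Embeddings of labelled ordered trees

-- A copy of `A` in a tree either has its root at the root of the tree or lies inside one branch.
-- The product theorem gives the copies of the first kind one colour, but which one becomes known
-- only after the tree is built. A symmetric hypothesis would fail here: branches made monochromatic
-- one by one need not agree with each other or with the copies at the root. With two targets of
-- prescribed colours they agree by construction, and each call of the hypothesis makes one target
-- smaller. Since either colour may come out, solutions for both families of pairs must sit in the
-- same tree, so trees have to be joined, which takes two slots at a vertex. A vertex with finite
-- label `p` has at most `p - 1` children, and `3 ≤ p` guarantees slots 1 and 2; they also make room
-- for a leaf beside an only child, which would otherwise cause degree 2. On the side of graphs,
-- adjacency is not assumed decidable. The order arguments therefore run on a parent function and a
-- depth, which decide the tree order from equality of vertices alone.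

data Tree : Set where
  node : Deg → List (ℕ × Tree) → Tree

Forest : Set
Forest = List (ℕ × Tree)

-- A branch of a node labelled by a finite degree must keep its index under an embedding;
-- branches of an ω-node are only ordered, and their index carries no information.
Match : Deg → ℕ → ℕ → Set
Match (fin _) i j = i ≡ j
Match ω       i j = ⊤

-- Embeddings are inductive codes and not functions: `top` against `down` is the case distinction of
-- the Ramsey argument, and recursion on the codes lists all embeddings between two trees.
data Emb : Tree → Tree → Set
data In (s : Tree) : Forest → Set
data FEmb (l : Deg) : Forest → Forest → Set

data Emb where
  top  : ∀ {l ss ts} → FEmb l ss ts → Emb (node l ss) (node l ts)
  down : ∀ {s l ts} → In s ts → Emb s (node l ts)

data In s where
  hd : ∀ {i t ts} → Emb s t → In s ((i , t) ∷ ts)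
  tl : ∀ {x ts} → In s ts → In s (x ∷ ts)

data FEmb l where
  done : FEmb l [] []
  skip : ∀ {ss x ts} → FEmb l ss ts → FEmb l ss (x ∷ ts)
  take : ∀ {i j s t ss ts} → Match l i j → Emb s t → FEmb l ss ts
       → FEmb l ((i , s) ∷ ss) ((j , t) ∷ ts)

matchRefl : ∀ l {i} → Match l i i
matchRefl (fin _) = refl
matchRefl ω       = tt

matchTrans : ∀ l {i j k} → Match l j k → Match l i j → Match l i k
matchTrans (fin _) q p = trans p q
matchTrans ω       _ _ = tt

matchTrans-assoc : ∀ l {i j k m} (r : Match l k m) (q : Match l j k) (p : Match l i j)
                 → matchTrans l r (matchTrans l q p) ≡ matchTrans l (matchTrans l r q) p
matchTrans-assoc (fin _) r q p = trans-assoc p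
matchTrans-assoc ω       _ _ _ = refl

infixr 9 _∘ᴱ_ _∘ᴵ_ _∘ᶠ_ _∘ᶠᴵ_

_∘ᴱ_  : ∀ {s t u} → Emb t u → Emb s t → Emb s u
_∘ᴵ_  : ∀ {s t us} → In t us → Emb s t → In s us
_∘ᶠ_  : ∀ {l ss ts us} → FEmb l ts us → FEmb l ss ts → FEmb l ss us
_∘ᶠᴵ_ : ∀ {l s ts us} → FEmb l ts us → In s ts → In s us

down h ∘ᴱ e      = down (h ∘ᴵ e)
top h  ∘ᴱ top f  = top (h ∘ᶠ f)
top h  ∘ᴱ down f = down (h ∘ᶠᴵ f)

hd h ∘ᴵ e = hd (h ∘ᴱ e)
tl h ∘ᴵ e = tl (h ∘ᴵ e)

done       ∘ᶠ done         = done
skip h     ∘ᶠ f            = skip (h ∘ᶠ f)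
take m e h ∘ᶠ skip f       = skip (h ∘ᶠ f)
_∘ᶠ_ {l} (take m e h) (take n d f) = take (matchTrans l m n) (e ∘ᴱ d) (h ∘ᶠ f)

skip h     ∘ᶠᴵ f    = tl (h ∘ᶠᴵ f)
take m e h ∘ᶠᴵ hd f = hd (e ∘ᴱ f)
take m e h ∘ᶠᴵ tl f = tl (h ∘ᶠᴵ f)

-- When a homogeneous copy is refined by a second one, the colours found in the inner copy are read
-- in the large tree through this identity of codes.
assocᴱ  : ∀ {s t u v} (h : Emb u v) (g : Emb t u) (f : Emb s t) → h ∘ᴱ (g ∘ᴱ f) ≡ (h ∘ᴱ g) ∘ᴱ f
assocᴵ  : ∀ {s t u vs} (h : In u vs) (g : Emb t u) (f : Emb s t) → h ∘ᴵ (g ∘ᴱ f) ≡ (h ∘ᴵ g) ∘ᴵ f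
assocᶠ  : ∀ {l ss ts us vs} (h : FEmb l us vs) (g : FEmb l ts us) (f : FEmb l ss ts)
        → h ∘ᶠ (g ∘ᶠ f) ≡ (h ∘ᶠ g) ∘ᶠ f
assocᶠᴵ : ∀ {l s ts us vs} (h : FEmb l us vs) (g : FEmb l ts us) (f : In s ts)
        → h ∘ᶠᴵ (g ∘ᶠᴵ f) ≡ (h ∘ᶠ g) ∘ᶠᴵ f
assocᶠᴵᴱ : ∀ {l s t us vs} (h : FEmb l us vs) (g : In t us) (f : Emb s t)
        → h ∘ᶠᴵ (g ∘ᴵ f) ≡ (h ∘ᶠᴵ g) ∘ᴵ f

assocᴱ (down h) g        f        = cong down (assocᴵ h g f)
assocᴱ (top h)  (down g) f        = cong down (assocᶠᴵᴱ h g f)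
assocᴱ (top h)  (top g)  (down f) = cong down (assocᶠᴵ h g f)
assocᴱ (top h)  (top g)  (top f)  = cong top (assocᶠ h g f)

assocᴵ (hd h) g f = cong hd (assocᴱ h g f)
assocᴵ (tl h) g f = cong tl (assocᴵ h g f)

assocᶠ done         done         done         = refl
assocᶠ (skip h)     g            f            = cong skip (assocᶠ h g f)
assocᶠ (take _ _ h) (skip g)     f            = cong skip (assocᶠ h g f)
assocᶠ (take _ _ h) (take _ _ g) (skip f)     = cong skip (assocᶠ h g f)
assocᶠ {l} (take m e h) (take n d g) (take o c f)
  rewrite matchTrans-assoc l m n o | assocᴱ e d c | assocᶠ h g f = refl

assocᶠᴵ done         done         ()
assocᶠᴵ (skip h)     g            f      = cong tl (assocᶠᴵ h g f)
assocᶠᴵ (take _ _ h) (skip g)     f      = cong tl (assocᶠᴵ h g f)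
assocᶠᴵ (take _ e h) (take _ d g) (hd f) = cong hd (assocᴱ e d f)
assocᶠᴵ (take _ e h) (take _ d g) (tl f) = cong tl (assocᶠᴵ h g f)

assocᶠᴵᴱ (skip h)     g      f = cong tl (assocᶠᴵᴱ h g f)
assocᶠᴵᴱ (take _ e h) (hd g) f = cong hd (assocᴱ e g f)
assocᶠᴵᴱ (take _ e h) (tl g) f = cong tl (assocᶠᴵᴱ h g f)

idᴱ : ∀ t → Emb t t
idᶠ : ∀ l ts → FEmb l ts ts
idᴱ (node l ts) = top (idᶠ l ts)
idᶠ l []             = done
idᶠ l ((i , t) ∷ ts) = take (matchRefl l) (idᴱ t) (idᶠ l ts)

emptyᶠ : ∀ {l} ts → FEmb l [] ts
emptyᶠ []       = done
emptyᶠ (_ ∷ ts) = skip (emptyᶠ ts)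

emptyᶠ-unique : ∀ {l ts} (f g : FEmb l [] ts) → f ≡ g
emptyᶠ-unique done     done     = refl
emptyᶠ-unique (skip f) (skip g) = cong skip (emptyᶠ-unique f g)

_≟ᴰ_ : (p q : Deg) → Dec (p ≡ q)
fin m ≟ᴰ fin n with m ℕ.≟ n
... | yes refl = yes refl
... | no  m≢n  = no λ { refl → m≢n refl }
fin _ ≟ᴰ ω     = no λ ()
ω     ≟ᴰ fin _ = no λ ()
ω     ≟ᴰ ω     = yes refl

match? : ∀ l i j → Dec (Match l i j)
match? (fin _) i j = i ℕ.≟ j
match? ω       i j = yes tt

match-irrelevant : ∀ l {i j} (m n : Match l i j) → m ≡ n
match-irrelevant (fin _) refl refl = refl
match-irrelevant ω       tt   tt   = refl

-- Only completeness of the list matters: the product theorem treats the embeddings one after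
-- another, and repetitions do no harm.
Enumeration : Set → Set
Enumeration X = Σ (List X) λ xs → ∀ x → x ∈ xs

enumᴱ : ∀ s t → Enumeration (Emb s t)
enumᴵ : ∀ s ts → Enumeration (In s ts)
enumᶠ : ∀ l ss ts → Enumeration (FEmb l ss ts)

enumᴱ (node l ss) (node m ts) with enumᴵ (node l ss) ts | l ≟ᴰ m
... | ds , d∈ | no l≢m  = map down ds
                        , λ { (top _) → ⊥-elim (l≢m refl) ; (down d) → ∈-map⁺ down (d∈ d) }
... | ds , d∈ | yes refl with enumᶠ l ss ts
...   | fs , f∈ = map top fs ++ map down ds
                , λ { (top f)  → ∈-++⁺ˡ (∈-map⁺ top (f∈ f))
                    ; (down d) → ∈-++⁺ʳ (map top fs) (∈-map⁺ down (d∈ d)) }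

enumᴵ s []             = [] , λ ()
enumᴵ s ((i , t) ∷ ts) with enumᴱ s t | enumᴵ s ts
... | es , e∈ | ds , d∈ = map hd es ++ map tl ds
                        , λ { (hd e) → ∈-++⁺ˡ (∈-map⁺ hd (e∈ e))
                            ; (tl d) → ∈-++⁺ʳ (map hd es) (∈-map⁺ tl (d∈ d)) }

enumᶠ l []       []       = done ∷ [] , λ { done → here refl }
enumᶠ l (_ ∷ _)  []       = [] , λ ()
enumᶠ l []       (x ∷ ts) with enumᶠ l [] ts
... | fs , f∈ = map skip fs , λ { (skip f) → ∈-map⁺ skip (f∈ f) }
enumᶠ l ((i , s) ∷ ss) ((j , t) ∷ ts) with enumᶠ l ((i , s) ∷ ss) ts | match? l i j
... | fs , f∈ | no ¬m = map skip fs
                      , λ { (skip f) → ∈-map⁺ skip (f∈ f) ; (take m _ _) → ⊥-elim (¬m m) }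
... | fs , f∈ | yes m with enumᴱ s t | enumᶠ l ss ts
...   | es , e∈ | gs , g∈ =
  map skip fs ++ concatMap (λ e → map (take m e) gs) es
  , λ { (skip f)     → ∈-++⁺ˡ (∈-map⁺ skip (f∈ f))
      ; (take n e g) → ∈-++⁺ʳ (map skip fs) (∈-concatMap⁺ (λ e → map (take m e) gs)
          (Any.map (λ { refl → subst (λ o → take o e g ∈ map (take m e) gs)
                                 (match-irrelevant l m n) (∈-map⁺ (take m e) (g∈ g)) }) (e∈ e))) }

-- Ramsey theorem for labelled ordered trees

module RamseyForTrees (P : Deg → Set) (adm : ∀ p → P p → Admissible p) where

  -- `lo` is the index of the preceding branch, and 0 at the start. Under a finite label the indices
  -- thus increase strictly from 1 to at most `p - 1`, as for `k` in `Step3`.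
  Slot : Deg → ℕ → ℕ → Set
  Slot (fin p) lo i = lo < i × i < p
  Slot ω       lo i = ⊤

  data Valid : Tree → Set
  data FValid (l : Deg) : ℕ → Forest → Set

  data Valid where
    valid : ∀ {l ts} → P l → FValid l 0 ts → Valid (node l ts)

  data FValid l where
    []   : ∀ {lo} → FValid l lo []
    cons : ∀ {lo i t ts} → Slot l lo i → Valid t → FValid l i ts → FValid l lo ((i , t) ∷ ts)

  FValid-ω : ∀ {lo lo′ ts} → FValid ω lo ts → FValid ω lo′ ts
  FValid-ω []           = []
  FValid-ω (cons _ v f) = cons tt v f

  FValid-++ : ∀ {lo ss ts} → FValid ω lo ss → FValid ω lo ts → FValid ω lo (ss ++ ts)
  FValid-++ []           g = FValid-ω g
  FValid-++ (cons _ v f) g = cons tt v (FValid-++ f (FValid-ω g))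

  FValid-raise : ∀ {p lo i t ts j} → j < i → FValid (fin p) lo ((i , t) ∷ ts)
               → FValid (fin p) j ((i , t) ∷ ts)
  FValid-raise j<i (cons (_ , i<p) v f) = cons (j<i , i<p) v f

  -- A branch needs a partner of the same index, and all indices in `ts` exceed `lo`. In `ramF-fin`
  -- this rules out skipping the branch of the right index.
  no-emb-above : ∀ {p i lo s ss ts} → i ≤ lo → FValid (fin p) lo ts
               → ¬ FEmb (fin p) ((i , s) ∷ ss) ts
  no-emb-above i≤lo (cons (lo<j , _) v f) (skip g) =
    no-emb-above (ℕ.≤-trans i≤lo (ℕ.<⇒≤ lo<j)) f g
  no-emb-above i≤lo (cons (lo<j , _) v f) (take refl _ _) = ℕ.<⇒≱ lo<j i≤lo

  -- Both trees become branches of a new root. Under a finite label the slots 1 and 2 exist because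
  -- admissible labels are at least 3.
  join : ∀ {s t} → Valid s → Valid t → Σ Tree λ u → Valid u × Emb s u × Emb t u
  join {node l ss} {t} vs@(valid pl _) vt =
    node l ((1 , node l ss) ∷ (2 , t) ∷ []) , valid pl (slots l (adm l pl)) , down (hd (idᴱ _)) , down (tl (hd (idᴱ _)))
    where
    slots : ∀ m → Admissible m → FValid m 0 ((1 , node l ss) ∷ (2 , t) ∷ [])
    slots (fin p) 3≤p = cons (s≤s z≤n , ℕ.<⇒≤ 3≤p) vs (cons (s≤s (s≤s z≤n) , 3≤p) vt [])
    slots ω       _   = cons tt vs (cons tt vt [])

  inlᶠ : ∀ {l} ss ts → FEmb l ss (ss ++ ts)
  inlᶠ     []             ts = emptyᶠ ts
  inlᶠ {l} ((i , s) ∷ ss) ts = take (matchRefl l) (idᴱ s) (inlᶠ ss ts)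

  inrᶠ : ∀ {l} ss ts → FEmb l ts (ss ++ ts)
  inrᶠ []       ts = idᶠ _ ts
  inrᶠ (_ ∷ ss) ts = skip (inrᶠ ss ts)

  FJoin : Deg → ℕ → Forest → Forest → Set
  FJoin l lo ss ts = Σ Forest λ us → FValid l lo us × FEmb l ss us × FEmb l ts us

  -- An index can be used only once, so two trees at the same index go into a single tree by `join`;
  -- the other branches are interleaved by index. The second function lets the recursion shorten
  -- either forest.
  merge : ∀ {p lo} ss ts → FValid (fin p) lo ss → FValid (fin p) lo ts → FJoin (fin p) lo ss ts
  merge∷ : ∀ {p lo} i s ss ts → FValid (fin p) lo ((i , s) ∷ ss) → FValid (fin p) lo ts
         → FJoin (fin p) lo ((i , s) ∷ ss) ts

  merge []             ts f g = ts , g , emptyᶠ ts , idᶠ _ ts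
  merge ((i , s) ∷ ss) ts f g = merge∷ i s ss ts f g

  merge∷ i s ss []             f g = (i , s) ∷ ss , f , idᶠ _ ((i , s) ∷ ss) , emptyᶠ ((i , s) ∷ ss)
  merge∷ i s ss ((j , t) ∷ ts) f@(cons (lo<i , i<p) vs f′) g@(cons (lo<j , j<p) vt g′)
    with ℕ.<-cmp i j
  ... | tri< i<j _ _ =
    let us , u , h , k = merge ss ((j , t) ∷ ts) f′ (FValid-raise i<j g) in
    (i , s) ∷ us , cons (lo<i , i<p) vs u , take refl (idᴱ s) h , skip k
  ... | tri> _ _ j<i =
    let us , u , h , k = merge∷ i s ss ts (FValid-raise j<i f) g′ in
    (j , t) ∷ us , cons (lo<j , j<p) vt u , skip h , take refl (idᴱ t) k
  ... | tri≈ _ refl _ =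
    let us , u , h , k = merge ss ts f′ g′
        w , vw , a , b = join vs vt
    in (i , w) ∷ us , cons (lo<i , i<p) vw u , take refl a h , take refl b k

  joinᶠ : ∀ l {lo} ss ts → FValid l lo ss → FValid l lo ts → FJoin l lo ss ts
  joinᶠ (fin p) ss ts f g = merge ss ts f g
  joinᶠ ω       ss ts f g = ss ++ ts , FValid-++ f g , inlᶠ ss ts , inrᶠ ss ts

  Ram : Tree → Set
  Ram A = ∀ B → Valid B → Σ Tree λ C → Valid C × ((χ : Emb A C → Bool) →
    Σ (Emb B C) λ h → Σ Bool λ c → ∀ f → χ (h ∘ᴱ f) ≡ c)

  -- The bound `lo` passes from `Bs` to `Cs`, so that a solution can stand behind the branches that
  -- precede `Bs`.
  RamF : Deg → Forest → Set
  RamF l As = ∀ lo Bs → FValid l lo Bs → Σ Forest λ Cs → FValid l lo Cs × ((χ : FEmb l As Cs → Bool) →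
    Σ (FEmb l Bs Cs) λ h → Σ Bool λ c → ∀ f → χ (h ∘ᶠ f) ≡ c)

  module _ {A : Tree} {l : Deg} {As : Forest} (ramA : Ram A) (ramAs : RamF l As) where

    -- The forest is fixed successively for each of the finitely many embeddings e of A.
    ramsey-family : ∀ {C} lo Ds → FValid l lo Ds → (es : List (Emb A C)) →
      Σ Forest λ Cs → FValid l lo Cs × ((χ : Emb A C → FEmb l As Cs → Bool) →
        Σ (FEmb l Ds Cs) λ h → ∀ e → e ∈ es → Σ Bool λ c → ∀ f → χ e (h ∘ᶠ f) ≡ c)
    ramsey-family lo Ds v []        = Ds , v , λ χ → idᶠ l Ds , λ _ ()
    ramsey-family lo Ds v (e₀ ∷ es) with ramsey-family lo Ds v es
    ... | Cs₁ , v₁ , hom₁ with ramAs lo Cs₁ v₁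
    ...   | Cs , v₂ , hom = Cs , v₂ , λ χ →
      let h₀ , c₀ , mono₀ = hom (χ e₀)
          h₁ , mono₁      = hom₁ (λ e f → χ e (h₀ ∘ᶠ f))
      in h₀ ∘ᶠ h₁ , λ where
        e (here refl) → c₀ , λ f → trans (cong (χ e) (sym (assocᶠ h₀ h₁ f))) (mono₀ (h₁ ∘ᶠ f))
        e (there e∈)  → let c , mono = mono₁ e e∈ in
                        c , λ f → trans (cong (χ e) (sym (assocᶠ h₀ h₁ f))) (mono f)

    -- `C` is chosen first, so that the embeddings of `A` into it are listed before the forest is
    -- built. On the forest copy the colour depends on `e` alone, and `ramA` makes this induced
    -- colouring of `Emb A C` constant.
    ramsey-product : ∀ lo D Ds → Valid D → FValid l lo Ds →
      Σ Tree λ C → Σ Forest λ Cs → Valid C × FValid l lo Cs × ((χ : Emb A C → FEmb l As Cs → Bool) →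
        Σ (Emb D C) λ h → Σ (FEmb l Ds Cs) λ hs → Σ Bool λ c →
          ∀ e f → χ (h ∘ᴱ e) (hs ∘ᶠ f) ≡ c)
    ramsey-product lo D Ds v vs with ramA D v
    ... | C , vC , hom with enumᴱ A C
    ...   | es , e∈ with ramsey-family lo Ds vs es
    ...     | Cs , vCs , homs = C , Cs , vC , vCs , λ χ →
      let hs , mono   = homs χ
          h , c , eq  = hom (λ e → proj₁ (mono e (e∈ e)))
      in h , hs , c , λ e f → trans (proj₂ (mono (h ∘ᴱ e) (e∈ _)) f) (eq e)

  -- The double induction on the two targets

  module _ (A : Tree) where

    Mono : ∀ {C} → (Emb A C → Bool) → Bool → Tree → Set
    Mono {C} χ c B = Σ (Emb B C) λ h → ∀ f → χ (h ∘ᴱ f) ≡ c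

    -- The asymmetric arrow of partition calculus. The colours are parameters, so that `swap` can
    -- exchange the roles of the two targets.
    Arrow : Bool → Tree → Bool → Tree → Tree → Set
    Arrow c B d B′ C = (χ : Emb A C → Bool) → Mono χ c B ⊎ Mono χ d B′

    data Arrows (c : Bool) (d : Bool) (B′ : Tree) : Forest → Forest → Set where
      []  : Arrows c d B′ [] []
      _∷_ : ∀ {i B C Bs Cs} → Arrow c B d B′ C → Arrows c d B′ Bs Cs
          → Arrows c d B′ ((i , B) ∷ Bs) ((i , C) ∷ Cs)

    MonoKids : Deg → ∀ {Cs} → (In A Cs → Bool) → Bool → Forest → Set
    MonoKids l {Cs} χ c Bs = Σ (FEmb l Bs Cs) λ g → ∀ f → χ (g ∘ᶠᴵ f) ≡ c

    MonoKid : ∀ {Cs} → (In A Cs → Bool) → Bool → Tree → Set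
    MonoKid {Cs} χ d B′ = Σ (In B′ Cs) λ h → ∀ f → χ (h ∘ᴵ f) ≡ d

    -- A single branch with `B′` in colour `d` settles the second alternative. If there is none,
    -- every branch contains its own `Bᵢ` in colour `c`, and a copy of `A` that misses the root lies
    -- in one branch, so colours cannot mix.
    arrowKids : ∀ l {c d B′ Bs Cs} → Arrows c d B′ Bs Cs → (χ : In A Cs → Bool)
              → MonoKids l χ c Bs ⊎ MonoKid χ d B′
    arrowKids l []       χ = inj₁ (done , λ ())
    arrowKids l (a ∷ as) χ with a (χ ∘ hd) | arrowKids l as (χ ∘ tl)
    ... | inj₂ (h , mono) | _               = inj₂ (hd h , mono)
    ... | inj₁ _          | inj₂ (h , mono) = inj₂ (tl h , mono)
    ... | inj₁ (h , mono) | inj₁ (g , monog) =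
      inj₁ (take (matchRefl l) h g , λ { (hd f) → mono f ; (tl f) → monog f })

  module _ {p : Deg} {As : Forest} (ramAs : RamF p As) where

    private
      A : Tree
      A = node p As

    -- With `l ≢ p` no copy of `A` has its root at the root, so the branches alone decide.
    arrow-skip : ∀ {c d l Bs B′ Xs} → l ≢ p → Arrows A c d B′ Bs Xs
               → Arrow A c (node l Bs) d B′ (node l Xs)
    arrow-skip {l = l} l≢p arr χ with arrowKids A l arr (χ ∘ down)
    ... | inj₁ (g , mono) = inj₁ (top g , λ { (top _) → ⊥-elim (l≢p refl) ; (down f) → mono f })
    ... | inj₂ (h , mono) = inj₂ (down h , mono)

    -- On the image of `k` all copies of `A` at the root already have the colour wanted for the
    -- first target; the copies inside branches are left to `arrowKids`.
    arrow-top : ∀ {c d Bs B′ Xs Cs} → Arrows A c d B′ Bs Xs → (χ : Emb A (node p Cs) → Bool)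
              → (k : FEmb p Xs Cs) → (∀ f → χ (top (k ∘ᶠ f)) ≡ c)
              → Mono A χ c (node p Bs) ⊎ Mono A χ d B′
    arrow-top {c} {d} arr χ k hom with arrowKids A p arr (λ f → χ (down (k ∘ᶠᴵ f)))
    ... | inj₁ (g , mono) = inj₁ (top (k ∘ᶠ g) , λ where
      (top f)  → trans (cong (χ ∘ top) (sym (assocᶠ k g f))) (hom (g ∘ᶠ f))
      (down f) → trans (cong (χ ∘ down) (sym (assocᶠᴵ k g f))) (mono f))
    ... | inj₂ (h , mono) = inj₂ (down (k ∘ᶠᴵ h) , λ f →
      trans (cong (χ ∘ down) (sym (assocᶠᴵᴱ k h f))) (mono f))

    swap : ∀ {c d B B′ C} → Arrow A c B d B′ C → Arrow A d B′ c B C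
    swap arr χ = [ inj₂ , inj₁ ]′ (arr χ)

    -- Each recursive call shrinks one of the two targets and keeps the other, so the mutual
    -- recursion terminates.
    arrow : ∀ B B′ → Valid B → Valid B′ → Σ Tree λ C → Valid C × Arrow A true B false B′ C
    kidsˡ : ∀ {l lo} Bs B′ → FValid l lo Bs → Valid B′
          → Σ Forest λ Cs → FValid l lo Cs × Arrows A true false B′ Bs Cs
    kidsʳ : ∀ {l lo} B Bs′ → Valid B → FValid l lo Bs′
          → Σ Forest λ Cs → FValid l lo Cs × Arrows A false true B Bs′ Cs

    arrow B@(node l Bs) B′@(node m Bs′) v@(valid pl vs) v′@(valid pm vs′)
      with kidsˡ Bs B′ vs v′ | kidsʳ B Bs′ v vs′ | l ≟ᴰ p | m ≟ᴰ p
    ... | Xs , vX , arrX | _ | no l≢p | _ = node l Xs , valid pl vX , arrow-skip l≢p arrX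
    ... | _ | Ys , vY , arrY | yes _ | no m≢p = node m Ys , valid pm vY , swap (arrow-skip m≢p arrY)
    -- The colour of the copies at the root comes out only later: red continues with `Xs`, blue with
    -- `Ys`. Both must therefore embed into the forest that is made homogeneous.
    ... | Xs , vX , arrX | Ys , vY , arrY | yes refl | yes refl with joinᶠ l Xs Ys vX vY
    ...   | Zs , vZ , inX , inY with ramAs 0 Zs vZ
    ...     | Cs , vC , hom = node l Cs , valid pl vC , colour
      where
      colour : Arrow A true B false B′ (node l Cs)
      colour χ with hom (χ ∘ top)
      ... | h , true , mono = arrow-top arrX χ (h ∘ᶠ inX) λ f →
              trans (cong (χ ∘ top) (sym (assocᶠ h inX f))) (mono (inX ∘ᶠ f))
      ... | h , false , mono = [ inj₂ , inj₁ ]′ (arrow-top arrY χ (h ∘ᶠ inY) λ f →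
              trans (cong (χ ∘ top) (sym (assocᶠ h inY f))) (mono (inY ∘ᶠ f)))

    kidsˡ []             B′ []            v′ = [] , [] , []
    kidsˡ ((i , b) ∷ Bs) B′ (cons s v vs) v′ with arrow b B′ v v′ | kidsˡ Bs B′ vs v′
    ... | C , vC , arr | Cs , vCs , arrs = (i , C) ∷ Cs , cons s vC vCs , arr ∷ arrs

    kidsʳ B []              v []              = [] , [] , []
    kidsʳ B ((i , b) ∷ Bs′) v (cons s v′ vs′) with arrow B b v v′ | kidsʳ B Bs′ v vs′
    ... | C , vC , arr | Cs , vCs , arrs = (i , C) ∷ Cs , cons s vC vCs , swap arr ∷ arrs

    ram-node : Ram A
    ram-node B v with arrow B B v v
    ... | C , vC , arr = C , vC , λ χ → [ (λ { (h , mono) → h , true , mono })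
                                        , (λ { (h , mono) → h , false , mono }) ]′ (arr χ)

  -- Ramsey theorem for forests

  ramF-[] : ∀ {l} → RamF l []
  ramF-[] {l} lo Bs v = Bs , v , λ χ → idᶠ l Bs , χ (emptyᶠ Bs) , λ f → cong χ (emptyᶠ-unique _ _)

  -- Branch `i` can only go to a branch of index `i`. A first branch of another index is skipped by
  -- every embedding and stays as it is; at the right index an embedding is a pair of embeddings of
  -- `A` and of `As`, and the product theorem applies.
  ramF-fin : ∀ {p i A As} → Ram A → RamF (fin p) As → RamF (fin p) ((i , A) ∷ As)
  ramF-fin         ramA ramAs lo []             []            = [] , [] , λ χ → done , true , λ ()
  ramF-fin {i = i} ramA ramAs lo ((j , B) ∷ Bs) (cons s v vs) with i ℕ.≟ j
  ... | no i≢j with ramF-fin ramA ramAs j Bs vs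
  ...   | Cs , vC , hom = (j , B) ∷ Cs , cons s v vC , λ χ →
    let h , c , mono = hom (χ ∘ skip) in
    take refl (idᴱ B) h , c , λ { (skip f) → mono f ; (take i≡j _ _) → ⊥-elim (i≢j i≡j) }
  ramF-fin {p} {i} ramA ramAs lo ((j , B) ∷ Bs) (cons s v vs) | yes refl
    with ramsey-product ramA ramAs j B Bs v vs
  ... | C , Cs , vC , vCs , hom = (j , C) ∷ Cs , cons s vC vCs , λ χ →
    let h , hs , c , mono = hom (λ e f → χ (take refl e f)) in
    take refl h hs , c , λ { (skip f)        → ⊥-elim (no-emb-above ℕ.≤-refl vs f)
                           ; (take refl e f) → mono e f }

  module _ {i : ℕ} {A : Tree} {As : Forest} (ramA : Ram A) (ramAs : RamF ω As) where

    MonoF : ∀ {Cs} → (FEmb ω ((i , A) ∷ As) Cs → Bool) → Bool → Forest → Set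
    MonoF {Cs} χ c Bs = Σ (FEmb ω Bs Cs) λ h → ∀ f → χ (h ∘ᶠ f) ≡ c

    ArrowF : Bool → Forest → Bool → Forest → Forest → Set
    ArrowF c Bs d Bs′ Cs = (χ : FEmb ω ((i , A) ∷ As) Cs → Bool) → MonoF χ c Bs ⊎ MonoF χ d Bs′

    -- Copies that send `A` into the first branch have colour `c` by hypothesis; the others skip
    -- this branch and are handled through `L`. A `bs` of colour `c` found there can thus be
    -- preceded by `b`, and a `Bs′` of colour `d` is already complete.
    arrowF-step : ∀ {c d b bs Bs′ L C Cs j k} → ArrowF c bs d Bs′ L
                → (χ : FEmb ω ((i , A) ∷ As) ((k , C) ∷ Cs) → Bool) → (g : Emb b C) (q : FEmb ω L Cs)
                → (∀ e f → χ (take tt (g ∘ᴱ e) (q ∘ᶠ f)) ≡ c)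
                → MonoF χ c ((j , b) ∷ bs) ⊎ MonoF χ d Bs′
    arrowF-step arr χ g q hom with arr (λ f → χ (skip (q ∘ᶠ f)))
    ... | inj₁ (h , mono) = inj₁ (take tt g (q ∘ᶠ h) , λ where
      (skip f)     → trans (cong (χ ∘ skip) (sym (assocᶠ q h f))) (mono f)
      (take _ e f) → trans (cong (χ ∘ take tt (g ∘ᴱ e)) (sym (assocᶠ q h f))) (hom e (h ∘ᶠ f)))
    ... | inj₂ (h , mono) = inj₂ (skip (q ∘ᶠ h) , λ f →
      trans (cong (χ ∘ skip) (sym (assocᶠ q h f))) (mono f))

    arrowF : ∀ {lo} Bs Bs′ → FValid ω lo Bs → FValid ω lo Bs′
           → Σ Forest λ Cs → FValid ω lo Cs × ArrowF true Bs false Bs′ Cs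
    -- The empty forest contains no copy of a nonempty one, so an empty target is homogeneous in
    -- either colour.
    arrowF []       Bs′      vs vs′ = [] , [] , λ χ → inj₁ (done , λ ())
    arrowF (_ ∷ _)  []       vs vs′ = [] , [] , λ χ → inj₂ (done , λ ())
    arrowF {lo} Bs@((j , b) ∷ bs) Bs′@((j′ , b′) ∷ bs′) v@(cons _ vb vbs) v′@(cons _ vb′ vbs′)
      with arrowF {lo} bs Bs′ (FValid-ω vbs) v′ | arrowF {lo} Bs bs′ v (FValid-ω vbs′) | join vb vb′
    -- The colour of the copies that use the first branch is again unknown in advance: `x` has room
    -- for `b` and for `b′`, and `L ++ R` for both continuations.
    ... | L , vL , arrL | R , vR , arrR | x , vx , inb , inb′
      with ramsey-product ramA ramAs lo x (L ++ R) vx (FValid-++ vL vR)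
    ... | C , Cs , vC , vCs , hom = (0 , C) ∷ Cs , cons tt vC (FValid-ω vCs) , colour
      where
      colour : ArrowF true Bs false Bs′ ((0 , C) ∷ Cs)
      colour χ with hom (λ e f → χ (take tt e f))
      ... | h , hs , true , mono = arrowF-step arrL χ (h ∘ᴱ inb) (hs ∘ᶠ inlᶠ L R) λ e f →
              trans (cong₂ (λ a b → χ (take tt a b)) (sym (assocᴱ h inb e)) (sym (assocᶠ hs (inlᶠ L R) f)))
                    (mono (inb ∘ᴱ e) (inlᶠ L R ∘ᶠ f))
      ... | h , hs , false , mono = [ inj₂ , inj₁ ]′ (arrowF-step
              (λ ψ → [ inj₂ , inj₁ ]′ (arrR ψ)) χ (h ∘ᴱ inb′) (hs ∘ᶠ inrᶠ L R) λ e f →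
              trans (cong₂ (λ a b → χ (take tt a b)) (sym (assocᴱ h inb′ e)) (sym (assocᶠ hs (inrᶠ L R) f)))
                    (mono (inb′ ∘ᴱ e) (inrᶠ L R ∘ᶠ f)))

    ramF-ω : RamF ω ((i , A) ∷ As)
    ramF-ω lo Bs v with arrowF Bs Bs v v
    ... | Cs , vC , arr = Cs , vC , λ χ → [ (λ { (h , mono) → h , true , mono })
                                          , (λ { (h , mono) → h , false , mono }) ]′ (arr χ)

  ramsey-tree : ∀ A → Ram A
  ramsey-forest : ∀ l As → RamF l As
  ramsey-tree (node p As) = ram-node (ramsey-forest p As)
  ramsey-forest l       []             = ramF-[]
  ramsey-forest (fin p) ((i , A) ∷ As) = ramF-fin (ramsey-tree A) (ramsey-forest (fin p) As)
  ramsey-forest ω       ((i , A) ∷ As) = ramF-ω (ramsey-tree A) (ramsey-forest ω As)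

  -- More than two colours

  isZero : ∀ {r} → Fin (suc r) → Bool
  isZero zero    = true
  isZero (suc _) = false

  isZero⇒≡ : ∀ {r} (i : Fin (suc r)) → isZero i ≡ true → i ≡ zero
  isZero⇒≡ zero _ = refl

  -- The default is met only at colour zero, which does not occur in the copy where this function is
  -- used.
  predOr : ∀ {r} → Fin r → Fin (suc r) → Fin r
  predOr d zero    = d
  predOr d (suc i) = i

  suc-predOr : ∀ {r} (d : Fin r) i → isZero i ≡ false → i ≡ suc (predOr d i)
  suc-predOr d (suc i) _ = refl

  -- Colour zero is red, all others together are blue. The blue target is a solution `C₁` for one
  -- colour less, so that a blue `C₁` still contains a monochromatic `B`; here the two targets of
  -- `arrow` really differ.
  ramsey-colours : ∀ r A B → Valid B → Σ Tree λ C → Valid C × ((χ : Emb A C → Fin (suc r)) →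
    Σ (Emb B C) λ h → Σ (Fin (suc r)) λ c → ∀ f → χ (h ∘ᴱ f) ≡ c)
  ramsey-colours zero    A            B v = B , v , λ χ → idᴱ B , zero , λ f → Fin0 (χ (idᴱ B ∘ᴱ f))
    where
    Fin0 : (i : Fin 1) → i ≡ zero
    Fin0 zero = refl
  ramsey-colours (suc r) A@(node p As) B v with ramsey-colours r A B v
  ... | C₁ , v₁ , hom with arrow (ramsey-forest p As) B C₁ v v₁
  ...   | C , vC , arr = C , vC , colour
    where
    colour : (χ : Emb A C → Fin (suc (suc r))) →
             Σ (Emb B C) λ h → Σ (Fin (suc (suc r))) λ c → ∀ f → χ (h ∘ᴱ f) ≡ c
    colour χ with arr (isZero ∘ χ)
    ... | inj₁ (h , mono) = h , zero , λ f → isZero⇒≡ _ (mono f)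
    ... | inj₂ (g , mono) with hom (λ f → predOr zero (χ (g ∘ᴱ f)))
    ...   | h , c , eq = g ∘ᴱ h , suc c , λ f →
      trans (cong χ (sym (assocᴱ g h f)))
            (trans (suc-predOr zero _ (mono (h ∘ᴱ f))) (cong suc (eq f)))

-- Paths in trees

unique-reverse : ∀ {X : Set} (xs : List X) → Unique xs → Unique (reverse xs)
unique-reverse []       _          = []
unique-reverse (x ∷ xs) (x∉ ∷ uxs) rewrite List.unfold-reverse x xs =
  Unique.++⁺ (unique-reverse xs uxs) ([] ∷ [])
    λ { (v∈ , here refl) → All.All¬⇒¬Any x∉ (Any.reverse⁻ v∈) }

unique-head : ∀ {X : Set} {x : X} {xs} → Unique (x ∷ xs) → x ∉ xs
unique-head (x∉ ∷ _) x∈ = All.All¬⇒¬Any x∉ x∈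

unique-tail : ∀ {X : Set} {x : X} {xs} → Unique (x ∷ xs) → Unique xs
unique-tail (_ ∷ u) = u

unique-cons : ∀ {X : Set} {x : X} {xs} → x ∉ xs → Unique xs → Unique (x ∷ xs)
unique-cons x∉ u = All.¬Any⇒All¬ _ x∉ ∷ u

module Walks {V : Set} (_≟_ : DecidableEquality V) (E : V → V → Set) where

  open DecMembership _≟_ using (_∈?_)

  walk-head : ∀ {a b l} → Walk E a b l → ∃ λ m → l ≡ a ∷ m
  walk-head here       = _ , refl
  walk-head (step _ _) = _ , refl

  head∈ : ∀ {a b l} → Walk E a b l → a ∈ l
  head∈ here       = here refl
  head∈ (step _ _) = here refl

  last∈ : ∀ {a b l} → Walk E a b l → b ∈ l
  last∈ here       = here refl
  last∈ (step _ w) = there (last∈ w)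

  infixr 5 _++ʷ_
  _++ʷ_ : ∀ {a b c l m} → Walk E a b l → Walk E b c (b ∷ m) → Walk E a c (l ++ m)
  here     ++ʷ w = w
  step e v ++ʷ w = step e (v ++ʷ w)

  join-walks : ∀ {a b c l m} → Walk E a b l → Walk E b c m
             → ∃ λ k → Walk E a c k × (∀ {v} → v ∈ k → v ∈ l ⊎ v ∈ m)
  join-walks {l = l} v w with walk-head w
  ... | m , refl = l ++ m , v ++ʷ w , λ x∈ → [ inj₁ , inj₂ ∘ there ]′ (∈-++⁻ l x∈)

  suffix : ∀ {a b v l} → Walk E a b l → v ∈ l
         → ∃ λ m → Walk E v b m × (Unique l → Unique m) × (∀ {x} → x ∈ m → x ∈ l)
  suffix w@here       (here refl) = _ , w , id , id
  suffix w@(step _ _) (here refl) = _ , w , id , id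
  suffix (step _ w)   (there v∈)  with suffix w v∈
  ... | m , w′ , u , m⊆ = m , w′ , (λ { (_ ∷ ul) → u ul }) , there ∘ m⊆

  shorten : ∀ {a b l} → Walk E a b l → ∃ λ p → Path E a b p × (∀ {x} → x ∈ p → x ∈ l)
  shorten here = _ , (here , [] ∷ []) , id
  shorten {a} (step e w) with shorten w
  ... | p , (w′ , u) , p⊆ with a ∈? p
  ...   | no a∉p = a ∷ p , (step e w′ , unique-cons a∉p u) , λ { (here eq) → here eq ; (there x∈) → there (p⊆ x∈) }
  ...   | yes a∈p with suffix w′ a∈p
  ...     | m , w″ , um , m⊆ = m , (w″ , um u) , λ x∈ → there (p⊆ (m⊆ x∈))

  module _ (symm : ∀ {a b} → E a b → E b a) where

    reverseʷ : ∀ {a b l} → Walk E a b l → Walk E b a (reverse l)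
    reverseʷ here = here
    reverseʷ (step {a} {l = l} e w) rewrite List.unfold-reverse a l =
      reverseʷ w ++ʷ step (symm e) here

    module _ (acyclic : ¬ HasCycle E) where

      -- Where two paths part after `a`, their continuations connect `x` with `y` through the common
      -- end and avoid `a`. Shortened and closed up by `a`, they form a cycle, which has at least
      -- three vertices because `x ≢ y`.
      path-unique : ∀ {a b l m} → Path E a b l → Path E a b m → l ≡ m
      path-unique (here , _)     (here , _)     = refl
      path-unique (here , _)     (step _ w , u) = ⊥-elim (unique-head u (last∈ w))
      path-unique (step _ w , u) (here , _)     = ⊥-elim (unique-head u (last∈ w))
      path-unique {a} (step {b = x} e v , u) (step {b = y} e′ w , u′) with x ≟ y
      ... | yes refl = cong (a ∷_) (path-unique (v , unique-tail u) (w , unique-tail u′))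
      ... | no  x≢y  with join-walks v (reverseʷ w)
      ...   | k , vw , k⊆ with shorten vw
      ...     | p , (q , up) , p⊆ = ⊥-elim (acyclic (a , y , a ∷ p , (step e q , unique-cons a∉p up) , long q , symm e′))
        where
        a∉p : a ∉ p
        a∉p a∈ with k⊆ (p⊆ a∈)
        ... | inj₁ a∈v = unique-head u a∈v
        ... | inj₂ a∈w = unique-head u′ (Any.reverse⁻ a∈w)
        long : ∀ {p} → Walk E x y p → 3 ≤ length (a ∷ p)
        long here                = ⊥-elim (x≢y refl)
        long (step _ here)       = s≤s (s≤s (s≤s z≤n))
        long (step _ (step _ _)) = s≤s (s≤s (s≤s z≤n))

-- A rooted tree as computable data: ancestors are found by iterating `par`, and `dep` bounds the
-- iteration. The passage to and from `IsTree` follows, given decidable equality of vertices.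
record Parented {V : Set} (E : V → V → Set) (r : V) : Set where
  field
    par     : V → V
    dep     : V → ℕ
    dep-par : ∀ {x} → x ≢ r → dep x ≡ suc (dep (par x))
    edge⁺   : ∀ {x} → x ≢ r → E x (par x)
    edge⁻   : ∀ {x y} → E x y → (x ≢ r × par x ≡ y) ⊎ (y ≢ r × par y ≡ x)

  par-below : ∀ {x} → x ≢ r → dep (par x) < dep x
  par-below x≢r = ℕ.≤-reflexive (sym (dep-par x≢r))

module _ {V : Set} (_≟_ : DecidableEquality V) {E : V → V → Set} where

  open DecMembership _≟_ using (_∈?_)
  open Walks _≟_ E

  secondOr : V → List V → V
  secondOr d (_ ∷ x ∷ _) = x
  secondOr d _           = d

  -- The parent of a vertex is the next vertex on its path to the root.
  tree⇒parented : IsTree E → ∀ r → Parented E r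
  tree⇒parented tree r = record
    { par     = par
    ; dep     = λ x → length (path x)
    ; dep-par = λ x≢r → cong length (proj₁ (path-step x≢r))
    ; edge⁺   = λ x≢r → proj₂ (path-step x≢r)
    ; edge⁻   = edge⁻
    }
    where
    open IsTree tree

    root-path : ∀ x → ∃ λ p → Path E x r p
    root-path x = let p , pth , _ = shorten (proj₂ (connected x r)) in p , pth

    path : V → List V
    path x = proj₁ (root-path x)

    par : V → V
    par x = secondOr x (path x)

    path-≡ : ∀ {x p} → Path E x r p → path x ≡ p
    path-≡ {x} = path-unique symm acyclic (proj₂ (root-path x))

    path-step : ∀ {x} → x ≢ r → path x ≡ x ∷ path (par x) × E x (par x)
    path-step {x} x≢r = go (proj₂ (root-path x))
      where
      go : ∀ {p} → Path E x r p → p ≡ x ∷ path (secondOr x p) × E x (secondOr x p)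
      go (here , _) = ⊥-elim (x≢r refl)
      go (step e w , u) with walk-head w
      ... | _ , refl = cong (x ∷_) (sym (path-≡ (w , unique-tail u))) , e

    extend : ∀ {x y m} → E x y → Path E y r m → x ∉ m → x ≢ r × par x ≡ y
    extend {x} {y} {m} e (w , u) x∉ = (λ { refl → x∉ (last∈ w) }) , par≡
      where
      par≡ : par x ≡ y
      par≡ with walk-head w
      ... | _ , refl = cong (secondOr x) (path-≡ (step e w , unique-cons x∉ u))

    par-of-edge : ∀ {x y p} → E x y → Path E x r p → y ∈ p → x ≢ r × par x ≡ y
    par-of-edge {x} e (here , _)     (here refl) = ⊥-elim (irrefl x e)
    par-of-edge {x} e (step _ _ , _) (here refl) = ⊥-elim (irrefl x e)
    par-of-edge     e (step _ w , u) (there y∈)  with suffix w y∈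
    ... | m , v , um , m⊆ = extend e (v , um (unique-tail u)) (unique-head u ∘ m⊆)

    edge⁻ : ∀ {x y} → E x y → (x ≢ r × par x ≡ y) ⊎ (y ≢ r × par y ≡ x)
    -- If `y` lies on the path of `x`, its part from `y` on avoids `x`; otherwise the path of `x`
    -- avoids `y`. Either way the edge prolongs the root path of one end to that of the other.
    edge⁻ {x} {y} e with y ∈? path x
    ... | no  y∉ = inj₂ (extend (symm e) (proj₂ (root-path x)) y∉)
    ... | yes y∈ = inj₁ (par-of-edge e (proj₂ (root-path x)) y∈)

  module _ {r : V} (pr : Parented E r) (symm : ∀ {a b} → E a b → E b a) where

    open Parented pr

    private
      walk-to-root : ∀ n x → dep x ≤ n → ∃ λ l → Walk E x r l
      walk-to-root n x d≤n with x ≟ r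
      ... | yes refl = _ , here
      walk-to-root zero    x d≤n | no x≢r with dep x | dep-par x≢r
      walk-to-root zero    x ()  | no x≢r | _ | refl
      walk-to-root (suc n) x d≤n | no x≢r =
        let l , w = walk-to-root n (par x) (ℕ.≤-pred (subst (_≤ suc n) (dep-par x≢r) d≤n))
        in x ∷ l , step (edge⁺ x≢r) w

      -- A path that has once left a vertex for a child keeps descending.
      descending : ∀ {a c b m} → Walk E c b m → Unique (a ∷ m) → c ≢ r → par c ≡ a
                 → dep b ≡ dep a + length m × par b ∈ a ∷ m
      descending {a} {c} here u c≢r refl = trans (dep-par c≢r) (ℕ.+-comm 1 (dep a)) , here refl
      descending {a} {c} (step {l = l} e w) u c≢r refl with edge⁻ e
      ... | inj₁ (_ , refl) = ⊥-elim (unique-head u (there (head∈ w)))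
      ... | inj₂ (d≢r , pd) with descending w (unique-tail u) d≢r pd
      ...   | eq , par∈ = trans eq (trans (cong (_+ length l) (dep-par c≢r)) (sym (ℕ.+-suc (dep a) (length l))))
                        , there par∈

      -- The path starts less deep than `a` and stays so while it climbs. Once it descends,
      -- `descending` puts the parent of its end on the path; this parent is `a`, which the path
      -- avoids.
      no-way-back : ∀ {a b c m} → Walk E c b m → Unique m → a ∉ m → dep c < dep a
                  → b ≢ r → par b ≡ a → ⊥
      no-way-back {b = b} here u a∉ c<a b≢r refl =
        ℕ.<-asym c<a (par-below b≢r)
      no-way-back (step e w) u a∉ c<a b≢r refl with edge⁻ e
      ... | inj₁ (c≢r , refl) = no-way-back w (unique-tail u) (a∉ ∘ there)
              (ℕ.<-trans (par-below c≢r) c<a) b≢r refl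
      ... | inj₂ (d≢r , pd) = a∉ (proj₂ (descending w u d≢r pd))

      -- The two edges of the cycle at `a` are compared. If the first goes down, the end `b` gets
      -- too deep for a neighbour of `a`; if both lead to the parent of `a`, a vertex repeats; if
      -- the first goes up and the last comes from a child, `no-way-back` applies.
      no-cycle : ¬ HasCycle E
      no-cycle (a , .a , _ , (here , _) , s≤s () , _)
      no-cycle (a , b , _ , (step e w , u) , s≤s 2≤m , back) with edge⁻ e | edge⁻ back
      ... | inj₂ (c≢r , pc) | inj₁ (b≢r , refl) =
        ℕ.<⇒≢ 2≤m (sym (ℕ.+-cancelˡ-≡ (dep a) _ 1
          (trans (sym (proj₁ (descending w u c≢r pc)))
                 (trans (dep-par b≢r) (ℕ.+-comm 1 (dep a))))))
      ... | inj₂ (c≢r , pc) | inj₂ (a≢r , refl) =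
        ℕ.m+1+n≢m (dep b) (sym (trans (proj₁ (descending w u c≢r pc)) (trans (cong (_+ _) (dep-par a≢r)) (sym (ℕ.+-suc (dep b) _)))))
      ... | inj₁ (a≢r , refl) | inj₂ (_ , refl) with w
      ...   | here      = case-2≤1 2≤m
        where
        case-2≤1 : ¬ 2 ≤ 1
        case-2≤1 (s≤s ())
      ...   | step _ w′ = unique-head (unique-tail u) (last∈ w′)
      no-cycle (a , b , _ , (step e w , u) , _ , _) | inj₁ (a≢r , refl) | inj₁ (b≢r , pb) =
        no-way-back w (unique-tail u) (unique-head u)
          (par-below a≢r) b≢r pb

    parented⇒tree : IsTree E
    parented⇒tree = record
      { nonempty  = r
      ; symm      = symm
      ; irrefl    = λ a e → no-loop a (edge⁻ e)
      ; connected = λ a b →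
          let l , v     = walk-to-root (dep a) a ℕ.≤-refl
              m , w     = walk-to-root (dep b) b ℕ.≤-refl
              k , x , _ = join-walks v (reverseʷ symm w)
          in k , x
      ; acyclic   = no-cycle
      }
      where
      no-loop : ∀ a → ¬ ((a ≢ r × par a ≡ a) ⊎ (a ≢ r × par a ≡ a))
      no-loop a (inj₁ (a≢r , eq)) = ℕ.1+n≢n (sym (trans (dep-par a≢r) (cong (suc ∘ dep) eq)) )
      no-loop a (inj₂ (a≢r , eq)) = ℕ.1+n≢n (sym (trans (dep-par a≢r) (cong (suc ∘ dep) eq)) )

-- The tree order

module Ancestors {V : Set} (_≟_ : DecidableEquality V) {E : V → V → Set} {r : V} (pr : Parented E r) where

  open Parented pr public

  data Anc (x : V) : V → Set where
    self : Anc x x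
    up   : ∀ {y} → y ≢ r → Anc x (par y) → Anc x y

  abstract

    anc-trans : ∀ {x y z} → Anc x y → Anc y z → Anc x z
    anc-trans p self     = p
    anc-trans p (up n q) = up n (anc-trans p q)

    anc-par : ∀ {x} → x ≢ r → Anc (par x) x
    anc-par x≢r = up x≢r self

    anc-dep : ∀ {x y} → Anc x y → x ≡ y ⊎ dep x < dep y
    anc-dep self     = inj₁ refl
    anc-dep (up n p) with anc-dep p
    ... | inj₁ refl = inj₂ (par-below n)
    ... | inj₂ lt   = inj₂ (ℕ.<-trans lt (par-below n))

    anc-antisym : ∀ {x y} → Anc x y → Anc y x → x ≡ y
    anc-antisym p q with anc-dep p | anc-dep q
    ... | inj₁ eq | _       = eq
    ... | inj₂ _  | inj₁ eq = sym eq
    ... | inj₂ a  | inj₂ b  = ⊥-elim (ℕ.<-asym a b)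

    anc-below-par : ∀ {x y} → Anc x y → x ≢ y → y ≢ r × Anc x (par y)
    anc-below-par self     x≢y = ⊥-elim (x≢y refl)
    anc-below-par (up n p) _   = n , p

    anc-r : ∀ {x} → Anc x r → x ≡ r
    anc-r self     = refl
    anc-r (up n _) = ⊥-elim (n refl)

    par-not-anc : ∀ {x} → x ≢ r → ¬ Anc x (par x)
    par-not-anc x≢r p with anc-dep p
    ... | inj₁ eq = ℕ.<-irrefl (cong dep (sym eq)) (par-below x≢r)
    ... | inj₂ lt = ℕ.<-asym lt (par-below x≢r)

    dep-ind : (Q : V → Set) → Q r → (∀ x → x ≢ r → Q (par x) → Q x) → ∀ x → Q x
    dep-ind Q base st x = go (dep x) x ℕ.≤-refl
      where
      go : ∀ n x → dep x ≤ n → Q x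
      go n x d≤n with x ≟ r
      ... | yes refl = base
      go zero    x d≤n | no x≢r = ⊥-elim (ℕ.n≮0 (ℕ.≤-trans (par-below x≢r) d≤n))
      go (suc n) x d≤n | no x≢r =
        st x x≢r (go n (par x) (ℕ.≤-pred (ℕ.≤-trans (par-below x≢r) d≤n)))

    root-anc : ∀ x → Anc r x
    root-anc = dep-ind (Anc r) self (λ _ → up)

    anc? : ∀ x y → Dec (Anc x y)
    anc? x = dep-ind (λ y → Dec (Anc x y)) base st
      where
      base : Dec (Anc x r)
      base with x ≟ r
      ... | yes refl = yes self
      ... | no  x≢r  = no (x≢r ∘ anc-r)
      st : ∀ y → y ≢ r → Dec (Anc x (par y)) → Dec (Anc x y)
      st y y≢r (yes p) = yes (up y≢r p)
      st y y≢r (no ¬p) with x ≟ y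
      ... | yes refl = yes self
      ... | no  x≢y  = no (¬p ∘ λ p → proj₂ (anc-below-par p x≢y))

    anc-chain : ∀ {x y z} → Anc x z → Anc y z → Anc x y ⊎ Anc y x
    anc-chain self     q        = inj₂ q
    anc-chain (up n p) self     = inj₁ (up n p)
    anc-chain (up _ p) (up _ q) = anc-chain p q

  Child : V → V → Set
  Child x c = c ≢ r × par c ≡ x

  abstract

    child-anc : ∀ {x c} → Child x c → Anc x c
    child-anc (c≢r , refl) = anc-par c≢r

    child-not-anc : ∀ {x c} → Child x c → ¬ Anc c x
    child-not-anc (c≢r , refl) = par-not-anc c≢r

    child-towards : ∀ {x y} → Anc x y → x ≢ y → ∃ λ c → Child x c × Anc c y
    child-towards self x≢y = ⊥-elim (x≢y refl)
    child-towards {x} (up {y} n p) _ with x ≟ par y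
    ... | yes refl = y , (n , refl) , self
    ... | no  x≢p  with child-towards p x≢p
    ...   | c , ch , q = c , ch , up n q

    children-incomparable : ∀ {x c d} → Child x c → Child x d → Anc c d → c ≡ d
    children-incomparable {c = c} {d} ch (d≢r , refl) p with c ≟ d
    ... | yes eq  = eq
    ... | no  c≢d = ⊥-elim (child-not-anc ch (proj₂ (anc-below-par p c≢d)))

    children-disjoint : ∀ {x c d y} → Child x c → Child x d → Anc c y → Anc d y → c ≡ d
    children-disjoint ch dh p q with anc-chain p q
    ... | inj₁ pq = children-incomparable ch dh pq
    ... | inj₂ qp = sym (children-incomparable dh ch qp)

  IsMeet : V → V → V → Set
  IsMeet a b m = Anc m a × Anc m b × (∀ d → Anc d a → Anc d b → Anc d m)

  abstract

    meet : ∀ a b → ∃ (IsMeet a b)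
    meet a b = dep-ind (λ a → ∃ (IsMeet a b)) (r , self , root-anc b , λ _ p _ → p) st a
      where
      st : ∀ a → a ≢ r → ∃ (IsMeet (par a) b) → ∃ (IsMeet a b)
      st a a≢r (m , p , q , g) with anc? a b
      ... | yes ab = a , self , ab , λ _ p _ → p
      ... | no ¬ab = m , up a≢r p , q , λ d da db →
        g d (proj₂ (anc-below-par da λ { refl → ¬ab db })) db

    meet-unique : ∀ {a b m n} → IsMeet a b m → IsMeet a b n → m ≡ n
    meet-unique (ma , mb , gm) (na , nb , gn) = anc-antisym (gn _ ma mb) (gm _ na nb)

    meet-sym : ∀ {a b m} → IsMeet a b m → IsMeet b a m
    meet-sym (p , q , g) = q , p , λ d da db → g d db da

    meet-below : ∀ {a b} → Anc a b → IsMeet a b a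
    meet-below p = self , p , λ _ q _ → q

    children-meet : ∀ {x c d a b} → Child x c → Child x d → c ≢ d → Anc c a → Anc d b → IsMeet a b x
    children-meet {x} {c} {d} {a} {b} ch dh c≢d ca db =
      anc-trans (child-anc ch) ca , anc-trans (child-anc dh) db , greatest
      where
      greatest : ∀ y → Anc y a → Anc y b → Anc y x
      greatest y ya yb with anc-chain ya ca
      ... | inj₂ cy = ⊥-elim (c≢d (children-disjoint ch dh (anc-trans cy yb) db))
      ... | inj₁ yc with y ≟ c
      ...   | yes refl = ⊥-elim (c≢d (children-disjoint ch dh yb db))
      ...   | no  y≢c  = subst (Anc y) (proj₂ ch) (proj₂ (anc-below-par yc y≢c))

  data Position (c d : V) : Set where
    above   : Anc c d → Position c d
    below   : Anc d c → Position c d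
    diverge : ∀ a x y → Child a x → Child a y → x ≢ y → Anc x c → Anc y d → Position c d

  abstract

    position : ∀ c d → Position c d
    position c d with meet c d
    ... | m , mc , md , g with m ≟ c | m ≟ d
    ...   | yes refl | _        = above md
    ...   | no _     | yes refl = below mc
    ...   | no m≢c   | no m≢d   with child-towards mc m≢c | child-towards md m≢d
    ...     | x , chx , xc | y , chy , yd =
      diverge m x y chx chy (λ { refl → child-not-anc chx (g x xc yd) }) xc yd

  module Paths (tree : IsTree E) where

    open IsTree tree
    open Walks _≟_ E

    abstract

      up-path : ∀ {x y} → Anc x y → ∃ λ l → Path E y x l × (∀ {v} → v ∈ l → Anc x v × Anc v y)
                                           × (∀ {v} → Anc x v → Anc v y → v ∈ l)
      up-path self = _ , (here , [] ∷ []) , (λ { (here refl) → self , self }) , λ p q → here (anc-antisym q p)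
      up-path {x} (up {y} n p) with up-path p
      ... | l , (w , u) , to , from = y ∷ l
        , (step (edge⁺ n) w , unique-cons (λ y∈ → par-not-anc n (proj₂ (to y∈))) u)
        , (λ { (here refl) → up n p , self ; (there v∈) → let a , b = to v∈ in a , up n b })
        , λ {v} a b → case a b (v ≟ y)
        where
        case : ∀ {v} → Anc x v → Anc v y → Dec (v ≡ y) → v ∈ y ∷ l
        case a b (yes eq) = here eq
        case a b (no neq) = there (from a (proj₂ (anc-below-par b neq)))

      -- The path climbs from `a` to the meet and descends to `b`, and by `path-unique` there is no
      -- other. This turns the path relations of the statement into conditions on the tree order.
      OnPath⇒ : ∀ {a b m v} → IsMeet a b m → OnPath E a b v → Anc m v × (Anc v a ⊎ Anc v b)
      OnPath⇐ : ∀ {a b m v} → IsMeet a b m → Anc m v → Anc v a ⊎ Anc v b → OnPath E a b v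

      private
        meet-path : ∀ {a b m} → IsMeet a b m → ∃ λ l → Path E a b l
                  × (∀ {v} → v ∈ l → Anc m v × (Anc v a ⊎ Anc v b))
                  × (∀ {v} → Anc m v → Anc v a ⊎ Anc v b → v ∈ l)
        meet-path {a} {b} {m} (ma , mb , g) with up-path ma | up-path mb
        ... | l₁ , (w₁ , u₁) , to₁ , from₁ | l₂ , (w₂ , u₂) , to₂ , from₂
          with reverse l₂ in eq | reverseʷ symm w₂ | unique-reverse l₂ u₂
        ...   | k | w | u with walk-head w
        ...     | k′ , refl = l₁ ++ k′ , (w₁ ++ʷ w , Unique.++⁺ u₁ (unique-tail u) disj) , to , from
          where
          back : ∀ {v} → v ∈ m ∷ k′ → v ∈ l₂
          back v∈ = Any.reverse⁻ (subst (_ ∈_) (sym eq) v∈)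
          -- A common vertex lies below `m` and is an ancestor of both ends, so it is `m`, which
          -- `k′` omits.
          disj : ∀ {v} → ¬ (v ∈ l₁ × v ∈ k′)
          disj (v∈₁ , v∈₂) with to₁ v∈₁ | to₂ (back (there v∈₂))
          ... | mv , va | _ , vb with anc-antisym mv (g _ va vb)
          ...   | refl = unique-head u v∈₂
          to : ∀ {v} → v ∈ l₁ ++ k′ → Anc m v × (Anc v a ⊎ Anc v b)
          to v∈ with ∈-++⁻ l₁ v∈
          ... | inj₁ v∈₁ = let p , q = to₁ v∈₁ in p , inj₁ q
          ... | inj₂ v∈₂ = let p , q = to₂ (back (there v∈₂)) in p , inj₂ q
          from : ∀ {v} → Anc m v → Anc v a ⊎ Anc v b → v ∈ l₁ ++ k′
          from mv (inj₁ va) = ∈-++⁺ˡ (from₁ mv va)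
          from mv (inj₂ vb) with subst (_ ∈_) eq (Any.reverse⁺ (from₂ mv vb))
          ... | here refl = ∈-++⁺ˡ (from₁ self ma)
          ... | there v∈  = ∈-++⁺ʳ l₁ v∈

      OnPath⇒ im (l , pth , v∈) with meet-path im
      ... | k , pth′ , to , _ = to (subst (_ ∈_) (path-unique symm acyclic pth pth′) v∈)

      OnPath⇐ im mv v≤ with meet-path im
      ... | k , pth′ , _ , from = k , pth′ , from mv v≤

      Le⇒Anc : ∀ {x y} → Le E r x y → Anc x y
      Le⇒Anc le with OnPath⇒ (meet-below (root-anc _)) le
      ... | _ , inj₂ p = p
      ... | _ , inj₁ p with anc-r p
      ...   | refl = root-anc _

      Anc⇒Le : ∀ {x y} → Anc x y → Le E r x y
      Anc⇒Le p = OnPath⇐ (meet-below (root-anc _)) (root-anc _) (inj₂ p)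

      ImmSucc⇒Child : ∀ {a b} → ImmSucc E r a b → Child a b
      ImmSucc⇒Child (le , a≢b , between) with child-towards (Le⇒Anc le) a≢b
      ... | c , ch , cb with between c (Anc⇒Le (child-anc ch)) (Anc⇒Le cb)
      ...   | inj₁ refl = ⊥-elim (child-not-anc ch self)
      ...   | inj₂ refl = ch

      Child⇒ImmSucc : ∀ {a b} → Child a b → ImmSucc E r a b
      Child⇒ImmSucc {a} {b} ch@(b≢r , refl) =
        Anc⇒Le (child-anc ch) , (λ eq → child-not-anc ch (subst (Anc b) (sym eq) self)) , between
        where
        between : ∀ c → Le E r a c → Le E r c b → c ≡ a ⊎ c ≡ b
        between c ac cb with c ≟ b
        ... | yes eq  = inj₂ eq
        ... | no  c≢b = inj₁ (anc-antisym (proj₂ (anc-below-par (Le⇒Anc cb) c≢b)) (Le⇒Anc ac))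

      Meet⇒IsMeet : ∀ {a b m} → Meet E r a b m → IsMeet a b m
      Meet⇒IsMeet (p , q , g) = Le⇒Anc p , Le⇒Anc q , λ d da db → Le⇒Anc (g d (Anc⇒Le da) (Anc⇒Le db))

      IsMeet⇒Meet : ∀ {a b m} → IsMeet a b m → Meet E r a b m
      IsMeet⇒Meet (p , q , g) = Anc⇒Le p , Anc⇒Le q , λ d da db → Anc⇒Le (g d (Le⇒Anc da) (Le⇒Anc db))

-- Tree maps between rooted ordered trees

unique-lookup-injective : ∀ {X : Set} {xs : List X} → Unique xs → ∀ i j → lookup xs i ≡ lookup xs j → i ≡ j
unique-lookup-injective (_ ∷ _)  zero    zero    _  = refl
unique-lookup-injective u@(_ ∷ _) zero    (suc j) eq = ⊥-elim (unique-head u (subst (_∈ _) (sym eq) (∈-lookup j)))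
unique-lookup-injective u@(_ ∷ _) (suc i) zero    eq = ⊥-elim (unique-head u (subst (_∈ _) eq (∈-lookup i)))
unique-lookup-injective (_ ∷ u)  (suc i) (suc j) eq = cong suc (unique-lookup-injective u i j eq)

record PlaneTree : Set₁ where
  field
    V        : Set
    _≟_      : DecidableEquality V
    E        : V → V → Set
    r        : V
    tree     : IsTree E
    parented : Parented E r
    lab      : V → Deg
    step3    : Step3 E r lab

  open Step3 step3 public
  open Ancestors _≟_ parented public
  open Paths tree public

  str : StrT V
  str = TStr E r lab step3

  arity : V → ℕ
  arity v = length (succs v)

  child : ∀ v → Fin (arity v) → V
  child v = lookup (succs v)

  abstract

    child-isChild : ∀ v j → Child v (child v j)
    child-isChild v j = ImmSucc⇒Child (Equivalence.to (succsComplete v _) (∈-lookup j))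

    child-index : ∀ {v c} → Child v c → ∃ λ j → child v j ≡ c
    child-index {v} ch = let c∈ = Equivalence.from (succsComplete v _) (Child⇒ImmSucc ch) in
      Any.index c∈ , sym (Any.lookup-index c∈)

    child-injective : ∀ v i j → child v i ≡ child v j → i ≡ j
    child-injective v = unique-lookup-injective (succsUnique v)

    branch-towards : ∀ {x y} → Anc x y → x ≢ y → ∃ λ j → Anc (child x j) y
    branch-towards p x≢y with child-towards p x≢y
    ... | c , ch , q with child-index ch
    ...   | j , refl = j , q

    branch-unique : ∀ {v y} i j → Anc (child v i) y → Anc (child v j) y → i ≡ j
    branch-unique {v} i j p q =
      child-injective v i j (children-disjoint (child-isChild v i) (child-isChild v j) p q)

    branches-meet : ∀ {v i j a b} → i ≢ j → Anc (child v i) a → Anc (child v j) b → IsMeet a b v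
    branches-meet {v} {i} {j} i≢j =
      children-meet (child-isChild v i) (child-isChild v j) (i≢j ∘ child-injective v i j)

  Prec : V → V → Set
  Prec c d = ∃ λ a → ∃ λ i → ∃ λ j → i Fin.< j × Anc (child a i) c × Anc (child a j) d

  abstract

    prec⇒Prec : ∀ {c d} → StrT.prec str c d → Prec c d
    prec⇒Prec (a , i , j , i<j , p , q) = a , i , j , i<j , Le⇒Anc p , Le⇒Anc q

    Prec⇒prec : ∀ {c d} → Prec c d → StrT.prec str c d
    Prec⇒prec (a , i , j , i<j , p , q) = a , i , j , i<j , Anc⇒Le p , Anc⇒Le q

    Prec-at-meet : ∀ {c d m} → IsMeet c d m → Prec c d
                 → ∃ λ i → ∃ λ j → i Fin.< j × Anc (child m i) c × Anc (child m j) d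
    Prec-at-meet im (a , i , j , i<j , p , q) with meet-unique im (branches-meet (Fin.<⇒≢ i<j) p q)
    ... | refl = i , j , i<j , p , q

    Prec-not-above : ∀ {c d} → Prec c d → ¬ Anc c d
    Prec-not-above (a , i , j , i<j , p , q) cd = Fin.<⇒≢ i<j (branch-unique i j (anc-trans p cd) q)

    Prec-not-below : ∀ {c d} → Prec c d → ¬ Anc d c
    Prec-not-below (a , i , j , i<j , p , q) dc = Fin.<⇒≢ i<j (branch-unique i j p (anc-trans q dc))

    Prec-asym : ∀ {c d} → Prec c d → ¬ Prec d c
    Prec-asym (a , i , j , i<j , p , q) dc with Prec-at-meet (meet-sym (branches-meet (Fin.<⇒≢ i<j) p q)) dc
    ... | i′ , j′ , i′<j′ , q′ , p′ with branch-unique i j′ p p′ | branch-unique j i′ q q′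
    ...   | refl | refl = Fin.<-asym i<j i′<j′

  data Order (c d : V) : Set where
    above  : Anc c d → Order c d
    below  : Anc d c → Order c d
    before : Prec c d → Order c d
    after  : Prec d c → Order c d

  abstract

    order : ∀ c d → Order c d
    order c d with position c d
    ... | above p = above p
    ... | below p = below p
    ... | diverge a x y chx chy x≢y p q with child-index chx | child-index chy
    ...   | i , refl | j , refl with Fin.<-cmp i j
    ...     | tri< i<j _ _  = before (a , i , j , i<j , p , q)
    ...     | tri≈ _ refl _ = ⊥-elim (x≢y refl)
    ...     | tri> _ _ j<i  = after (a , j , i , j<i , q , p)

  Hit : V → V → V → V → Set
  Hit a b c d = ∃ λ v → OnPath E a b v × OnPath E c d v

  -- A common vertex lies below the top vertices `m` and `n` of both paths, so these are comparable
  -- and the lower one is on both paths. Disjointness thus depends only on meets and the tree order.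
  HitAt : V → V → V → V → V → V → Set
  HitAt a b m c d n = (Anc m n × (Anc n a ⊎ Anc n b)) ⊎ (Anc n m × (Anc m c ⊎ Anc m d))

  abstract

    Hit⇒HitAt : ∀ {a b m c d n} → IsMeet a b m → IsMeet c d n → Hit a b c d → HitAt a b m c d n
    Hit⇒HitAt im in′ (v , p , q) with OnPath⇒ im p | OnPath⇒ in′ q
    ... | mv , v≤ | nv , v≤′ with anc-chain mv nv
    ...   | inj₁ mn = inj₁ (mn , [ inj₁ ∘ anc-trans nv , inj₂ ∘ anc-trans nv ]′ v≤)
    ...   | inj₂ nm = inj₂ (nm , [ inj₁ ∘ anc-trans mv , inj₂ ∘ anc-trans mv ]′ v≤′)

    HitAt⇒Hit : ∀ {a b m c d n} → IsMeet a b m → IsMeet c d n → HitAt a b m c d n → Hit a b c d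
    HitAt⇒Hit {n = n} im in′ (inj₁ (mn , n≤)) = n , OnPath⇐ im mn n≤ , OnPath⇐ in′ self (inj₁ (proj₁ in′))
    HitAt⇒Hit {m = m} im in′ (inj₂ (nm , m≤)) = m , OnPath⇐ im self (inj₁ (proj₁ im)) , OnPath⇐ in′ nm m≤

    -- The path from `c` to the root consists of the ancestors of `c`, and it can meet `ab` only if
    -- it runs through the meet. With `a = b` the relation `C` therefore encodes the tree order.
    C⇒ : ∀ {a b c m} → IsMeet a b m → StrT.C str a b c → ¬ Anc m c
    C⇒ {c = c} im dis mc = dis (HitAt⇒Hit im (meet-sym (meet-below (root-anc c))) (inj₂ (root-anc _ , inj₁ mc)))

    C⇐ : ∀ {a b c m} → IsMeet a b m → ¬ Anc m c → StrT.C str a b c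
    C⇐ {c = c} im m≰c hit with Hit⇒HitAt im (meet-sym (meet-below (root-anc c))) hit
    ... | inj₁ (mr , _)        = m≰c (anc-trans mr (root-anc c))
    ... | inj₂ (_ , inj₁ mc)   = m≰c mc
    ... | inj₂ (_ , inj₂ mr)   = m≰c (anc-trans mr (root-anc c))

module _ (A B : PlaneTree) where

  private
    module A = PlaneTree A
    module B = PlaneTree B

  record Branching (F : A.V → B.V) (v : A.V) : Set where
    field
      σ       : Fin (A.arity v) → Fin (B.arity (F v))
      σ-mono  : ∀ {i j} → i Fin.< j → σ i Fin.< σ j
      σ-anc   : ∀ j → B.Anc (B.child (F v) (σ j)) (F (A.child v j))
      σ-match : ∀ j → Match (A.lab v) (A.k v j) (B.k (F v) (σ j))

  -- A condition on one vertex and its children at a time, which fits the recursive shape of `Emb`;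
  -- for the rooted structures it amounts to being an embedding.
  TreeMap : (A.V → B.V) → Set
  TreeMap F = ∀ v → B.lab (F v) ≡ A.lab v × Branching F v

  module TreeMaps {F : A.V → B.V} (tm : TreeMap F) where

    open module Br v = Branching (proj₂ (tm v))

    abstract

      anc⁺ : ∀ {x y} → A.Anc x y → B.Anc (F x) (F y)
      anc⁺ A.self = B.self
      anc⁺ {x} (A.up {y} y≢r p) with A.child-index (y≢r , refl)
      ... | j , eq = B.anc-trans (anc⁺ p) (B.anc-trans (B.child-anc (B.child-isChild _ (σ (A.par y) j)))
                       (subst (λ z → B.Anc (B.child (F (A.par y)) (σ (A.par y) j)) (F z)) eq (σ-anc (A.par y) j)))

      anc-strict : ∀ {x y} → A.Anc x y → x ≢ y → ¬ B.Anc (F y) (F x)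
      anc-strict {x} p x≢y q with A.branch-towards p x≢y
      ... | j , cy = B.child-not-anc (B.child-isChild _ (σ x j)) (B.anc-trans (σ-anc x j) (B.anc-trans (anc⁺ cy) q))

      Prec⁺ : ∀ {c d} → A.Prec c d → B.Prec (F c) (F d)
      Prec⁺ (a , i , j , i<j , p , q) = F a , σ a i , σ a j , σ-mono a i<j
        , B.anc-trans (σ-anc a i) (anc⁺ p) , B.anc-trans (σ-anc a j) (anc⁺ q)

      -- Reflection follows from preservation: `order` leaves three other relations between `x` and
      -- `y`, and the image of each excludes that `F x` is above `F y`, unless `x` and `y` coincide.
      anc⁻ : ∀ {x y} → B.Anc (F x) (F y) → A.Anc x y
      anc⁻ {x} {y} p with A.order x y
      ... | A.above q  = q
      ... | A.before q = ⊥-elim (B.Prec-not-above (Prec⁺ q) p)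
      ... | A.after q  = ⊥-elim (B.Prec-not-below (Prec⁺ q) p)
      ... | A.below q with y A.≟ x
      ...   | yes refl = A.self
      ...   | no  y≢x  = ⊥-elim (anc-strict q y≢x p)

      F-injective : ∀ {x y} → F x ≡ F y → x ≡ y
      F-injective {x} {y} eq =
        A.anc-antisym (anc⁻ (subst (B.Anc (F x)) eq B.self)) (anc⁻ (subst (B.Anc (F y)) (sym eq) B.self))

      Prec⁻ : ∀ {c d} → B.Prec (F c) (F d) → A.Prec c d
      Prec⁻ {c} {d} p with A.order c d
      ... | A.above q  = ⊥-elim (B.Prec-not-above p (anc⁺ q))
      ... | A.below q  = ⊥-elim (B.Prec-not-below p (anc⁺ q))
      ... | A.before q = q
      ... | A.after q  = ⊥-elim (B.Prec-asym p (Prec⁺ q))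

      meet⁺ : ∀ {a b m} → A.IsMeet a b m → B.IsMeet (F a) (F b) (F m)
      meet⁺ {a} {b} im with A.order a b
      ... | A.above q with A.meet-unique im (A.meet-below q)
      ...   | refl = B.meet-below (anc⁺ q)
      meet⁺ im | A.below q with A.meet-unique (A.meet-sym im) (A.meet-below q)
      ...   | refl = B.meet-sym (B.meet-below (anc⁺ q))
      meet⁺ im | A.before q with A.Prec-at-meet im q
      ...   | i , j , i<j , ci , cj = B.branches-meet (Fin.<⇒≢ (σ-mono _ i<j))
                                        (B.anc-trans (σ-anc _ i) (anc⁺ ci)) (B.anc-trans (σ-anc _ j) (anc⁺ cj))
      meet⁺ im | A.after q with A.Prec-at-meet (A.meet-sym im) q
      ...   | i , j , i<j , ci , cj = B.meet-sym (B.branches-meet (Fin.<⇒≢ (σ-mono _ i<j))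
                                        (B.anc-trans (σ-anc _ i) (anc⁺ ci)) (B.anc-trans (σ-anc _ j) (anc⁺ cj)))

      D⇔ : ∀ a b c d → StrT.D A.str a b c d ⇔ StrT.D B.str (F a) (F b) (F c) (F d)
      D⇔ a b c d with A.meet a b | A.meet c d
      ... | m , im | n , in′ = mk⇔ (λ dis hit → dis (A.HitAt⇒Hit im in′ (back (B.Hit⇒HitAt (meet⁺ im) (meet⁺ in′) hit))))
                                   (λ dis hit → dis (B.HitAt⇒Hit (meet⁺ im) (meet⁺ in′) (forth (A.Hit⇒HitAt im in′ hit))))
        where
        forth : A.HitAt a b m c d n → B.HitAt (F a) (F b) (F m) (F c) (F d) (F n)
        forth (inj₁ (p , q)) = inj₁ (anc⁺ p , [ inj₁ ∘ anc⁺ , inj₂ ∘ anc⁺ ]′ q)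
        forth (inj₂ (p , q)) = inj₂ (anc⁺ p , [ inj₁ ∘ anc⁺ , inj₂ ∘ anc⁺ ]′ q)
        back : B.HitAt (F a) (F b) (F m) (F c) (F d) (F n) → A.HitAt a b m c d n
        back (inj₁ (p , q)) = inj₁ (anc⁻ p , [ inj₁ ∘ anc⁻ , inj₂ ∘ anc⁻ ]′ q)
        back (inj₂ (p , q)) = inj₂ (anc⁻ p , [ inj₁ ∘ anc⁻ , inj₂ ∘ anc⁻ ]′ q)

      C⇔ : ∀ a b c → StrT.C A.str a b c ⇔ StrT.C B.str (F a) (F b) (F c)
      C⇔ a b c with A.meet a b
      ... | m , im = mk⇔ (λ x → B.C⇐ (meet⁺ im) (A.C⇒ im x ∘ anc⁻)) (λ x → A.C⇐ im (B.C⇒ (meet⁺ im) x ∘ anc⁺))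

      K⇔ : ∀ p a → StrT.K A.str p a ⇔ StrT.K B.str p (F a)
      K⇔ p a = mk⇔ (trans (proj₁ (tm a))) (trans (sym (proj₁ (tm a))))

      prec⇔ : ∀ a b → StrT.prec A.str a b ⇔ StrT.prec B.str (F a) (F b)
      prec⇔ a b = mk⇔ (B.Prec⇒prec ∘ Prec⁺ ∘ A.prec⇒Prec) (A.Prec⇒prec ∘ Prec⁻ ∘ B.prec⇒Prec)

      index⁺ : ∀ {a p j} → A.lab a ≡ fin p → A.k a j ≡ B.k (F a) (σ a j)
      index⁺ {a} {p} {j} eq with A.lab a | σ-match a j
      index⁺ refl | .(fin _) | m = m

      G⇔ : ∀ i a b → StrT.G A.str i a b ⇔ StrT.G B.str i (F a) (F b)
      G⇔ i a b = mk⇔ forth back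
        where
        forth : StrT.G A.str i a b → StrT.G B.str i (F a) (F b)
        forth (p , eq , j , refl , le) = p , trans (proj₁ (tm a)) eq , σ a j , sym (index⁺ eq)
          , B.Anc⇒Le (B.anc-trans (σ-anc a j) (anc⁺ (A.Le⇒Anc le)))
        back : StrT.G B.str i (F a) (F b) → StrT.G A.str i a b
        -- `F b` lies in branch `j` at `F a`, so `b` is properly below `a`; the branch of `a`
        -- towards `b` is sent by `σ` to the branch of `F b`, which is `j`.
        back (p , eq , j , refl , le)
          with A.branch-towards (anc⁻ (B.anc-trans (B.child-anc (B.child-isChild (F a) j)) (B.Le⇒Anc le)))
                 (λ { refl → B.child-not-anc (B.child-isChild (F a) j) (B.Le⇒Anc le) })
        ... | i′ , p′ with B.branch-unique (σ a i′) j (B.anc-trans (σ-anc a i′) (anc⁺ p′)) (B.Le⇒Anc le)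
        ...   | refl = p , lab≡ , i′ , index⁺ lab≡ , A.Anc⇒Le p′
          where
          lab≡ : A.lab a ≡ fin p
          lab≡ = trans (sym (proj₁ (tm a))) eq

    treeMap⇒embT : ∀ P → EmbT P A.str B.str F
    treeMap⇒embT P = record
      { inj      = λ _ _ → F-injective
      ; presD    = D⇔
      ; presK    = λ p _ → K⇔ p
      ; presC    = C⇔
      ; presPrec = prec⇔
      ; presG    = λ i _ → G⇔ i
      }

  -- Tree maps recovered from preserved relations

  module _ {F : A.V → B.V} where

    -- `σ j` is the branch at `F v` towards the image of the child. `Prec` compares two such
    -- branches once the images are known to meet in `F v`, and `G` fixes the index under a finite
    -- label.
    mk-branching : ∀ v → (∀ j → B.Anc (F v) (F (A.child v j)))
      → (∀ j → F v ≢ F (A.child v j))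
      → (∀ i j → i Fin.< j → B.Prec (F (A.child v i)) (F (A.child v j)))
      → (∀ i j → i Fin.< j → B.IsMeet (F (A.child v i)) (F (A.child v j)) (F v))
      → (∀ j p → A.lab v ≡ fin p → StrT.G B.str (A.k v j) (F v) (F (A.child v j)))
      → Branching F v
    mk-branching v anc neq prec mt idx = record
      { σ = σ ; σ-mono = mono ; σ-anc = σ-anc ; σ-match = match }
      where
      σ : Fin (A.arity v) → Fin (B.arity (F v))
      σ j = proj₁ (B.branch-towards (anc j) (neq j))
      σ-anc : ∀ j → B.Anc (B.child (F v) (σ j)) (F (A.child v j))
      σ-anc j = proj₂ (B.branch-towards (anc j) (neq j))
      mono : ∀ {i j} → i Fin.< j → σ i Fin.< σ j
      mono {i} {j} i<j with B.Prec-at-meet (mt i j i<j) (prec i j i<j)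
      ... | i′ , j′ , i′<j′ , p , q with B.branch-unique i′ (σ i) p (σ-anc i) | B.branch-unique j′ (σ j) q (σ-anc j)
      ...   | refl | refl = i′<j′
      match : ∀ j → Match (A.lab v) (A.k v j) (B.k (F v) (σ j))
      match j with A.lab v | idx j
      ... | ω     | _  = tt
      ... | fin p | ix with ix p refl
      ...   | _ , _ , j′ , eq , le with B.branch-unique j′ (σ j) (B.Le⇒Anc le) (σ-anc j)
      ...     | refl = sym eq

    -- `Good` singles out the vertices at which the relations are known: all of them for 𝓣*, and
    -- those other than a missing root for 𝓕*.
    module _ (Good : A.V → Set)
      (presC    : ∀ {a b c} → Good a → Good b → Good c → StrT.C A.str a b c ⇔ StrT.C B.str (F a) (F b) (F c))
      (presPrec : ∀ {a b} → Good a → Good b → StrT.prec A.str a b → StrT.prec B.str (F a) (F b))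
      (presG    : ∀ {i a b} → 1 ≤ i → Good a → Good b → StrT.G A.str i a b → StrT.G B.str i (F a) (F b))
      where

      abstract

        good-anc⁺ : ∀ {a b} → Good a → Good b → A.Anc a b → B.Anc (F a) (F b)
        good-anc⁺ {a} {b} ga gb p with B.anc? (F a) (F b)
        ... | yes q = q
        ... | no ¬q = ⊥-elim (A.C⇒ (A.meet-below A.self) (Equivalence.from (presC ga ga gb) (B.C⇐ (B.meet-below B.self) ¬q)) p)

        good-anc⁻ : ∀ {a b} → Good a → Good b → B.Anc (F a) (F b) → A.Anc a b
        good-anc⁻ {a} {b} ga gb p with A.anc? a b
        ... | yes q = q
        ... | no ¬q = ⊥-elim (B.C⇒ (B.meet-below B.self) (Equivalence.to (presC ga ga gb) (A.C⇐ (A.meet-below A.self) ¬q)) p)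

        -- `C` fails at `a`, `b`, `m`, as the path `ab` passes through `m`; hence the meet of the
        -- images is above `F m`. Conversely `F m` is a common ancestor of the images.
        good-meet : ∀ {a b m} → Good a → Good b → Good m → A.IsMeet a b m → B.IsMeet (F a) (F b) (F m)
        good-meet {a} {b} {m} ga gb gm im@(ma , mb , g) with B.meet (F a) (F b)
        ... | n , in′@(na , nb , gn) with B.anc? n (F m)
        ...   | no ¬q = ⊥-elim (A.C⇒ im (Equivalence.from (presC ga gb gm) (B.C⇐ in′ ¬q)) A.self)
        ...   | yes q with B.anc-antisym q (gn _ (good-anc⁺ gm ga ma) (good-anc⁺ gm gb mb))
        ...     | refl = in′

        good-branching : ∀ v → Good v → (∀ j → Good (A.child v j)) → Branching F v
        good-branching v gv gc = mk-branching v
          (λ j → good-anc⁺ gv (gc j) (A.child-anc (A.child-isChild v j)))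
          (λ j eq → A.child-not-anc (A.child-isChild v j) (good-anc⁻ (gc j) gv (subst (B.Anc _) (sym eq) B.self)))
          (λ i j i<j → B.prec⇒Prec (presPrec (gc i) (gc j) (A.Prec⇒prec (v , i , j , i<j , A.self , A.self))))
          (λ i j i<j → good-meet (gc i) (gc j) gv (A.branches-meet (Fin.<⇒≢ i<j) A.self A.self))
          (λ j p eq → presG (proj₁ (A.kRange v p eq j)) gv (gc j) (p , eq , j , refl , A.Anc⇒Le A.self))

-- Vertices as tree positions

data Node : Tree → Set
data FNode : Forest → Set

data Node where
  top  : ∀ {t} → Node t
  down : ∀ {l ts} → FNode ts → Node (node l ts)

data FNode where
  hd : ∀ {i t ts} → Node t → FNode ((i , t) ∷ ts)
  tl : ∀ {x ts} → FNode ts → FNode (x ∷ ts)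

⟦_⟧ᴱ : ∀ {s t} → Emb s t → Node s → Node t
⟦_⟧ᴵ : ∀ {s ts} → In s ts → Node s → FNode ts
⟦_⟧ᶠ : ∀ {l ss ts} → FEmb l ss ts → FNode ss → FNode ts

⟦ top f ⟧ᴱ  top      = top
⟦ top f ⟧ᴱ  (down p) = down (⟦ f ⟧ᶠ p)
⟦ down i ⟧ᴱ p        = down (⟦ i ⟧ᴵ p)

⟦ hd e ⟧ᴵ p = hd (⟦ e ⟧ᴱ p)
⟦ tl i ⟧ᴵ p = tl (⟦ i ⟧ᴵ p)

⟦ skip f ⟧ᶠ     p      = tl (⟦ f ⟧ᶠ p)
⟦ take _ e f ⟧ᶠ (hd p) = hd (⟦ e ⟧ᴱ p)
⟦ take _ e f ⟧ᶠ (tl p) = tl (⟦ f ⟧ᶠ p)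

⟦⟧-∘ᴱ  : ∀ {s t u} (h : Emb t u) (e : Emb s t) p → ⟦ h ∘ᴱ e ⟧ᴱ p ≡ ⟦ h ⟧ᴱ (⟦ e ⟧ᴱ p)
⟦⟧-∘ᴵ  : ∀ {s t us} (h : In t us) (e : Emb s t) p → ⟦ h ∘ᴵ e ⟧ᴵ p ≡ ⟦ h ⟧ᴵ (⟦ e ⟧ᴱ p)
⟦⟧-∘ᶠ  : ∀ {l ss ts us} (h : FEmb l ts us) (f : FEmb l ss ts) p → ⟦ h ∘ᶠ f ⟧ᶠ p ≡ ⟦ h ⟧ᶠ (⟦ f ⟧ᶠ p)
⟦⟧-∘ᶠᴵ : ∀ {l s ts us} (h : FEmb l ts us) (f : In s ts) p → ⟦ h ∘ᶠᴵ f ⟧ᴵ p ≡ ⟦ h ⟧ᶠ (⟦ f ⟧ᴵ p)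

⟦⟧-∘ᴱ (down h) e        p        = cong down (⟦⟧-∘ᴵ h e p)
⟦⟧-∘ᴱ (top h)  (top f)  top      = refl
⟦⟧-∘ᴱ (top h)  (top f)  (down p) = cong down (⟦⟧-∘ᶠ h f p)
⟦⟧-∘ᴱ (top h)  (down f) p        = cong down (⟦⟧-∘ᶠᴵ h f p)

⟦⟧-∘ᴵ (hd h) e p = cong hd (⟦⟧-∘ᴱ h e p)
⟦⟧-∘ᴵ (tl h) e p = cong tl (⟦⟧-∘ᴵ h e p)

⟦⟧-∘ᶠ done         done         ()
⟦⟧-∘ᶠ (skip h)     f            p      = cong tl (⟦⟧-∘ᶠ h f p)
⟦⟧-∘ᶠ (take _ _ h) (skip f)     p      = cong tl (⟦⟧-∘ᶠ h f p)
⟦⟧-∘ᶠ (take _ h _) (take _ e _) (hd p) = cong hd (⟦⟧-∘ᴱ h e p)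
⟦⟧-∘ᶠ (take _ _ h) (take _ _ f) (tl p) = cong tl (⟦⟧-∘ᶠ h f p)

⟦⟧-∘ᶠᴵ (skip h)     f      p = cong tl (⟦⟧-∘ᶠᴵ h f p)
⟦⟧-∘ᶠᴵ (take _ e h) (hd f) p = cong hd (⟦⟧-∘ᴱ e f p)
⟦⟧-∘ᶠᴵ (take _ e h) (tl f) p = cong tl (⟦⟧-∘ᶠᴵ h f p)

-- Plane trees described by labelled ordered trees

kid : (A : PlaneTree) (v : PlaneTree.V A) → Fin (PlaneTree.arity A v) → ℕ × PlaneTree.V A
kid A v j = PlaneTree.k A v j , PlaneTree.child A v j

-- A relation serves both directions: `represent` reads a tree off a given structure, while `rep-F`
-- concerns a graph built from a tree.
data Rep (A : PlaneTree) : PlaneTree.V A → Tree → Set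
data FRep (A : PlaneTree) : List (ℕ × PlaneTree.V A) → Forest → Set

data Rep A where
  rep : ∀ {v l ts} → PlaneTree.lab A v ≡ l → FRep A (tabulate (kid A v)) ts → Rep A v (node l ts)

data FRep A where
  []  : FRep A [] []
  _∷_ : ∀ {x xs t ts} → Rep A (proj₂ x) t → FRep A xs ts → FRep A (x ∷ xs) ((proj₁ x , t) ∷ ts)

module Representation (A : PlaneTree) where

  open PlaneTree A

  name  : ∀ {v t} → Rep A v t → Node t → V
  fname : ∀ {xs ts} → FRep A xs ts → FNode ts → V
  name {v} _         top      = v
  name     (rep _ f) (down p) = fname f p
  fname (R ∷ _) (hd p) = name R p
  fname (_ ∷ f) (tl p) = fname f p

  name-anc  : ∀ {v t} (R : Rep A v t) p → Anc v (name R p)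
  fname-anc : ∀ {xs ts} (f : FRep A xs ts) p → ∃ λ x → x ∈ xs × Anc (proj₂ x) (fname f p)
  name-anc R         top      = self
  name-anc (rep _ f) (down p) with fname-anc f p
  ... | x , x∈ , q with Any.tabulate⁻ x∈
  ...   | j , refl = anc-trans (child-anc (child-isChild _ j)) q
  fname-anc (R ∷ _) (hd p) = _ , here refl , name-anc R p
  fname-anc (_ ∷ f) (tl p) = let x , x∈ , q = fname-anc f p in x , there x∈ , q

  pos  : ∀ {v t x} (R : Rep A v t) → Anc v x → ∃ λ p → name R p ≡ x
  fpos : ∀ {ws ts x w} (f : FRep A ws ts) → w ∈ ws → Anc (proj₂ w) x → ∃ λ p → fname f p ≡ x
  pos {v} {x = x} (rep _ f) q with v ≟ x
  ... | yes refl = top , refl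
  ... | no  v≢x with branch-towards q v≢x
  ...   | j , jx with fpos f (∈-tabulate⁺ j) jx
  ...     | p , eq = down p , eq
  fpos (R ∷ _) (here refl) q = let p , eq = pos R q in hd p , eq
  fpos (_ ∷ f) (there w∈)  q = let p , eq = fpos f w∈ q in tl p , eq

  name-injective  : ∀ {v t} (R : Rep A v t) p q → name R p ≡ name R q → p ≡ q
  fname-injective : ∀ {v n ts} (g : Fin n → ℕ × V) → (∀ j → Child v (proj₂ (g j)))
                  → (∀ i j → proj₂ (g i) ≡ proj₂ (g j) → i ≡ j)
                  → (f : FRep A (tabulate g) ts) → ∀ p q → fname f p ≡ fname f q → p ≡ q

  top≢down : ∀ {v ts} (f : FRep A (tabulate (kid A v)) ts) p → v ≢ fname f p
  top≢down f p eq with fname-anc f p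
  ... | x , x∈ , q with Any.tabulate⁻ x∈
  ...   | j , refl = child-not-anc (child-isChild _ j) (subst (Anc _) (sym eq) q)

  name-injective R         top      top      _  = refl
  name-injective (rep _ f) top      (down q) eq = ⊥-elim (top≢down f q eq)
  name-injective (rep _ f) (down p) top      eq = ⊥-elim (top≢down f p (sym eq))
  name-injective (rep _ f) (down p) (down q) eq =
    cong down (fname-injective (kid A _) (child-isChild _) (child-injective _) f p q eq)

  hd≢tl : ∀ {v n t ts} (g : Fin (suc n) → ℕ × V) → (∀ j → Child v (proj₂ (g j)))
        → (∀ i j → proj₂ (g i) ≡ proj₂ (g j) → i ≡ j)
        → (R : Rep A (proj₂ (g zero)) t) (f : FRep A (tabulate (g ∘ suc)) ts) → ∀ p q → name R p ≢ fname f q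
  hd≢tl g ch inj R f p q eq with fname-anc f q
  ... | x , x∈ , a with Any.tabulate⁻ x∈
  ...   | j , refl with inj zero (suc j) (children-disjoint (ch zero) (ch (suc j)) (name-anc R p) (subst (Anc _) (sym eq) a))
  ...     | ()

  fname-injective {n = suc n} g ch inj (R ∷ f) (hd p) (hd q) eq = cong hd (name-injective R p q eq)
  fname-injective {n = suc n} g ch inj (R ∷ f) (hd p) (tl q) eq = ⊥-elim (hd≢tl g ch inj R f p q eq)
  fname-injective {n = suc n} g ch inj (R ∷ f) (tl p) (hd q) eq = ⊥-elim (hd≢tl g ch inj R f q p (sym eq))
  fname-injective {n = suc n} g ch inj (R ∷ f) (tl p) (tl q) eq =
    cong tl (fname-injective (g ∘ suc) (ch ∘ suc) (λ i j → Fin.suc-injective ∘ inj (suc i) (suc j)) f p q eq)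

  module _ (N : ℕ) (bounded : ∀ v → dep v ≤ N) where

    -- `n` is fuel: it drops by one per level while the depth grows by one, so the inequality
    -- persists, and without fuel it contradicts the depth bound.
    represent  : ∀ n v → N < n + dep v → ∃ (Rep A v)
    frepresent : ∀ n {m} (g : Fin m → ℕ × V) → (∀ j → N < n + dep (proj₂ (g j))) → ∃ (FRep A (tabulate g))
    represent zero    v lt = ⊥-elim (ℕ.<⇒≱ lt (bounded v))
    represent (suc n) v lt =
      let ts , f = frepresent n (kid A v) (λ j → subst (N <_) (sym (deeper j)) lt) in node (lab v) ts , rep refl f
      where
      deeper : ∀ j → n + dep (child v j) ≡ suc n + dep v
      deeper j with child-isChild v j
      ... | c≢r , eq = trans (cong (n +_) (trans (dep-par c≢r) (cong (suc ∘ dep) eq))) (ℕ.+-suc n (dep v))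
    frepresent n {zero}  g lt = [] , []
    frepresent n {suc m} g lt =
      let t  , R = represent n (proj₂ (g zero)) (lt zero)
          ts , f = frepresent n (g ∘ suc) (lt ∘ suc)
      in (proj₁ (g zero) , t) ∷ ts , R ∷ f

    represent-root : ∃ (Rep A r)
    represent-root = represent (suc N) r (s≤s (ℕ.m≤m+n N (dep r)))

  module _ (P : Deg → Set) (adm : ∀ p → P p → Admissible p) (labP : ∀ v → P (lab v)) where

    open RamseyForTrees P adm

    rep-valid  : ∀ {v t} → Rep A v t → Valid t
    frep-valid-fin : ∀ {p lo n ts} (g : Fin n → ℕ × V) → (∀ j → lo < proj₁ (g j)) → (∀ j → proj₁ (g j) < p)
                   → (∀ {i j} → i Fin.< j → proj₁ (g i) < proj₁ (g j)) → FRep A (tabulate g) ts → FValid (fin p) lo ts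
    frep-valid-ω : ∀ {lo xs ts} → FRep A xs ts → FValid ω lo ts

    rep-valid {v} (rep {l = ω}     eq f) = valid (subst P eq (labP v)) (frep-valid-ω f)
    rep-valid {v} (rep {l = fin p} eq f) = valid (subst P eq (labP v))
      (frep-valid-fin (kid A v) (λ j → proj₁ (kRange v p eq j)) (λ j → ≤pred⇒< (proj₁ (kRange v p eq j)) (proj₂ (kRange v p eq j)))
        (kIncr v p eq _ _) f)
      where
      ≤pred⇒< : ∀ {i p} → 1 ≤ i → i ≤ p ∸ 1 → i < p
      ≤pred⇒< {p = zero}  (s≤s _) ()
      ≤pred⇒< {p = suc p} _       i≤p = s≤s i≤p

    frep-valid-fin {n = zero}  g lo< <p mono []      = []
    frep-valid-fin {n = suc n} g lo< <p mono (R ∷ f) =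
      cons (lo< zero , <p zero) (rep-valid R)
           (frep-valid-fin (g ∘ suc) (λ j → mono (s≤s z≤n)) (<p ∘ suc) (mono ∘ s≤s) f)

    frep-valid-ω []      = []
    frep-valid-ω (R ∷ f) = cons tt (rep-valid R) (frep-valid-ω f)

-- Embeddings of labelled ordered trees as tree maps

module Realisation (A B : PlaneTree) where

  private
    module A = PlaneTree A
    module B = PlaneTree B
    module RA = Representation A
    module RB = Representation B

  -- Branching with the children and their images read off from a common parametrisation by Q.
  BranchingVia : {Q : Set} → (Q → A.V) → (Q → B.V) → A.V → B.V → Set
  BranchingVia {Q} f g x y = Σ (Fin (A.arity x) → Fin (B.arity y)) λ σ → (∀ {i j} → i Fin.< j → σ i Fin.< σ j)
    × (∀ j → (Σ Q λ q → f q ≡ A.child x j × B.Anc (B.child y (σ j)) (g q)) × Match (A.lab x) (A.k x j) (B.k y (σ j)))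

  reparametrise : ∀ {Q Q′ : Set} {f g f′ g′ x y} (u : Q → Q′) → (∀ q → f′ (u q) ≡ f q) → (∀ q → g′ (u q) ≡ g q)
                → B.lab y ≡ A.lab x × BranchingVia f g x y → B.lab y ≡ A.lab x × BranchingVia f′ g′ x y
  reparametrise u ef eg (eq , σ , mono , br) = eq , σ , mono , λ j →
    let (q , e , a) , m = br j in (u q , trans (ef q) e , subst (B.Anc _) (sym (eg q)) a) , m

  branching-roots : ∀ {l n m ss ts} (g : Fin n → ℕ × A.V) (g′ : Fin m → ℕ × B.V)
    (R : FRep A (tabulate g) ss) (S : FRep B (tabulate g′) ts) (f : FEmb l ss ts)
    → Σ (Fin n → Fin m) λ σ → (∀ {i j} → i Fin.< j → σ i Fin.< σ j)
      × (∀ j → (Σ (FNode ss) λ q → RA.fname R q ≡ proj₂ (g j)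
                                 × B.Anc (proj₂ (g′ (σ j))) (RB.fname S (⟦ f ⟧ᶠ q)))
             × Match l (proj₁ (g j)) (proj₁ (g′ (σ j))))
  branching-roots {n = zero} g g′ R S f = (λ ()) , (λ { {()} }) , λ ()
  branching-roots {n = suc _} {m = zero}  g g′ (_ ∷ _) [] ()
  branching-roots {n = suc _} {m = suc _} g g′ R@(_ ∷ _) (_ ∷ S) (skip f) with branching-roots g (g′ ∘ suc) R S f
  ... | σ , mono , br = suc ∘ σ , s≤s ∘ mono , br
  branching-roots {l} {n = suc n} {m = suc m} g g′ (R ∷ Rs) (S ∷ Ss) (take mt e f)
    with branching-roots (g ∘ suc) (g′ ∘ suc) Rs Ss f
  ... | σ , mono , br = σ′ , mono′ , br′
    where
    σ′ : Fin (suc n) → Fin (suc m)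
    σ′ zero    = zero
    σ′ (suc j) = suc (σ j)
    mono′ : ∀ {i j} → i Fin.< j → σ′ i Fin.< σ′ j
    mono′ {zero}  {suc j} _         = s≤s z≤n
    mono′ {suc i} {suc j} (s≤s i<j) = s≤s (mono i<j)
    br′ : ∀ j → (Σ (FNode _) λ q → RA.fname (R ∷ Rs) q ≡ proj₂ (g j)
                  × B.Anc (proj₂ (g′ (σ′ j))) (RB.fname (S ∷ Ss) (⟦ take mt e f ⟧ᶠ q)))
              × Match l (proj₁ (g j)) (proj₁ (g′ (σ′ j)))
    br′ zero    = (hd top , refl , RB.name-anc S (⟦ e ⟧ᴱ top)) , mt
    br′ (suc j) = let (q , eq , a) , m = br j in (tl q , eq , a) , m

  branching-at  : ∀ {a b s t} (R : Rep A a s) (S : Rep B b t) (e : Emb s t) (p : Node s)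
    → B.lab (RB.name S (⟦ e ⟧ᴱ p)) ≡ A.lab (RA.name R p)
      × BranchingVia (RA.name R) (RB.name S ∘ ⟦ e ⟧ᴱ) (RA.name R p) (RB.name S (⟦ e ⟧ᴱ p))
  branching-atᴵ : ∀ {a xs s ts} (R : Rep A a s) (S : FRep B xs ts) (e : In s ts) (p : Node s)
    → B.lab (RB.fname S (⟦ e ⟧ᴵ p)) ≡ A.lab (RA.name R p)
      × BranchingVia (RA.name R) (RB.fname S ∘ ⟦ e ⟧ᴵ) (RA.name R p) (RB.fname S (⟦ e ⟧ᴵ p))
  branching-atᶠ : ∀ {l ws xs ss ts} (R : FRep A ws ss) (S : FRep B xs ts) (f : FEmb l ss ts) (p : FNode ss)
    → B.lab (RB.fname S (⟦ f ⟧ᶠ p)) ≡ A.lab (RA.fname R p)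
      × BranchingVia (RA.fname R) (RB.fname S ∘ ⟦ f ⟧ᶠ) (RA.fname R p) (RB.fname S (⟦ f ⟧ᶠ p))

  branching-at (rep refl R) (rep eq S) (top f) top with branching-roots (kid A _) (kid B _) R S f
  ... | σ , mono , br = eq , σ , mono , λ j → let (q , e , a) , m = br j in (down q , e , a) , m
  branching-at (rep _ R) (rep _ S) (top f) (down p) =
    reparametrise down (λ _ → refl) (λ _ → refl) (branching-atᶠ R S f p)
  branching-at R (rep _ S) (down i) p = branching-atᴵ R S i p

  branching-atᴵ R (S ∷ _) (hd e) p = branching-at R S e p
  branching-atᴵ R (_ ∷ S) (tl i) p = branching-atᴵ R S i p

  branching-atᶠ R (_ ∷ S) (skip f) p = branching-atᶠ R S f p
  branching-atᶠ (R ∷ _) (S ∷ _) (take _ e _) (hd p) = reparametrise hd (λ _ → refl) (λ _ → refl) (branching-at R S e p)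
  branching-atᶠ (_ ∷ R) (_ ∷ S) (take _ _ f) (tl p) = reparametrise tl (λ _ → refl) (λ _ → refl) (branching-atᶠ R S f p)

  module _ {s t : Tree} (R : Rep A A.r s) (S : Rep B B.r t) where

    position-of : ∀ x → Node s
    position-of x = proj₁ (RA.pos R (A.root-anc x))

    name-position : ∀ x → RA.name R (position-of x) ≡ x
    name-position x = proj₂ (RA.pos R (A.root-anc x))

    position-name : ∀ p → position-of (RA.name R p) ≡ p
    position-name p = RA.name-injective R _ p (name-position _)

    realise : Emb s t → A.V → B.V
    realise e x = RB.name S (⟦ e ⟧ᴱ (position-of x))

    realise-treeMap : ∀ e → TreeMap A B (realise e)
    realise-treeMap e x =
      subst (λ z → B.lab (realise e z) ≡ A.lab z × Branching A B (realise e) z) (name-position x) (at-name (position-of x))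
      where
      at-name : ∀ p → B.lab (realise e (RA.name R p)) ≡ A.lab (RA.name R p) × Branching A B (realise e) (RA.name R p)
      at-name p with subst (λ q → B.lab (RB.name S (⟦ e ⟧ᴱ q)) ≡ A.lab (RA.name R p)
                        × BranchingVia (RA.name R) (RB.name S ∘ ⟦ e ⟧ᴱ) (RA.name R p) (RB.name S (⟦ e ⟧ᴱ q)))
                      (sym (position-name p)) (branching-at R S e p)
      ... | eq , σ , mono , br = eq , record
        { σ = σ ; σ-mono = mono ; σ-match = proj₂ ∘ br
        ; σ-anc = λ j → let q , nq , a = proj₁ (br j) in
            subst (B.Anc _) (cong (RB.name S ∘ ⟦ e ⟧ᴱ) (trans (sym (position-name q)) (cong position-of nq))) a }

  module _ {F : A.V → B.V} (tm : TreeMap A B F) where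

    -- As `σ` increases strictly, the first target branch, once used or skipped, is not a value at
    -- the remaining branches and can be removed.
    lower : ∀ {n m} (σ : Fin n → Fin (suc m)) → (∀ j → σ j ≢ zero) → ∀ j → Σ (Fin m) λ i → σ j ≡ suc i
    lower σ nz j with σ j | nz j
    ... | zero  | n = ⊥-elim (n refl)
    ... | suc i | _ = i , refl

    -- The image of `a` dictates the code: `top` if it is `b`, otherwise `down` into the branch that
    -- contains it. Along a forest, `take` or `skip` depends on whether `σ zero` is the first
    -- branch.
    emb-of  : ∀ {a b s t} (R : Rep A a s) (S : Rep B b t) → B.Anc b (F a)
            → Σ (Emb s t) λ e → ∀ p → RB.name S (⟦ e ⟧ᴱ p) ≡ F (RA.name R p)
    emb-ofᴵ : ∀ {a x xs s ts} (R : Rep A a s) (S : FRep B xs ts) → x ∈ xs → B.Anc (proj₂ x) (F a)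
            → Σ (In s ts) λ e → ∀ p → RB.fname S (⟦ e ⟧ᴵ p) ≡ F (RA.name R p)
    emb-ofᶠ : ∀ {l n m ss ts} (g : Fin n → ℕ × A.V) (g′ : Fin m → ℕ × B.V)
            → (R : FRep A (tabulate g) ss) (S : FRep B (tabulate g′) ts)
            → (σ : Fin n → Fin m) → (∀ {i j} → i Fin.< j → σ i Fin.< σ j)
            → (∀ j → B.Anc (proj₂ (g′ (σ j))) (F (proj₂ (g j))))
            → (∀ j → Match l (proj₁ (g j)) (proj₁ (g′ (σ j))))
            → Σ (FEmb l ss ts) λ f → ∀ p → RB.fname S (⟦ f ⟧ᶠ p) ≡ F (RA.fname R p)

    emb-of {a} {b} R′@(rep la R) (rep lb S) q with b B.≟ F a
    ... | no b≢Fa with B.branch-towards q b≢Fa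
    ...   | j , jFa = let e , eq = emb-ofᴵ R′ S (∈-tabulate⁺ j) jFa in down e , eq
    emb-of {a} (rep refl R) (rep lb S) q | yes refl with trans (sym lb) (proj₁ (tm a))
    ...   | refl = let open Branching (proj₂ (tm a))
                       f , eq = emb-ofᶠ (kid A a) (kid B (F a)) R S σ σ-mono σ-anc σ-match
                   in top f , λ { top → refl ; (down p) → eq p }

    emb-ofᴵ R (S ∷ _) (here refl) q = let e , eq = emb-of R S q in hd e , eq
    emb-ofᴵ R (_ ∷ S) (there x∈)  q = let e , eq = emb-ofᴵ R S x∈ q in tl e , eq

    emb-ofᶠ {n = zero} g g′ [] S σ mono anc mt = emptyᶠ _ , λ ()
    emb-ofᶠ {n = suc n} {m = zero} g g′ R S σ mono anc mt with σ zero
    ... | ()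
    emb-ofᶠ {l} {n = suc n} {m = suc m} g g′ (R ∷ Rs) (S ∷ Ss) σ mono anc mt with σ zero in eq₀
    ... | zero = take (subst (λ i → Match l (proj₁ (g zero)) (proj₁ (g′ i))) eq₀ (mt zero)) (proj₁ e) (proj₁ es)
               , λ { (hd p) → proj₂ e p ; (tl p) → proj₂ es p }
      where
      e : Σ (Emb _ _) λ e → ∀ p → RB.name S (⟦ e ⟧ᴱ p) ≡ F (RA.name R p)
      e = emb-of R S (subst (λ i → B.Anc (proj₂ (g′ i)) _) eq₀ (anc zero))
      low : ∀ j → Σ (Fin m) λ i → σ (suc j) ≡ suc i
      low = lower (σ ∘ suc) (λ j eq → ℕ.n≮0 (subst (toℕ (σ zero) <_) (cong toℕ eq) (mono (s≤s z≤n))))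
      es : Σ (FEmb l _ _) λ f → ∀ p → RB.fname Ss (⟦ f ⟧ᶠ p) ≡ F (RA.fname Rs p)
      es = emb-ofᶠ (g ∘ suc) (g′ ∘ suc) Rs Ss (proj₁ ∘ low)
             (λ {i} {j} i<j → ℕ.≤-pred (subst₂ Fin._<_ (proj₂ (low i)) (proj₂ (low j)) (mono (s≤s i<j))))
             (λ j → subst (λ i → B.Anc (proj₂ (g′ i)) _) (proj₂ (low j)) (anc (suc j)))
             (λ j → subst (λ i → Match l _ (proj₁ (g′ i))) (proj₂ (low j)) (mt (suc j)))
    ... | suc i₀ = let f , eq = es in skip f , eq
      where
      nz : ∀ j → σ j ≢ zero
      nz zero    eq with trans (sym eq₀) eq
      ... | ()
      nz (suc j) eq = ℕ.n≮0 (subst (toℕ (σ zero) <_) (cong toℕ eq) (mono (s≤s z≤n)))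
      low : ∀ j → Σ (Fin m) λ i → σ j ≡ suc i
      low = lower σ nz
      es : Σ (FEmb l _ _) λ f → ∀ p → RB.fname Ss (⟦ f ⟧ᶠ p) ≡ F (RA.fname (R ∷ Rs) p)
      es = emb-ofᶠ g (g′ ∘ suc) (R ∷ Rs) Ss (proj₁ ∘ low)
             (λ {i} {j} i<j → ℕ.≤-pred (subst₂ Fin._<_ (proj₂ (low i)) (proj₂ (low j)) (mono i<j)))
             (λ j → subst (λ i → B.Anc (proj₂ (g′ i)) _) (proj₂ (low j)) (anc j))
             (λ j → subst (λ i → Match l _ (proj₁ (g′ i))) (proj₂ (low j)) (mt j))

-- The rooted tree of an element of the class

-- The subdivided graph is shown to be a tree by a parent function. With `A` rooted at `a`, the
-- vertex `b` is a child of `a`; both get the new vertex as parent, and all others keep theirs.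
module Subdivision {P : Deg → Set} {n : ℕ} (A : FPData P n) (a b : Fin n) (ab : FPData.E A a b)
                   (p : Deg) (Pp : P p) where

  open FPData A
  open IsTree tree
  open Ancestors Fin._≟_ (tree⇒parented Fin._≟_ tree a)

  private
    c : Choice A
    c = atEdge a b ab p Pp

  b-child : Child a b
  b-child with edge⁻ ab
  ... | inj₁ (a≢a , _) = ⊥-elim (a≢a refl)
  ... | inj₂ ch        = ch

  par′ : Maybe (Fin n) → Maybe (Fin n)
  par′ nothing = nothing
  par′ (just x) with x Fin.≟ a | x Fin.≟ b
  ... | yes _ | _     = nothing
  ... | no  _ | yes _ = nothing
  ... | no  _ | no _  = just (par x)

  -- Rooted at a, only the vertices outside the branch of b move away from the root by the subdivision.
  dep′ : Maybe (Fin n) → ℕ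
  dep′ nothing = dep a
  dep′ (just x) with anc? b x
  ... | yes _ = dep x
  ... | no  _ = suc (dep x)

  par′-a : par′ (just a) ≡ nothing
  par′-a with a Fin.≟ a
  ... | yes _  = refl
  ... | no a≢a = ⊥-elim (a≢a refl)

  par′-b : par′ (just b) ≡ nothing
  par′-b with b Fin.≟ a | b Fin.≟ b
  ... | yes _ | _     = refl
  ... | no  _ | yes _ = refl
  ... | no  _ | no n  = ⊥-elim (n refl)

  par′-other : ∀ {x} → x ≢ a → x ≢ b → par′ (just x) ≡ just (par x)
  par′-other {x} x≢a x≢b with x Fin.≟ a | x Fin.≟ b
  ... | yes eq | _      = ⊥-elim (x≢a eq)
  ... | no  _  | yes eq = ⊥-elim (x≢b eq)
  ... | no  _  | no _   = refl

  dep′-step : ∀ x → dep′ (just x) ≡ suc (dep′ (par′ (just x)))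
  dep′-step x with x Fin.≟ a | x Fin.≟ b | anc? b x
  ... | yes refl | _        | yes q = ⊥-elim (proj₁ b-child (anc-r q))
  ... | yes refl | _        | no _  = refl
  ... | no _     | yes refl | yes _ = trans (dep-par (proj₁ b-child)) (cong (suc ∘ dep) (proj₂ b-child))
  ... | no _     | yes refl | no ¬q = ⊥-elim (¬q self)
  ... | no x≢a   | no x≢b   | yes q with anc? b (par x)
  ...   | yes _ = dep-par x≢a
  ...   | no ¬q = ⊥-elim (¬q (proj₂ (anc-below-par q (x≢b ∘ sym))))
  dep′-step x | no x≢a | no x≢b | no ¬q with anc? b (par x)
  ...   | yes q = ⊥-elim (¬q (up x≢a q))
  ...   | no _  = cong suc (dep-par x≢a)

  TE-symm : ∀ {x y} → TE c x y → TE c y x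
  TE-symm {just x}  {just y}  (e , ne) = symm e , λ { (inj₁ (p , q)) → ne (inj₂ (q , p)) ; (inj₂ (p , q)) → ne (inj₁ (q , p)) }
  TE-symm {just x}  {nothing} e        = e
  TE-symm {nothing} {just y}  e        = e

  just≢nothing : ∀ {x : Fin n} → just x ≢ nothing
  just≢nothing ()

  TE-par : ∀ {x} → x ≢ nothing → TE c x (par′ x)
  TE-par {nothing} n = ⊥-elim (n refl)
  TE-par {just x}  _ with x Fin.≟ a | x Fin.≟ b
  ... | yes eq | _      = inj₁ eq
  ... | no  _  | yes eq = inj₂ eq
  ... | no x≢a | no x≢b = edge⁺ x≢a , λ { (inj₁ (eq , _)) → x≢a eq ; (inj₂ (eq , _)) → x≢b eq }

  TE-edge : ∀ {x y} → TE c x y → (x ≢ nothing × par′ x ≡ y) ⊎ (y ≢ nothing × par′ y ≡ x)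
  TE-edge {just x}  {nothing} (inj₁ refl) = inj₁ (just≢nothing , par′-a)
  TE-edge {just x}  {nothing} (inj₂ refl) = inj₁ (just≢nothing , par′-b)
  TE-edge {nothing} {just y}  (inj₁ refl) = inj₂ (just≢nothing , par′-a)
  TE-edge {nothing} {just y}  (inj₂ refl) = inj₂ (just≢nothing , par′-b)
  TE-edge {just x}  {just y}  (e , ne) with edge⁻ e
  ... | inj₁ (x≢a , refl) = inj₁ (just≢nothing , par′-other x≢a λ { refl → ne (inj₂ (refl , proj₂ b-child)) })
  ... | inj₂ (y≢a , refl) = inj₂ (just≢nothing , par′-other y≢a λ { refl → ne (inj₁ (proj₂ b-child , refl)) })

  TE-parented : Parented (TE c) nothing
  TE-parented = record
    { par     = par′
    ; dep     = dep′
    ; dep-par = λ { {nothing} n → ⊥-elim (n refl) ; {just x} _ → dep′-step x }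
    ; edge⁺   = TE-par
    ; edge⁻   = TE-edge
    }

module _ {P : Deg → Set} {n : ℕ} (A : FPData P n) where

  TV-≟ : (c : Choice A) → DecidableEquality (TV c)
  TV-≟ (atVertex _ _)     = Fin._≟_
  TV-≟ (atEdge _ _ _ _ _) = Maybe.≡-dec Fin._≟_

  abstract

    TE-isTree : (c : Choice A) → IsTree (TE c)
    TE-isTree (atVertex _ _)        = record
      { nonempty = nonempty ; symm = symm ; irrefl = irrefl ; connected = connected ; acyclic = acyclic }
      where open IsTree (FPData.tree A)
    TE-isTree c@(atEdge a b ab p Pp) = parented⇒tree (TV-≟ c) TE-parented (λ {x} {y} → TE-symm {x} {y})
      where open Subdivision A a b ab p Pp

    TE-rooted : (c : Choice A) → Parented (TE c) (root c)
    TE-rooted c = tree⇒parented (TV-≟ c) (TE-isTree c) (root c)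

  Tlabel-P : (c : Choice A) → ∀ v → P (Tlabel c v)
  Tlabel-P (atVertex _ _)      v        = FPData.labelP A v
  Tlabel-P (atEdge _ _ _ _ _)  (just v) = FPData.labelP A v
  Tlabel-P (atEdge _ _ _ _ Pp) nothing  = Pp

  planeTree : (c : Choice A) → Step3 (TE c) (root c) (Tlabel c) → PlaneTree
  planeTree c s = record
    { V = TV c ; _≟_ = TV-≟ c ; E = TE c ; r = root c ; tree = TE-isTree c
    ; parented = TE-rooted c ; lab = Tlabel c ; step3 = s }

-- The graph of a labelled ordered tree

labelOf : Tree → Deg
labelOf (node l _) = l

size  : Tree → ℕ
fsize : Forest → ℕ
size (node l ts) = suc (fsize ts)
fsize []             = 0
fsize ((i , t) ∷ ts) = size t + fsize ts

decode  : ∀ t → Fin (size t) → Node t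
fdecode : ∀ ts → Fin (fsize ts) → FNode ts
decode (node l ts) zero    = top
decode (node l ts) (suc i) = down (fdecode ts i)
fdecode ((i , t) ∷ ts) j = [ (λ k → hd (decode t k)) , (λ k → tl (fdecode ts k)) ]′ (Fin.splitAt (size t) j)

encode  : ∀ t → Node t → Fin (size t)
fencode : ∀ ts → FNode ts → Fin (fsize ts)
encode (node l ts) top      = zero
encode (node l ts) (down p) = suc (fencode ts p)
fencode ((i , t) ∷ ts) (hd p) = encode t p Fin.↑ˡ fsize ts
fencode ((i , t) ∷ ts) (tl p) = size t Fin.↑ʳ fencode ts p

decode-encode   : ∀ t p → decode t (encode t p) ≡ p
fdecode-fencode : ∀ ts p → fdecode ts (fencode ts p) ≡ p
decode-encode (node l ts) top      = refl
decode-encode (node l ts) (down p) = cong down (fdecode-fencode ts p)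
fdecode-fencode ((i , t) ∷ ts) (hd p)
  rewrite Fin.splitAt-↑ˡ (size t) (encode t p) (fsize ts) = cong hd (decode-encode t p)
fdecode-fencode ((i , t) ∷ ts) (tl p)
  rewrite Fin.splitAt-↑ʳ (size t) (fsize ts) (fencode ts p) = cong tl (fdecode-fencode ts p)

encode-decode   : ∀ t i → encode t (decode t i) ≡ i
fencode-fdecode : ∀ ts i → fencode ts (fdecode ts i) ≡ i
encode-decode (node l ts) zero    = refl
encode-decode (node l ts) (suc i) = cong suc (fencode-fdecode ts i)
fencode-fdecode ((i , t) ∷ ts) j with Fin.splitAt (size t) j in eq
... | inj₁ k = trans (cong (Fin._↑ˡ fsize ts) (encode-decode t k))
                     (trans (cong (Fin.join (size t) (fsize ts)) (sym eq)) (Fin.join-splitAt (size t) (fsize ts) j))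
... | inj₂ k = trans (cong (size t Fin.↑ʳ_) (fencode-fdecode ts k))
                     (trans (cong (Fin.join (size t) (fsize ts)) (sym eq)) (Fin.join-splitAt (size t) (fsize ts) j))

labelAt  : ∀ {t} → Node t → Deg
flabelAt : ∀ {ts} → FNode ts → Deg
labelAt {t} top      = labelOf t
labelAt     (down p) = flabelAt p
flabelAt (hd p) = labelAt p
flabelAt (tl p) = flabelAt p

depth  : ∀ {t} → Node t → ℕ
fdepth : ∀ {ts} → FNode ts → ℕ
depth top      = 0
depth (down p) = suc (fdepth p)
fdepth (hd p) = depth p
fdepth (tl p) = fdepth p

later : ∀ {l x ts} → Node (node l ts) → Node (node l (x ∷ ts))
later top      = top
later (down p) = down (tl p)

parent  : ∀ {t} → Node t → Node t
fparent : ∀ {l ts} → FNode ts → Node (node l ts)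
parent top      = top
parent (down p) = fparent p
fparent (hd top)        = top
fparent (hd p@(down _)) = down (hd (parent p))
fparent (tl p)          = later (fparent p)

depth-later : ∀ {l x ts} (p : Node (node l ts)) → depth (later {x = x} p) ≡ depth p
depth-later top      = refl
depth-later (down p) = refl

depth-parent  : ∀ {t} {p : Node t} → p ≢ top → depth p ≡ suc (depth (parent p))
fdepth-fparent : ∀ {l ts} (p : FNode ts) → fdepth p ≡ depth (fparent {l} p)
depth-parent {p = top}    n = ⊥-elim (n refl)
depth-parent {p = down p} n = cong suc (fdepth-fparent p)
fdepth-fparent     (hd top)        = refl
fdepth-fparent     (hd p@(down _)) = depth-parent {p = p} λ ()
fdepth-fparent {l} (tl {x} p)      = trans (fdepth-fparent {l} p) (sym (depth-later {l} {x} (fparent p)))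

-- Listing the children already transported along φ makes the passage to a subtree definitional.
kidsOf  : ∀ {X : Set} {t} → (Node t → X) → Node t → List (ℕ × X)
rootsOf : ∀ {X : Set} ts → (FNode ts → X) → List (ℕ × X)
fkidsOf : ∀ {X : Set} {ts} → (FNode ts → X) → FNode ts → List (ℕ × X)
kidsOf {t = node l ts} φ top      = rootsOf ts (φ ∘ down)
kidsOf                 φ (down p) = fkidsOf (φ ∘ down) p
rootsOf []             φ = []
rootsOf ((i , t) ∷ ts) φ = (i , φ (hd top)) ∷ rootsOf ts (φ ∘ tl)
fkidsOf φ (hd p) = kidsOf (φ ∘ hd) p
fkidsOf φ (tl p) = fkidsOf (φ ∘ tl) p

roots-parent : ∀ {X : Set} {l} ts (φ : FNode ts → X) {x} → x ∈ rootsOf ts φ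
             → ∃ λ q → proj₂ x ≡ φ q × fparent {l} q ≡ top
roots-parent ((i , t) ∷ ts) φ (here refl) = hd top , refl , refl
roots-parent {l = l} ((i , t) ∷ ts) φ (there x∈) with roots-parent {l = l} ts (φ ∘ tl) x∈
... | q , eq , pq = tl q , eq , cong later pq

kids-parent  : ∀ {X : Set} {t} (φ : Node t → X) (p : Node t) {x} → x ∈ kidsOf φ p
             → ∃ λ q → proj₂ x ≡ φ q × q ≢ top × parent q ≡ p
fkids-parent : ∀ {X : Set} {l ts} (φ : FNode ts → X) (p : FNode ts) {x} → x ∈ fkidsOf φ p
             → ∃ λ q → proj₂ x ≡ φ q × fparent {l} q ≡ down p
kids-parent {t = node l ts} φ top x∈ with roots-parent {l = l} ts (φ ∘ down) x∈
... | q , eq , pq = down q , eq , (λ ()) , pq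
kids-parent {t = node l ts} φ (down p) x∈ with fkids-parent {l = l} (φ ∘ down) p x∈
... | q , eq , pq = down q , eq , (λ ()) , pq
fkids-parent φ (hd p) x∈ with kids-parent (φ ∘ hd) p x∈
... | top      , _  , n , _  = ⊥-elim (n refl)
... | q@(down _) , eq , _ , pq = hd q , eq , cong (λ z → down (hd z)) pq
fkids-parent {l = l} φ (tl p) x∈ with fkids-parent {l = l} (φ ∘ tl) p x∈
... | q , eq , pq = tl q , eq , cong later pq

later-kids : ∀ {X : Set} {l x ts} (φ : Node (node l (x ∷ ts)) → X) (p : Node (node l ts)) {y}
           → y ∈ kidsOf (φ ∘ later) p → y ∈ kidsOf φ (later p)
later-kids φ top      y∈ = there y∈
later-kids φ (down p) y∈ = y∈

kid-of-parent  : ∀ {X : Set} {t} (φ : Node t → X) (q : Node t) → q ≢ top → ∃ λ i → (i , φ q) ∈ kidsOf φ (parent q)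
fkid-of-parent : ∀ {X : Set} {l ts} (φ : Node (node l ts) → X) (q : FNode ts)
               → ∃ λ i → (i , φ (down q)) ∈ kidsOf φ (fparent {l} q)
kid-of-parent φ top      n = ⊥-elim (n refl)
kid-of-parent {t = node l ts} φ (down q) n = fkid-of-parent φ q
fkid-of-parent φ (hd top)        = _ , here refl
fkid-of-parent φ (hd q@(down _)) = kid-of-parent (λ z → φ (down (hd z))) q λ ()
fkid-of-parent φ (tl q) = let i , q∈ = fkid-of-parent (φ ∘ later) q in i , later-kids φ (fparent q) q∈

down-injective : ∀ {l ts} {p q : FNode ts} → down {l} p ≡ down q → p ≡ q
down-injective refl = refl

hd-injective : ∀ {i t ts} {p q : Node t} → hd {i} {t} {ts} p ≡ hd q → p ≡ q
hd-injective refl = refl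

tl-injective : ∀ {x ts} {p q : FNode ts} → tl {x} p ≡ tl q → p ≡ q
tl-injective refl = refl

roots-unique : ∀ {X : Set} ts (φ : FNode ts → X) → (∀ {p q} → φ p ≡ φ q → p ≡ q)
             → Unique (map proj₂ (rootsOf ts φ))
roots-unique []             φ inj = []
roots-unique ((i , t) ∷ ts) φ inj =
  unique-cons new (roots-unique ts (φ ∘ tl) (λ eq → tl-injective (inj eq)))
  where
  new : φ (hd top) ∉ map proj₂ (rootsOf ts (φ ∘ tl))
  new m with ∈-map⁻ proj₂ m
  ... | x , x∈ , eq with roots-parent {l = ω} ts (φ ∘ tl) x∈
  ...   | q , eq′ , _ with inj (trans eq eq′)
  ...     | ()

kids-unique  : ∀ {X : Set} {t} (φ : Node t → X) → (∀ {p q} → φ p ≡ φ q → p ≡ q)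
             → ∀ p → Unique (map proj₂ (kidsOf φ p))
fkids-unique : ∀ {X : Set} {ts} (φ : FNode ts → X) → (∀ {p q} → φ p ≡ φ q → p ≡ q)
             → ∀ p → Unique (map proj₂ (fkidsOf φ p))
kids-unique {t = node l ts} φ inj top      = roots-unique ts (φ ∘ down) (λ eq → down-injective (inj eq))
kids-unique {t = node l ts} φ inj (down p) = fkids-unique (φ ∘ down) (λ eq → down-injective (inj eq)) p
fkids-unique φ inj (hd p) = kids-unique (φ ∘ hd) (λ eq → hd-injective (inj eq)) p
fkids-unique φ inj (tl p) = fkids-unique (φ ∘ tl) (λ eq → tl-injective (inj eq)) p

-- A vertex with a parent and exactly one child would have degree 2 in the unrooted tree.
data Full : Tree → Set
data FFull : Forest → Set

data Full where
  full : ∀ {l ts} → length ts ≢ 1 → FFull ts → Full (node l ts)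

data FFull where
  []  : FFull []
  _∷_ : ∀ {i t ts} → Full t → FFull ts → FFull ((i , t) ∷ ts)

roots-length : ∀ {X : Set} ts (φ : FNode ts → X) → length (rootsOf ts φ) ≡ length ts
roots-length []       φ = refl
roots-length (_ ∷ ts) φ = cong suc (roots-length ts (φ ∘ tl))

full-kids  : ∀ {X : Set} {t} → Full t → (φ : Node t → X) → ∀ p → length (kidsOf φ p) ≢ 1
ffull-kids : ∀ {X : Set} {ts} → FFull ts → (φ : FNode ts → X) → ∀ p → length (fkidsOf φ p) ≢ 1
full-kids (full {ts = ts} n _) φ top      eq = n (trans (sym (roots-length ts (φ ∘ down))) eq)
full-kids (full _ f) φ (down p) = ffull-kids f (φ ∘ down) p
ffull-kids (f ∷ _) φ (hd p) = full-kids f (φ ∘ hd) p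
ffull-kids (_ ∷ f) φ (tl p) = ffull-kids f (φ ∘ tl) p

module _ (A : PlaneTree) where

  open PlaneTree A using (V; lab)

  rep-kidsOf  : ∀ {t} (φ : Node t → V)
    → (∀ p → lab (φ p) ≡ labelAt p) → (∀ p → tabulate (kid A (φ p)) ≡ kidsOf φ p) → Rep A (φ top) t
  frep-kidsOf : ∀ ts (φ : FNode ts → V)
    → (∀ p → lab (φ p) ≡ flabelAt p) → (∀ p → tabulate (kid A (φ p)) ≡ fkidsOf φ p) → FRep A (rootsOf ts φ) ts
  rep-kidsOf {node l ts} φ lab≡ kids≡ = rep (lab≡ top)
    (subst (λ ws → FRep A ws ts) (sym (kids≡ top)) (frep-kidsOf ts (φ ∘ down) (lab≡ ∘ down) (kids≡ ∘ down)))
  frep-kidsOf []             φ lab≡ kids≡ = []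
  frep-kidsOf ((i , t) ∷ ts) φ lab≡ kids≡ =
    rep-kidsOf (φ ∘ hd) (lab≡ ∘ hd) (kids≡ ∘ hd) ∷ frep-kidsOf ts (φ ∘ tl) (lab≡ ∘ tl) (kids≡ ∘ tl)

indexAt : ∀ {X : Set} (xs : List (ℕ × X)) → Fin (length (map proj₂ xs)) → ℕ
indexAt ((i , _) ∷ xs) zero    = i
indexAt (_ ∷ xs)       (suc j) = indexAt xs j

tabulate-indexAt : ∀ {X : Set} (xs : List (ℕ × X))
                 → tabulate (λ j → indexAt xs j , lookup (map proj₂ xs) j) ≡ xs
tabulate-indexAt []       = refl
tabulate-indexAt (x ∷ xs) = cong (x ∷_) (tabulate-indexAt xs)

-- `Degree` admits any repetition-free list of the neighbours; this equates its length with that of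
-- the list computed from the tree.
unique-same-length : ∀ {X : Set} {xs ys : List X} → Unique xs → Unique ys
                   → (∀ {x} → x ∈ xs ⇔ x ∈ ys) → length xs ≡ length ys
unique-same-length u v eq = ↭-length (∼bag⇒↭ (unique∧set⇒bag u v eq))

-- Padding by leaves and the target graph

module Padding (P : Deg → Set) (adm : ∀ p → P p → Admissible p) where

  open RamseyForTrees P adm

  data Slots (l : Deg) {X : Set} : ℕ → List (ℕ × X) → Set where
    []   : ∀ {lo} → Slots l lo []
    cons : ∀ {lo i x xs} → Slot l lo i → Slots l i xs → Slots l lo ((i , x) ∷ xs)

  roots-slots : ∀ {X : Set} {l lo ts} → FValid l lo ts → (φ : FNode ts → X) → Slots l lo (rootsOf ts φ)
  roots-slots []           φ = []
  roots-slots (cons s _ f) φ = cons s (roots-slots f (φ ∘ tl))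

  kids-slots  : ∀ {X : Set} {t} → Valid t → (φ : Node t → X) → ∀ p
              → P (labelAt p) × Slots (labelAt p) 0 (kidsOf φ p)
  fkids-slots : ∀ {X : Set} {l lo ts} → FValid l lo ts → (φ : FNode ts → X) → ∀ p
              → P (flabelAt p) × Slots (flabelAt p) 0 (fkidsOf φ p)
  kids-slots (valid pl f) φ top      = pl , roots-slots f (φ ∘ down)
  kids-slots (valid _ f)  φ (down p) = fkids-slots f (φ ∘ down) p
  fkids-slots (cons _ v _) φ (hd p) = kids-slots v (φ ∘ hd) p
  fkids-slots (cons _ _ f) φ (tl p) = fkids-slots f (φ ∘ tl) p

  slots-range : ∀ {X : Set} {p lo} {xs : List (ℕ × X)} → Slots (fin p) lo xs
              → ∀ j → lo < indexAt xs j × indexAt xs j < p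
  slots-range (cons s _)        zero    = s
  slots-range (cons (lo<i , _) f) (suc j) =
    let i<j , j<p = slots-range f j in ℕ.<-trans lo<i i<j , j<p

  slots-increasing : ∀ {X : Set} {p lo} {xs : List (ℕ × X)} → Slots (fin p) lo xs
                   → ∀ i j → i Fin.< j → indexAt xs i < indexAt xs j
  slots-increasing (cons _ f) zero    (suc j) _         = proj₁ (slots-range f j)
  slots-increasing (cons _ f) (suc i) (suc j) (s≤s i<j) = slots-increasing f i j i<j

  -- Strictly increasing indices between `lo` and `p` leave room for fewer than `p - lo` entries.
  -- From `lo = 0` this gives at most `p - 1` children, and the parent brings the degree to at most
  -- `p`.
  slots-length : ∀ {X : Set} {p lo} {xs : List (ℕ × X)} → Slots (fin p) lo xs → lo < p → lo + length xs < p
  slots-length {lo = lo} [] lo<p rewrite ℕ.+-identityʳ lo = lo<p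
  slots-length {lo = lo} (cons {i = i} {xs = xs} (lo<i , i<p) f) _ =
    ℕ.≤-<-trans (subst (_≤ i + length xs) (sym (ℕ.+-suc lo (length xs))) (ℕ.+-monoˡ-≤ (length xs) lo<i)) (slots-length f i<p)

  leaf : Deg → Tree
  leaf l = node l []

  leaf-valid : ∀ {l} → P l → Valid (leaf l)
  leaf-valid pl = valid pl []

  -- The new leaf takes whichever of the slots 1 and 2 the only child leaves free, and stands before
  -- or behind it accordingly; slot 2 exists as `3 ≤ p`. Under ω any index will do.
  widen : Deg → Forest → Forest
  widen (fin p) ((1 , t) ∷ []) = (1 , t) ∷ (2 , leaf (fin p)) ∷ []
  widen (fin p) ((i , t) ∷ []) = (1 , leaf (fin p)) ∷ (i , t) ∷ []
  widen ω       ((i , t) ∷ []) = (i , t) ∷ (i , leaf ω) ∷ []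
  widen l       ts             = ts

  widen-emb : ∀ l {l′} ts → FEmb l′ ts (widen l ts)
  widen-emb (fin p) []                                = done
  widen-emb (fin p) ((0 , t) ∷ [])                    = skip (idᶠ _ _)
  widen-emb (fin p) ((1 , t) ∷ [])                    = take (matchRefl _) (idᴱ t) (skip done)
  widen-emb (fin p) ((suc (suc i) , t) ∷ [])          = skip (idᶠ _ _)
  widen-emb (fin p) ((0 , t) ∷ x ∷ ts)                = idᶠ _ _
  widen-emb (fin p) ((1 , t) ∷ x ∷ ts)                = idᶠ _ _
  widen-emb (fin p) ((suc (suc i) , t) ∷ x ∷ ts)      = idᶠ _ _
  widen-emb ω       []                                = done
  widen-emb ω       ((i , t) ∷ [])                    = take (matchRefl _) (idᴱ t) (skip done)
  widen-emb ω       ((i , t) ∷ x ∷ ts)                = idᶠ _ _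

  widen-valid : ∀ l {ts} → P l → FValid l 0 ts → FValid l 0 (widen l ts)
  widen-valid (fin p) pl []                          = []
  widen-valid (fin p) pl (cons {i = 0} (() , _) v [])
  widen-valid (fin p) pl (cons {i = 1} s v [])       =
    cons s v (cons (s≤s (s≤s z≤n) , adm _ pl) (leaf-valid pl) [])
  widen-valid (fin p) pl (cons {i = suc (suc i)} (_ , i<p) v []) =
    cons (s≤s z≤n , ℕ.<⇒≤ (adm _ pl)) (leaf-valid pl) (cons (s≤s (s≤s z≤n) , i<p) v [])
  widen-valid (fin p) pl f@(cons {i = 0} _ _ (cons _ _ _))           = f
  widen-valid (fin p) pl f@(cons {i = 1} _ _ (cons _ _ _))           = f
  widen-valid (fin p) pl f@(cons {i = suc (suc i)} _ _ (cons _ _ _)) = f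
  widen-valid ω       pl []                          = []
  widen-valid ω       pl (cons _ v [])               = cons tt v (cons tt (leaf-valid pl) [])
  widen-valid ω       pl f@(cons _ _ (cons _ _ _))   = f

  leaf-full : ∀ l → Full (leaf l)
  leaf-full l = full (λ ()) []

  widen-full : ∀ l {ts} → FFull ts → length (widen l ts) ≢ 1 × FFull (widen l ts)
  widen-full (fin p) []                               = (λ ()) , []
  widen-full (fin p) (_∷_ {i = 0} f [])               = (λ ()) , leaf-full _ ∷ f ∷ []
  widen-full (fin p) (_∷_ {i = 1} f [])               = (λ ()) , f ∷ leaf-full _ ∷ []
  widen-full (fin p) (_∷_ {i = suc (suc i)} f [])     = (λ ()) , leaf-full _ ∷ f ∷ []
  widen-full (fin p) fs@(_∷_ {i = 0} _ (_ ∷ _))           = (λ ()) , fs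
  widen-full (fin p) fs@(_∷_ {i = 1} _ (_ ∷ _))           = (λ ()) , fs
  widen-full (fin p) fs@(_∷_ {i = suc (suc i)} _ (_ ∷ _)) = (λ ()) , fs
  widen-full ω       []                               = (λ ()) , []
  widen-full ω       (f ∷ [])                         = (λ ()) , f ∷ leaf-full _ ∷ []
  widen-full ω       fs@(_ ∷ _ ∷ _)                   = (λ ()) , fs

  pad  : Tree → Tree
  fpad : Forest → Forest
  pad (node l ts) = node l (widen l (fpad ts))
  fpad []             = []
  fpad ((i , t) ∷ ts) = (i , pad t) ∷ fpad ts

  pad-emb  : ∀ t → Emb t (pad t)
  fpad-emb : ∀ l ts → FEmb l ts (fpad ts)
  pad-emb (node l ts) = top (widen-emb l (fpad ts) ∘ᶠ fpad-emb l ts)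
  fpad-emb l []             = done
  fpad-emb l ((i , t) ∷ ts) = take (matchRefl l) (pad-emb t) (fpad-emb l ts)

  pad-valid  : ∀ {t} → Valid t → Valid (pad t)
  fpad-valid : ∀ {l lo ts} → FValid l lo ts → FValid l lo (fpad ts)
  pad-valid (valid {l} pl f) = valid pl (widen-valid l pl (fpad-valid f))
  fpad-valid []           = []
  fpad-valid (cons s v f) = cons s (pad-valid v) (fpad-valid f)

  pad-full  : ∀ t → Full (pad t)
  fpad-full : ∀ ts → FFull (fpad ts)
  pad-full (node l ts) = let n , f = widen-full l (fpad-full ts) in full n f
  fpad-full []             = []
  fpad-full ((i , t) ∷ ts) = pad-full t ∷ fpad-full ts

  -- A root with a single child never comes from a subdivided edge, so T is an element of both classes.
  module Realised (u : Tree) (vu : Valid u) (fu : Full u) (l : Deg) (pl : P l) where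

    T : Tree
    T = node l ((1 , u) ∷ [])

    T-valid : Valid T
    T-valid = valid pl (cons (slot l (adm l pl)) vu [])
      where
      slot : ∀ l → Admissible l → Slot l 0 1
      slot (fin p) 3≤p = s≤s z≤n , ℕ.<⇒≤ 3≤p
      slot ω       _   = tt

    n : ℕ
    n = size T

    private
      enc : Node T → Fin n
      enc = encode T
      dec : Fin n → Node T
      dec = decode T

    parF : Fin n → Fin n
    parF x = enc (parent (dec x))

    EF : Fin n → Fin n → Set
    EF x y = (x ≢ zero × parF x ≡ y) ⊎ (y ≢ zero × parF y ≡ x)

    dec≢top : ∀ {x} → x ≢ zero → dec x ≢ top
    dec≢top {x} x≢0 eq = x≢0 (trans (sym (encode-decode T x)) (cong enc eq))

    prF : Parented EF zero
    prF = record
      { par     = parF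
      ; dep     = depth ∘ dec
      ; dep-par = λ x≢0 → trans (depth-parent (dec≢top x≢0)) (cong (suc ∘ depth) (sym (decode-encode T _)))
      ; edge⁺   = λ x≢0 → inj₁ (x≢0 , refl)
      ; edge⁻   = id
      }

    EF-tree : IsTree EF
    EF-tree = parented⇒tree Fin._≟_ prF λ { (inj₁ e) → inj₂ e ; (inj₂ e) → inj₁ e }

    open Ancestors Fin._≟_ prF
    open Paths EF-tree

    kidsF : Fin n → List (ℕ × Fin n)
    kidsF x = kidsOf enc (dec x)

    succsF : Fin n → List (Fin n)
    succsF x = map proj₂ (kidsF x)

    enc-injective : ∀ {p q} → enc p ≡ enc q → p ≡ q
    enc-injective {p} {q} eq = trans (sym (decode-encode T p)) (trans (cong dec eq) (decode-encode T q))

    succsF-unique : ∀ x → Unique (succsF x)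
    succsF-unique x = kids-unique enc enc-injective (dec x)

    succsF⇒Child : ∀ {x c} → c ∈ succsF x → Child x c
    succsF⇒Child {x} c∈ with ∈-map⁻ proj₂ c∈
    ... | w , w∈ , refl with kids-parent enc (dec x) w∈
    ...   | q , eq , q≢top , pq = (λ { c≡0 → q≢top (enc-injective (trans (sym eq) c≡0)) })
          , trans (cong parF eq) (trans (cong (enc ∘ parent) (decode-encode T q)) (trans (cong enc pq) (encode-decode T x)))

    Child⇒succsF : ∀ {x c} → Child x c → c ∈ succsF x
    Child⇒succsF {c = c} (c≢0 , refl) with kid-of-parent enc (dec c) (dec≢top c≢0)
    ... | i , c∈ = subst (_∈ succsF (parF c)) (encode-decode T c)
          (∈-map⁺ proj₂ (subst (λ p → (i , enc (dec c)) ∈ kidsOf enc p) (sym (decode-encode T (parent (dec c)))) c∈))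

    labF : Fin n → Deg
    labF = labelAt ∘ dec

    neighbours : ∀ {x d} → Degree EF x d → x ≢ zero → d ≡ suc (length (kidsF x))
    neighbours {x} (xs , u , iff , refl) x≢0 = trans
      (unique-same-length u (unique-cons par∉ (succsF-unique x)) (λ {y} → mk⇔ (to ∘ Equivalence.to (iff y)) (Equivalence.from (iff y) ∘ from)))
      (cong suc (List.length-map proj₂ (kidsF x)))
      where
      par∉ : parF x ∉ succsF x
      par∉ p∈ = child-not-anc (succsF⇒Child p∈) (anc-par x≢0)
      to : ∀ {y} → EF x y → y ∈ parF x ∷ succsF x
      to (inj₁ (_ , eq)) = here (sym eq)
      to (inj₂ ch)       = there (Child⇒succsF ch)
      from : ∀ {y} → y ∈ parF x ∷ succsF x → EF x y
      from (here refl) = inj₁ (x≢0 , refl)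
      from (there y∈)  = inj₂ (succsF⇒Child y∈)

    neighbours-root : ∀ {d} → Degree EF zero d → d ≡ 1
    neighbours-root (xs , u , iff , refl) = unique-same-length u (succsF-unique zero)
      (λ {y} → mk⇔ (to ∘ Equivalence.to (iff y)) (Equivalence.from (iff y) ∘ inj₂ ∘ succsF⇒Child))
      where
      to : ∀ {y} → EF zero y → y ∈ succsF zero
      to (inj₁ (n , _)) = ⊥-elim (n refl)
      to (inj₂ ch)      = Child⇒succsF ch

    kidsF-length : ∀ x → x ≢ zero → length (kidsF x) ≢ 1
    kidsF-length x x≢0 with dec x | dec≢top x≢0
    ... | top         | n = ⊥-elim (n refl)
    -- All positions other than the root lie in `u`, which is full.
    ... | down (hd p) | _ = full-kids fu (λ q → enc (down (hd q))) p

    kidsF-slots : ∀ x → P (labF x) × Slots (labF x) 0 (kidsF x)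
    kidsF-slots x = kids-slots T-valid enc (dec x)

    degree-bound : ∀ l {lo} {xs : List (ℕ × Fin n)} → Admissible l → Slots l lo xs → lo ≡ 0 → suc (length xs) ≤ᵈ l
    degree-bound (fin p) 3≤p s refl = slots-length s (ℕ.≤-trans (s≤s z≤n) 3≤p)
    degree-bound ω       _   s refl = tt

    one-below : ∀ l → Admissible l → 1 <ᵈ l
    one-below (fin p) 3≤p = ℕ.<⇒≤ 3≤p
    one-below ω       _   = tt

    one-within : ∀ l → Admissible l → 1 ≤ᵈ l
    one-within (fin p) 3≤p = ℕ.≤-trans (s≤s z≤n) 3≤p
    one-within ω       _   = tt

    data-F : FPData P n
    data-F = record
      { E = EF ; tree = EF-tree ; label = labF ; labelP = proj₁ ∘ kidsF-slots ; noDeg2 = noDeg2 ; degBound = degBound }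
      where
      noDeg2 : ∀ x → ¬ Degree EF x 2
      noDeg2 x deg with x Fin.≟ zero
      ... | yes refl with neighbours-root deg
      ...   | ()
      noDeg2 x deg | no x≢0 = kidsF-length x x≢0 (sym (ℕ.suc-injective (neighbours deg x≢0)))
      degBound : ∀ x d → Degree EF x d → d ≤ᵈ labF x
      degBound x d deg with x Fin.≟ zero
      ... | yes refl = subst (_≤ᵈ l) (sym (neighbours-root deg)) (one-within l (adm l pl))
      ... | no x≢0 with neighbours deg x≢0 | kidsF-slots x
      ...   | refl | px , s = degree-bound (labF x) (adm _ px) s refl

    root-free : ∀ d → Degree EF zero d → d <ᵈ labF zero
    root-free d deg = subst (_<ᵈ l) (sym (neighbours-root deg)) (one-below l (adm l pl))

    choice-F : Choice data-F
    choice-F = atVertex zero root-free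

    step3-F : Step3 (TE choice-F) (root choice-F) (Tlabel choice-F)
    step3-F = record
      { succs         = succsF
      ; succsUnique   = succsF-unique
      ; succsComplete = λ a b → mk⇔ (Child⇒ImmSucc ∘ succsF⇒Child) (Child⇒succsF ∘ ImmSucc⇒Child)
      ; k             = λ x → indexAt (kidsF x)
      ; kRange        = λ x p eq → range eq (proj₂ (kidsF-slots x))
      ; kIncr         = λ x p eq → increasing eq (proj₂ (kidsF-slots x))
      }
      where
      range : ∀ {l p} {xs : List (ℕ × Fin n)} → l ≡ fin p → Slots l 0 xs → ∀ j → 1 ≤ indexAt xs j × indexAt xs j ≤ p ∸ 1
      range refl s j with slots-range s j
      ... | pos , s≤s i≤p = pos , i≤p
      increasing : ∀ {l p} {xs : List (ℕ × Fin n)} → l ≡ fin p → Slots l 0 xs → ∀ i j → i Fin.< j → indexAt xs i < indexAt xs j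
      increasing refl = slots-increasing

    tree-F : PlaneTree
    tree-F = planeTree data-F choice-F step3-F

    rep-F : Rep tree-F zero T
    rep-F = rep-kidsOf tree-F enc (λ p → cong labelAt (decode-encode T p))
      (λ p → trans (tabulate-indexAt (kidsF (enc p))) (cong (kidsOf enc) (decode-encode T p)))

-- Embeddings of structures

bounded-Fin : ∀ {n} (f : Fin n → ℕ) → ∃ λ N → ∀ i → f i ≤ N
bounded-Fin {zero}  f = 0 , λ ()
bounded-Fin {suc n} f with bounded-Fin (f ∘ suc)
... | N , f≤N = f zero + N , λ { zero    → ℕ.m≤m+n (f zero) N
                               ; (suc i) → ℕ.≤-trans (f≤N i) (ℕ.m≤n+m N (f zero)) }

bounded-TV : ∀ {P n} {A : FPData P n} (c : Choice A) (f : TV c → ℕ) → ∃ λ N → ∀ v → f v ≤ N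
bounded-TV (atVertex _ _)     f = bounded-Fin f
bounded-TV (atEdge _ _ _ _ _) f with bounded-Fin (f ∘ just)
... | N , f≤N = f nothing + N , λ { nothing  → ℕ.m≤m+n (f nothing) N
                                  ; (just i) → ℕ.≤-trans (f≤N i) (ℕ.m≤n+m N (f nothing)) }

ι-injective : ∀ {P n} {A : FPData P n} (c : Choice A) {x y} → ι c x ≡ ι c y → x ≡ y
ι-injective (atVertex _ _)     eq = eq
ι-injective (atEdge _ _ _ _ _) eq = Maybe.just-injective eq

⇔-trans : ∀ {X Y Z : Set} → X ⇔ Y → Y ⇔ Z → X ⇔ Z
⇔-trans f g = mk⇔ (Equivalence.to g ∘ Equivalence.to f) (Equivalence.from f ∘ Equivalence.from g)

⇔-sym : ∀ {X Y : Set} → X ⇔ Y → Y ⇔ X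
⇔-sym f = mk⇔ (Equivalence.from f) (Equivalence.to f)

⇔-refl : ∀ {X : Set} → X ⇔ X
⇔-refl = mk⇔ id id

module _ {P : Deg → Set} where

  embT-id : ∀ {X} {A : StrT X} → EmbT P A A id
  embT-id = record
    { inj = λ _ _ → id ; presD = λ _ _ _ _ → ⇔-refl ; presK = λ _ _ _ → ⇔-refl ; presC = λ _ _ _ → ⇔-refl
    ; presPrec = λ _ _ → ⇔-refl ; presG = λ _ _ _ _ → ⇔-refl }

  embT-∘ : ∀ {X Y Z} {A : StrT X} {B : StrT Y} {C : StrT Z} {f g} → EmbT P B C g → EmbT P A B f → EmbT P A C (g ∘ f)
  embT-∘ {f = f} G F = record
    { inj      = λ x y eq → F.inj x y (G.inj _ _ eq)
    ; presD    = λ a b c d → ⇔-trans (F.presD a b c d) (G.presD _ _ _ _)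
    ; presK    = λ p Pp a → ⇔-trans (F.presK p Pp a) (G.presK p Pp _)
    ; presC    = λ a b c → ⇔-trans (F.presC a b c) (G.presC _ _ _)
    ; presPrec = λ a b → ⇔-trans (F.presPrec a b) (G.presPrec _ _)
    ; presG    = λ i 1≤i a b → ⇔-trans (F.presG i 1≤i a b) (G.presG i 1≤i _ _)
    }
    where module F = EmbT F
          module G = EmbT G

  -- A tabulated vector reproduces a map only pointwise, so embeddings have to be carried along
  -- pointwise equality.
  embT-cong : ∀ {X Y} {A : StrT X} {B : StrT Y} {f g} → (∀ x → f x ≡ g x) → EmbT P A B f → EmbT P A B g
  embT-cong {A = A} {B} {f} {g} f≗g F = record
    { inj      = λ x y eq → F.inj x y (trans (f≗g x) (trans eq (sym (f≗g y))))
    ; presD    = D′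
    ; presK    = λ p Pp a → subst (λ z → StrT.K A p a ⇔ StrT.K B p z) (f≗g a) (F.presK p Pp a)
    ; presC    = C′
    ; presPrec = λ a b → subst₂ (λ y z → StrT.prec A a b ⇔ StrT.prec B y z) (f≗g a) (f≗g b) (F.presPrec a b)
    ; presG    = λ i 1≤i a b → subst₂ (λ y z → StrT.G A i a b ⇔ StrT.G B i y z) (f≗g a) (f≗g b) (F.presG i 1≤i a b)
    }
    where
    module F = EmbT F
    D′ : ∀ a b c d → StrT.D A a b c d ⇔ StrT.D B (g a) (g b) (g c) (g d)
    D′ a b c d rewrite sym (f≗g a) | sym (f≗g b) | sym (f≗g c) | sym (f≗g d) = F.presD a b c d
    C′ : ∀ a b c → StrT.C A a b c ⇔ StrT.C B (g a) (g b) (g c)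
    C′ a b c rewrite sym (f≗g a) | sym (f≗g b) | sym (f≗g c) = F.presC a b c

  module _ {X Y : Set} {A : StrT X} {B : StrT Y} {f : X → Y} (F : EmbT P A B f) (sur : Surjective f) where

    private module F = EmbT F

    inverse : Y → X
    inverse y = proj₁ (sur y)

    f-inverse : ∀ y → f (inverse y) ≡ y
    f-inverse y = proj₂ (sur y)

    inverse-f : ∀ x → inverse (f x) ≡ x
    inverse-f x = F.inj _ _ (f-inverse (f x))

    embT-inverse : EmbT P B A inverse
    embT-inverse = record
      { inj      = λ x y eq → trans (sym (f-inverse x)) (trans (cong f eq) (f-inverse y))
      ; presD    = λ a b c d → ⇔-trans (E.presD a b c d) (⇔-sym (F.presD _ _ _ _))
      ; presK    = λ p Pp a → ⇔-trans (E.presK p Pp a) (⇔-sym (F.presK p Pp _))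
      ; presC    = λ a b c → ⇔-trans (E.presC a b c) (⇔-sym (F.presC _ _ _))
      ; presPrec = λ a b → ⇔-trans (E.presPrec a b) (⇔-sym (F.presPrec _ _))
      ; presG    = λ i 1≤i a b → ⇔-trans (E.presG i 1≤i a b) (⇔-sym (F.presG i 1≤i _ _))
      }
      where module E = EmbT (embT-cong {g = f ∘ inverse} (sym ∘ f-inverse) embT-id)

  embF-∘ : ∀ {X Y Z} {A : StrF X} {B : StrF Y} {C : StrF Z} {f g} → EmbF P B C g → EmbF P A B f → EmbF P A C (g ∘ f)
  embF-∘ G F = record
    { embBase = embT-∘ G.embBase F.embBase
    ; presR   = λ p Pp a b → ⇔-trans (F.presR p Pp a b) (G.presR p Pp _ _)
    ; presH   = λ i j 1≤i i<j a b → ⇔-trans (F.presH i j 1≤i i<j a b) (G.presH i j 1≤i i<j _ _)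
    }
    where module F = EmbF F
          module G = EmbF G

  embF-id : ∀ {X} {A : StrF X} → EmbF P A A id
  embF-id = record { embBase = embT-id ; presR = λ _ _ _ _ → ⇔-refl ; presH = λ _ _ _ _ _ _ → ⇔-refl }

  embF-cong : ∀ {X Y} {A : StrF X} {B : StrF Y} {f g} → (∀ x → f x ≡ g x) → EmbF P A B f → EmbF P A B g
  embF-cong {A = A} {B} f≗g F = record
    { embBase = embT-cong f≗g F.embBase
    ; presR   = λ p Pp a b → subst₂ (λ y z → StrF.R A p a b ⇔ StrF.R B p y z) (f≗g a) (f≗g b) (F.presR p Pp a b)
    ; presH   = λ i j 1≤i i<j a b → subst₂ (λ y z → StrF.H A i j a b ⇔ StrF.H B i j y z) (f≗g a) (f≗g b) (F.presH i j 1≤i i<j a b)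
    }
    where module F = EmbF F

  embF-inverse : ∀ {X Y} {A : StrF X} {B : StrF Y} {f} (F : EmbF P A B f) (sur : Surjective f)
               → EmbF P B A (inverse (EmbF.embBase F) sur)
  embF-inverse {B = B} {f = f} F sur = record
    { embBase = embT-inverse F.embBase sur
    ; presR   = λ p Pp a b → ⇔-trans (E.presR p Pp a b) (⇔-sym (F.presR p Pp _ _))
    ; presH   = λ i j 1≤i i<j a b → ⇔-trans (E.presH i j 1≤i i<j a b) (⇔-sym (F.presH i j 1≤i i<j _ _))
    }
    where
    module F = EmbF F
    module E = EmbF (embF-cong {A = B} {B = B} {g = f ∘ inverse F.embBase sur} (sym ∘ f-inverse F.embBase sur) embF-id)

module _ {P : Deg → Set} {n m : ℕ} {DA : FPData P n} {DB : FPData P m} (c : Choice DA) (d : Choice DB)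
         (s : Step3 (TE c) (root c) (Tlabel c)) (s′ : Step3 (TE d) (root d) (Tlabel d)) where

  private
    TA TB : PlaneTree
    TA = planeTree DA c s
    TB = planeTree DB d s′
    module A = PlaneTree TA
    module B = PlaneTree TB

  embT⇒treeMap : ∀ {F} → EmbT P A.str B.str F → TreeMap TA TB F
  embT⇒treeMap {F} em v = Equivalence.to (presK (A.lab v) (Tlabel-P DA c v) v) refl
    , good-branching TA TB (λ _ → ⊤) (λ {a} {b} {c} _ _ _ → presC a b c)
        (λ {a} {b} _ _ → Equivalence.to (presPrec a b)) (λ {i} {a} {b} 1≤i _ _ → Equivalence.to (presG i 1≤i a b)) v tt (λ _ → tt)
    where open EmbT em

  -- `R` and `H` speak of a meet that may be the missing root, so `F` is given on the whole rooted
  -- tree. It preserves meets, hence every meet of images is the image of a meet.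
  treeMap⇒embF : ∀ {F} → TreeMap TA TB F → (f : Fin n → Fin m) → (∀ x → F (ι c x) ≡ ι d (f x))
               → EmbF P (FStr c s) (FStr d s′) f
  treeMap⇒embF {F} tm f F≡ = record
    { embBase = record
      { inj      = λ x y eq → ι-injective c (F-injective (trans (F≡ x) (trans (cong (ι d) eq) (sym (F≡ y)))))
      ; presD    = D′
      ; presK    = K′
      ; presC    = C′
      ; presPrec = prec′
      ; presG    = G′
      }
    ; presR = λ p _ a b → mk⇔ (R⁺ p a b) (R⁻ p a b)
    ; presH = λ i j _ _ a b → mk⇔ (H⁺ i j a b) (H⁻ i j a b)
    }
    where
    open TreeMaps TA TB tm
    D′ : ∀ w x y z → StrT.D (StrF.base (FStr c s)) w x y z ⇔ StrT.D (StrF.base (FStr d s′)) (f w) (f x) (f y) (f z)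
    D′ w x y z rewrite sym (F≡ w) | sym (F≡ x) | sym (F≡ y) | sym (F≡ z) = D⇔ _ _ _ _
    C′ : ∀ w x y → StrT.C (StrF.base (FStr c s)) w x y ⇔ StrT.C (StrF.base (FStr d s′)) (f w) (f x) (f y)
    C′ w x y rewrite sym (F≡ w) | sym (F≡ x) | sym (F≡ y) = C⇔ _ _ _
    K′ : ∀ p → P p → ∀ x → StrT.K (StrF.base (FStr c s)) p x ⇔ StrT.K (StrF.base (FStr d s′)) p (f x)
    K′ p _ x rewrite sym (F≡ x) = K⇔ p _
    prec′ : ∀ x y → StrT.prec (StrF.base (FStr c s)) x y ⇔ StrT.prec (StrF.base (FStr d s′)) (f x) (f y)
    prec′ x y rewrite sym (F≡ x) | sym (F≡ y) = prec⇔ _ _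
    G′ : ∀ i → 1 ≤ i → ∀ x y → StrT.G (StrF.base (FStr c s)) i x y ⇔ StrT.G (StrF.base (FStr d s′)) i (f x) (f y)
    G′ i _ x y rewrite sym (F≡ x) | sym (F≡ y) = G⇔ i _ _
    inc⁺ : ∀ {x y} → Incomparable A.E A.r x y → Incomparable B.E B.r (F x) (F y)
    inc⁺ (p , q) = p ∘ A.Anc⇒Le ∘ anc⁻ ∘ B.Le⇒Anc , q ∘ A.Anc⇒Le ∘ anc⁻ ∘ B.Le⇒Anc
    inc⁻ : ∀ {x y} → Incomparable B.E B.r (F x) (F y) → Incomparable A.E A.r x y
    inc⁻ (p , q) = p ∘ B.Anc⇒Le ∘ anc⁺ ∘ A.Le⇒Anc , q ∘ B.Anc⇒Le ∘ anc⁺ ∘ A.Le⇒Anc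
    preimage : ∀ {x y z} → Meet B.E B.r (F x) (F y) z → ∃ λ w → Meet A.E A.r x y w × F w ≡ z
    preimage {x} {y} im with A.meet x y
    ... | w , iw = w , A.IsMeet⇒Meet iw , B.meet-unique (meet⁺ iw) (B.Meet⇒IsMeet im)
    RB : Deg → B.V → B.V → Set
    RB p u v = Incomparable B.E B.r u v × ∃ λ z → Meet B.E B.r u v z × B.lab z ≡ p
    HB : ℕ → ℕ → B.V → B.V → Set
    HB i j u v = Incomparable B.E B.r u v
               × ∃ λ z → Meet B.E B.r u v z × StrT.G B.str i z u × StrT.G B.str j z v
    R⁺ : ∀ p x y → StrF.R (FStr c s) p x y → StrF.R (FStr d s′) p (f x) (f y)
    R⁺ p x y (inc , w , im , lw) = subst₂ (RB p) (F≡ x) (F≡ y)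
      (inc⁺ inc , F w , B.IsMeet⇒Meet (meet⁺ (A.Meet⇒IsMeet im)) , trans (proj₁ (tm w)) lw)
    R⁻ : ∀ p x y → StrF.R (FStr d s′) p (f x) (f y) → StrF.R (FStr c s) p x y
    R⁻ p x y h = reflect (subst₂ (RB p) (sym (F≡ x)) (sym (F≡ y)) h)
      where
      reflect : RB p (F (ι c x)) (F (ι c y)) → StrF.R (FStr c s) p x y
      reflect (inc , z , im , lz) = let w , iw , eq = preimage im in
        inc⁻ inc , w , iw , trans (sym (proj₁ (tm w))) (trans (cong B.lab eq) lz)
    H⁺ : ∀ i j x y → StrF.H (FStr c s) i j x y → StrF.H (FStr d s′) i j (f x) (f y)
    H⁺ i j x y (inc , w , im , gi , gj) = subst₂ (HB i j) (F≡ x) (F≡ y)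
      (inc⁺ inc , F w , B.IsMeet⇒Meet (meet⁺ (A.Meet⇒IsMeet im))
      , Equivalence.to (G⇔ i _ _) gi , Equivalence.to (G⇔ j _ _) gj)
    H⁻ : ∀ i j x y → StrF.H (FStr d s′) i j (f x) (f y) → StrF.H (FStr c s) i j x y
    H⁻ i j x y h = reflect (subst₂ (HB i j) (sym (F≡ x)) (sym (F≡ y)) h)
      where
      reflect : HB i j (F (ι c x)) (F (ι c y)) → StrF.H (FStr c s) i j x y
      reflect (inc , z , im , gi , gj) = let w , iw , eq = preimage im in
        inc⁻ inc , w , iw
        , Equivalence.from (G⇔ i _ _) (subst (λ v → StrT.G B.str i v _) (sym eq) gi)
        , Equivalence.from (G⇔ j _ _) (subst (λ v → StrT.G B.str j v _) (sym eq) gj)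

-- Ramsey classes

module _ {P : Deg → Set} {n m : ℕ} {DA : FPData P n} {DB : FPData P m} where

  -- A missing root of A is the meet of its two children, and its label and the indices of its two branches
  -- are recorded by the relations R and H; it is sent to the meet of the images of these children.
  module AtMissingRoot (a b : Fin n) (ab : FPData.E DA a b) (p : Deg) (Pp : P p) (d : Choice DB) where

    private
      c : Choice DA
      c = atEdge a b ab p Pp

    module _ (s : Step3 (TE c) nothing (Tlabel c)) (s′ : Step3 (TE d) (root d) (Tlabel d))
             {f : Fin n → Fin m} (em : EmbF P (FStr c s) (FStr d s′) f) where

      private
        TA TB : PlaneTree
        TA = planeTree DA c s
        TB = planeTree DB d s′
        module A = PlaneTree TA
        module B = PlaneTree TB
        open EmbF em
        open EmbT embBase

      end-child : ∀ {x} → A.E nothing (just x) → A.Child nothing (just x)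
      end-child e with A.edge⁻ e
      ... | inj₁ (n≢n , _) = ⊥-elim (n≢n refl)
      ... | inj₂ ch        = ch

      child-end : ∀ j → A.child nothing j ≡ just a ⊎ A.child nothing j ≡ just b
      child-end j with A.child nothing j | A.child-isChild nothing j
      ... | nothing | n≢n , _ = ⊥-elim (n≢n refl)
      ... | just x  | x≢ , eq with subst (TE c (just x)) eq (A.edge⁺ x≢)
      ...   | inj₁ refl = inj₁ refl
      ...   | inj₂ refl = inj₂ refl

      -- The ends of the subdivided edge are the only children of the new root, but `Step3` may
      -- order them either way; `x₀` is the one that comes first.
      record Ends : Set where
        field
          x₀ x₁ : Fin n
          j₀ j₁ : Fin (A.arity nothing)
          j₀<j₁ : j₀ Fin.< j₁
          eq₀   : A.child nothing j₀ ≡ just x₀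
          eq₁   : A.child nothing j₁ ≡ just x₁
          all   : ∀ j → j ≡ j₀ ⊎ j ≡ j₁

      ends : Ends
      ends with A.child-index (end-child (inj₁ refl)) | A.child-index (end-child (inj₂ refl))
      ... | i , eqa | j , eqb = by-order (Fin.<-cmp i j)
        where
        all : ∀ k → k ≡ i ⊎ k ≡ j
        all k with child-end k
        ... | inj₁ eq = inj₁ (A.child-injective nothing k i (trans eq (sym eqa)))
        ... | inj₂ eq = inj₂ (A.child-injective nothing k j (trans eq (sym eqb)))
        by-order : _ → Ends
        by-order (tri< i<j _ _) = record { j₀<j₁ = i<j ; eq₀ = eqa ; eq₁ = eqb ; all = all }
        by-order (tri> _ _ j<i) = record { j₀<j₁ = j<i ; eq₀ = eqb ; eq₁ = eqa ; all = [ inj₂ , inj₁ ]′ ∘ all }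
        by-order (tri≈ _ i≡j _) = ⊥-elim (IsTree.irrefl (FPData.tree DA) a (subst (FPData.E DA a) (sym a≡b) ab))
          where
          a≡b : a ≡ b
          a≡b = Maybe.just-injective (trans (sym eqa) (trans (cong (A.child nothing) i≡j) eqb))

      open Ends ends

      F₀ F₁ : B.V
      F₀ = ι d (f x₀)
      F₁ = ι d (f x₁)

      new-root : B.V
      new-root = proj₁ (B.meet F₀ F₁)

      new-root-meet : B.IsMeet F₀ F₁ new-root
      new-root-meet = proj₂ (B.meet F₀ F₁)

      F̃ : A.V → B.V
      F̃ nothing  = new-root
      F̃ (just x) = ι d (f x)

      root-meet : A.IsMeet (just x₀) (just x₁) nothing
      root-meet = A.branches-meet (Fin.<⇒≢ j₀<j₁) (subst (A.Anc _) eq₀ A.self) (subst (A.Anc _) eq₁ A.self)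

      x₀≺x₁ : A.Prec (just x₀) (just x₁)
      x₀≺x₁ = nothing , j₀ , j₁ , j₀<j₁ , subst (A.Anc _) eq₀ A.self , subst (A.Anc _) eq₁ A.self

      root-incomparable : Incomparable A.E nothing (just x₀) (just x₁)
      root-incomparable = A.Prec-not-above x₀≺x₁ ∘ A.Le⇒Anc , A.Prec-not-below x₀≺x₁ ∘ A.Le⇒Anc

      F₀≺F₁ : B.Prec F₀ F₁
      F₀≺F₁ = B.prec⇒Prec (Equivalence.to (presPrec x₀ x₁) (A.Prec⇒prec x₀≺x₁))

      root-label : B.lab new-root ≡ p
      root-label with Equivalence.to (presR p Pp x₀ x₁) (root-incomparable , nothing , A.IsMeet⇒Meet root-meet , refl)
      ... | _ , z , im , lz = trans (cong B.lab (B.meet-unique new-root-meet (B.Meet⇒IsMeet im))) lz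

      root-index : ∀ q → p ≡ fin q → StrT.G B.str (A.k nothing j₀) new-root F₀ × StrT.G B.str (A.k nothing j₁) new-root F₁
      -- `H` exists only for increasing indices; `kIncr` and `j₀<j₁` provide this order.
      root-index q eq with Equivalence.to
          (presH (A.k nothing j₀) (A.k nothing j₁) (proj₁ (A.kRange nothing q eq j₀)) (A.kIncr nothing q eq j₀ j₁ j₀<j₁) x₀ x₁)
          ( root-incomparable , nothing , A.IsMeet⇒Meet root-meet
          , (q , eq , j₀ , refl , A.Anc⇒Le (subst (A.Anc _) eq₀ A.self))
          , (q , eq , j₁ , refl , A.Anc⇒Le (subst (A.Anc _) eq₁ A.self)))
      ... | _ , z , im , g₀ , g₁ =
        subst (λ v → StrT.G B.str (A.k nothing j₀) v F₀) z≡ g₀ , subst (λ v → StrT.G B.str (A.k nothing j₁) v F₁) z≡ g₁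
        where
        z≡ : z ≡ new-root
        z≡ = B.meet-unique (B.Meet⇒IsMeet im) new-root-meet

      image₀ : F̃ (A.child nothing j₀) ≡ F₀
      image₀ = cong F̃ eq₀

      image₁ : F̃ (A.child nothing j₁) ≡ F₁
      image₁ = cong F̃ eq₁

      ordered-pair : ∀ {i j} → i Fin.< j → i ≡ j₀ × j ≡ j₁
      ordered-pair {i} {j} i<j with all i | all j
      ... | inj₁ refl | inj₁ refl = ⊥-elim (Fin.<-irrefl refl i<j)
      ... | inj₁ refl | inj₂ refl = refl , refl
      ... | inj₂ refl | inj₁ refl = ⊥-elim (Fin.<-asym i<j j₀<j₁)
      ... | inj₂ refl | inj₂ refl = ⊥-elim (Fin.<-irrefl refl i<j)

      root-branching : Branching TA TB F̃ nothing
      root-branching = mk-branching TA TB nothing anc neq prec mt idx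
        where
        anc : ∀ j → B.Anc new-root (F̃ (A.child nothing j))
        anc j with all j
        ... | inj₁ refl = subst (B.Anc new-root) (sym image₀) (proj₁ new-root-meet)
        ... | inj₂ refl = subst (B.Anc new-root) (sym image₁) (proj₁ (proj₂ new-root-meet))
        neq : ∀ j → new-root ≢ F̃ (A.child nothing j)
        neq j eq with all j
        ... | inj₁ refl = B.Prec-not-above F₀≺F₁ (subst (λ v → B.Anc v F₁) (trans eq image₀) (proj₁ (proj₂ new-root-meet)))
        ... | inj₂ refl = B.Prec-not-below F₀≺F₁ (subst (λ v → B.Anc v F₀) (trans eq image₁) (proj₁ new-root-meet))
        prec : ∀ i j → i Fin.< j → B.Prec (F̃ (A.child nothing i)) (F̃ (A.child nothing j))
        prec i j i<j with ordered-pair i<j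
        ... | refl , refl = subst₂ B.Prec (sym image₀) (sym image₁) F₀≺F₁
        mt : ∀ i j → i Fin.< j → B.IsMeet (F̃ (A.child nothing i)) (F̃ (A.child nothing j)) new-root
        mt i j i<j with ordered-pair i<j
        ... | refl , refl = subst₂ (λ u v → B.IsMeet u v new-root) (sym image₀) (sym image₁) new-root-meet
        idx : ∀ j q → p ≡ fin q → StrT.G B.str (A.k nothing j) new-root (F̃ (A.child nothing j))
        idx j q eq with all j
        ... | inj₁ refl = subst (StrT.G B.str (A.k nothing j₀) new-root) (sym image₀) (proj₁ (root-index q eq))
        ... | inj₂ refl = subst (StrT.G B.str (A.k nothing j₁) new-root) (sym image₁) (proj₂ (root-index q eq))

      Old : A.V → Set
      Old v = ∃ λ x → v ≡ just x

      extension : TreeMap TA TB F̃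
      extension nothing  = root-label , root-branching
      extension (just x) = Equivalence.to (presK (FPData.label DA x) (FPData.labelP DA x) x) refl
        , good-branching TA TB Old
            (λ { (x , refl) (y , refl) (z , refl) → presC x y z })
            (λ { (x , refl) (y , refl) → Equivalence.to (presPrec x y) })
            (λ { {i} 1≤i (x , refl) (y , refl) → Equivalence.to (presG i 1≤i x y) })
            (just x) (x , refl) old-child
        where
        old-child : ∀ j → Old (A.child (just x) j)
        old-child j with A.child (just x) j | A.child-isChild (just x) j
        ... | nothing | n≢n , _ = ⊥-elim (n≢n refl)
        ... | just y  | _       = y , refl

  embF⇒treeMap : (c : Choice DA) (d : Choice DB) (s : Step3 (TE c) (root c) (Tlabel c)) (s′ : Step3 (TE d) (root d) (Tlabel d))
    → ∀ {f} → EmbF P (FStr c s) (FStr d s′) f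
    → Σ (TV c → TV d) λ F → TreeMap (planeTree DA c s) (planeTree DB d s′) F × (∀ x → F (ι c x) ≡ ι d (f x))
  embF⇒treeMap c@(atVertex _ _) d s s′ {f} em = ι d ∘ f , tm , λ _ → refl
    where
    open EmbF em
    open EmbT embBase
    tm : TreeMap (planeTree DA c s) (planeTree DB d s′) (ι d ∘ f)
    tm v = Equivalence.to (presK (FPData.label DA v) (FPData.labelP DA v) v) refl
      , good-branching (planeTree DA c s) (planeTree DB d s′) (λ _ → ⊤) (λ {x} {y} {z} _ _ _ → presC x y z)
          (λ {x} {y} _ _ → Equivalence.to (presPrec x y)) (λ {i} {x} {y} 1≤i _ _ → Equivalence.to (presG i 1≤i x y)) v tt (λ _ → tt)
  embF⇒treeMap (atEdge a b ab p Pp) d s s′ em = F̃ s s′ em , extension s s′ em , λ _ → refl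
    where open AtMissingRoot a b ab p Pp d

module RamseyClasses (P : Deg → Set) (adm : ∀ p → P p → Admissible p) (p₀ : Deg) (Pp₀ : P p₀) where

  open RamseyForTrees P adm
  open Padding P adm

  -- Only targets rooted at a vertex are considered: nothing is added to the universe, so the
  -- structures of both classes live on the same vertices.
  record Target : Set₁ where
    field
      size-T : ℕ
      dat    : FPData P size-T
      base-T : Fin size-T
      free   : ∀ d → Degree (FPData.E dat) base-T d → d <ᵈ FPData.label dat base-T

    choice : Choice dat
    choice = atVertex base-T free

    field
      step3-T : Step3 (TE choice) (root choice) (Tlabel choice)

    tree-T : PlaneTree
    tree-T = planeTree dat choice step3-T

  module _ (A B : PlaneTree) where

    private
      module A = PlaneTree A
      module B = PlaneTree B

    abstract

      -- A colouring of tree maps is pulled back to codes, and `emb-of` turns each tree map from `A`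
      -- to `B` into a code. The realised `F′` agrees with `H ∘ F` only pointwise, so it is returned
      -- with its own proof.
      ramsey-planeTrees : (∃ λ N → ∀ v → A.dep v ≤ N) → (∃ λ N → ∀ v → B.dep v ≤ N) → (∀ v → P (B.lab v)) → ∀ r →
        Σ Target λ τ → let open Target τ in
          (χ : (F : A.V → Fin size-T) → TreeMap A tree-T F → Fin (suc r)) →
          Σ (B.V → Fin size-T) λ H → TreeMap B tree-T H × Σ (Fin (suc r)) λ col →
            ∀ F → TreeMap A B F →
            Σ (A.V → Fin size-T) λ F′ → Σ (TreeMap A tree-T F′) λ tm → (∀ x → F′ x ≡ H (F x)) × χ F′ tm ≡ col
      ramsey-planeTrees (NA , bdA) (NB , bdB) labP r
        with Representation.represent-root A NA bdA | Representation.represent-root B NB bdB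
      ... | tA , RA | tB , RB with ramsey-colours r tA tB (Representation.rep-valid B P adm labP RB)
      ...   | u , vu , hom = τ , λ χ →
        let h , col , mono = hom (λ e → χ (AT.realise RA RT (incl ∘ᴱ e)) (AT.realise-treeMap RA RT (incl ∘ᴱ e)))
        in BT.realise RB RT (incl ∘ᴱ h) , BT.realise-treeMap RB RT (incl ∘ᴱ h) , col , λ F tm →
           let e , eq = AB.emb-of tm RA RB (B.root-anc _) in
           AT.realise RA RT (incl ∘ᴱ (h ∘ᴱ e)) , AT.realise-treeMap RA RT (incl ∘ᴱ (h ∘ᴱ e)) , factor h e F eq , mono e
        where
        -- The added root takes its label from the non-emptiness of `P`.
        open Realised (pad u) (pad-valid vu) (pad-full u) p₀ Pp₀
        τ : Target
        τ = record { size-T = n ; dat = data-F ; base-T = zero ; free = root-free ; step3-T = step3-F }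
        RT : Rep tree-F zero T
        RT = rep-F
        module AT = Realisation A tree-F
        module BT = Realisation B tree-F
        module AB = Realisation A B
        incl : Emb u T
        incl = down (hd (pad-emb u))
        factor : ∀ (h : Emb tB u) (e : Emb tA tB) (F : A.V → B.V) → (∀ q → Representation.name B RB (⟦ e ⟧ᴱ q) ≡ F (Representation.name A RA q))
               → ∀ x → AT.realise RA RT (incl ∘ᴱ (h ∘ᴱ e)) x ≡ BT.realise RB RT (incl ∘ᴱ h) (F x)
        factor h e F eq x = cong (Representation.name tree-F RT)
          (trans (cong (λ g → ⟦ g ⟧ᴱ q) (assocᴱ incl h e))
          (trans (⟦⟧-∘ᴱ (incl ∘ᴱ h) e q) (cong ⟦ incl ∘ᴱ h ⟧ᴱ (sym position-Fx))))
          where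
          q : Node tA
          q = AB.position-of RA RB x
          position-Fx : BT.position-of RB RT (F x) ≡ ⟦ e ⟧ᴱ q
          position-Fx = trans (cong (BT.position-of RB RT) (trans (cong F (sym (AB.name-position RA RB x))) (sym (eq q))))
                              (BT.position-name RB RT (⟦ e ⟧ᴱ q))

  colour-cong : ∀ {X : Set} {r} {Q : X → Set} (χ : (x : X) → .(Q x) → Fin r) {x y} → x ≡ y
              → .(p : Q x) .(q : Q y) → χ x p ≡ χ y q
  colour-cong χ refl p q = refl

  -- Pointwise agreement becomes equality of vectors here, and then `colour-cong` compares the
  -- colours, as the embedding proofs are irrelevant arguments.
  tabulate-compose : ∀ {a b N} (h : Fin b → Fin N) (f : Vec (Fin b) a) (g : Fin a → Fin N)
    → (∀ x → g x ≡ h (Vec.lookup f x)) → Vec.tabulate g ≡ Vec.map (Vec.lookup (Vec.tabulate h)) f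
  tabulate-compose h f g g≗ = trans (Vec.tabulate-cong λ x →
      trans (g≗ x) (trans (sym (Vec.lookup∘tabulate h (Vec.lookup f x))) (sym (Vec.lookup-map x (Vec.lookup (Vec.tabulate h)) f))))
    (Vec.tabulate∘lookup _)

  abstract

    depth-bounded : ∀ {n} {D : FPData P n} (c : Choice D) (s : Step3 (TE c) (root c) (Tlabel c))
                  → ∃ λ N → ∀ v → PlaneTree.dep (planeTree D c s) v ≤ N
    depth-bounded c s = bounded-TV c (PlaneTree.dep (planeTree _ c s))

  T*-Ramsey : Ramsey StrT (EmbT P) (InTstar P)
  T*-Ramsey a b A B (_ , DA , cA , sA , gA , emA , surA) (_ , DB , cB , sB , gB , emB , surB) _ (suc r) _
    with ramsey-planeTrees (planeTree DA cA sA) (planeTree DB cB sB)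
           (depth-bounded cA sA) (depth-bounded cB sB) (Tlabel-P DB cB) r
  ... | τ , hom = size-T , PlaneTree.str tree-T
      , (size-T , dat , choice , step3-T , id , embT-id , λ y → y , refl) , mono
    where
    open Target τ
    TA TB : PlaneTree
    TA = planeTree DA cA sA
    TB = planeTree DB cB sB

    into : ∀ {X k} {S : StrT (Fin k)} {g : Fin k → PlaneTree.V X} {F} → EmbT P S (PlaneTree.str X) g
         → TreeMap X tree-T F → EmbT P S (PlaneTree.str tree-T) (Vec.lookup (Vec.tabulate (F ∘ g)))
    into {X} {g = g} {F} em tm = embT-cong (sym ∘ Vec.lookup∘tabulate (F ∘ g))
      (embT-∘ (TreeMaps.treeMap⇒embT X tree-T tm P) em)

    mono : (χ : (f : Vec (Fin size-T) a) → .(EmbT P A (PlaneTree.str tree-T) (Vec.lookup f)) → Fin (suc r)) →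
      Σ (Vec (Fin size-T) b) λ h → EmbT P B (PlaneTree.str tree-T) (Vec.lookup h) × Σ (Fin (suc r)) λ col →
        ∀ (f : Vec (Fin b) a) → EmbT P A B (Vec.lookup f)
        → (e : EmbT P A (PlaneTree.str tree-T) (Vec.lookup (Vec.map (Vec.lookup h) f)))
        → χ (Vec.map (Vec.lookup h) f) e ≡ col
    mono χ with hom (λ F tm → χ (Vec.tabulate (F ∘ gA)) (into {TA} emA tm))
    ... | H , tmH , col , eq = Vec.tabulate (H ∘ gB) , into {TB} emB tmH , col , λ f em e →
      let F , tm , F≡ = lift f em
          F′ , tm′ , F′≡ , χ≡ = eq F tm
      in trans (colour-cong {Q = λ v → EmbT P A (PlaneTree.str tree-T) (Vec.lookup v)} χ (sym (tabulate-compose (H ∘ gB) f (F′ ∘ gA)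
                 (λ x → trans (F′≡ (gA x)) (cong H (F≡ x))))) e (into {TA} emA tm′)) χ≡
      where
      lift : (f : Vec (Fin b) a) → EmbT P A B (Vec.lookup f)
           → Σ (TV cA → TV cB) λ F → TreeMap TA TB F × (∀ x → F (gA x) ≡ gB (Vec.lookup f x))
      -- The given structures are only isomorphic to ones obtained from trees, so the embedding is
      -- transported along `gA` and `gB`.
      lift f em = gB ∘ Vec.lookup f ∘ inverse emA surA
        , embT⇒treeMap cA cB sA sB (embT-∘ emB (embT-∘ em (embT-inverse emA surA)))
        , λ x → cong (gB ∘ Vec.lookup f) (inverse-f emA surA x)

  F*-Ramsey : Ramsey StrF (EmbF P) (InFstar P)
  F*-Ramsey a b A B (_ , DA , cA , sA , gA , emA , surA) (_ , DB , cB , sB , gB , emB , surB) _ (suc r) _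
    with ramsey-planeTrees (planeTree DA cA sA) (planeTree DB cB sB)
           (depth-bounded cA sA) (depth-bounded cB sB) (Tlabel-P DB cB) r
  ... | τ , hom = size-T , FT , (size-T , dat , choice , step3-T , id , embF-id , λ y → y , refl) , mono
    where
    open Target τ
    TA TB : PlaneTree
    TA = planeTree DA cA sA
    TB = planeTree DB cB sB
    FT : StrF (Fin size-T)
    FT = FStr choice step3-T

    into : ∀ {k l} {D : FPData P l} {c : Choice D} {s : Step3 (TE c) (root c) (Tlabel c)} {S : StrF (Fin k)} {g : Fin k → Fin l} {F}
         → EmbF P S (FStr c s) g → TreeMap (planeTree D c s) tree-T F
         → EmbF P S FT (Vec.lookup (Vec.tabulate (F ∘ ι c ∘ g)))
    into {c = c} {s} {g = g} {F} em tm = embF-cong (sym ∘ Vec.lookup∘tabulate (F ∘ ι c ∘ g))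
      (embF-∘ (treeMap⇒embF c choice s step3-T tm (F ∘ ι c) (λ _ → refl)) em)

    mono : (χ : (f : Vec (Fin size-T) a) → .(EmbF P A FT (Vec.lookup f)) → Fin (suc r)) →
      Σ (Vec (Fin size-T) b) λ h → EmbF P B FT (Vec.lookup h) × Σ (Fin (suc r)) λ col →
        ∀ (f : Vec (Fin b) a) → EmbF P A B (Vec.lookup f)
        → (e : EmbF P A FT (Vec.lookup (Vec.map (Vec.lookup h) f)))
        → χ (Vec.map (Vec.lookup h) f) e ≡ col
    mono χ with hom (λ F tm → χ (Vec.tabulate (F ∘ ι cA ∘ gA)) (into {s = sA} emA tm))
    ... | H , tmH , col , eq = Vec.tabulate (H ∘ ι cB ∘ gB) , into {s = sB} emB tmH , col , λ f em e →
      let F , tm , F≡ = lift f em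
          F′ , tm′ , F′≡ , χ≡ = eq F tm
      in trans (colour-cong {Q = λ v → EmbF P A FT (Vec.lookup v)} χ (sym (tabulate-compose (H ∘ ι cB ∘ gB) f (F′ ∘ ι cA ∘ gA)
                 (λ x → trans (F′≡ (ι cA (gA x))) (cong H (F≡ x))))) e (into {s = sA} emA tm′)) χ≡
      where
      lift : (f : Vec (Fin b) a) → EmbF P A B (Vec.lookup f)
           → Σ (TV cA → TV cB) λ F → TreeMap TA TB F × (∀ x → F (ι cA (gA x)) ≡ ι cB (gB (Vec.lookup f x)))
      lift f em =
        -- At a missing root of `A` the value of `F` is new; elsewhere `F` extends the given
        -- embedding, and only those values enter the coloured vector.
        let F , tm , F≡ = embF⇒treeMap cA cB sA sB (embF-∘ emB (embF-∘ em (embF-inverse emA surA)))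
        in F , tm , λ x → trans (F≡ (gA x)) (cong (ι cB ∘ gB ∘ Vec.lookup f) (inverse-f (EmbF.embBase emA) surA x))

theorem3p6 : (P : Deg → Set) → (∀ p → P p → Admissible p) → (∃ λ p → P p)
    → Ramsey StrT (EmbT P) (InTstar P) × Ramsey StrF (EmbF P) (InFstar P)
theorem3p6 P adm (p , Pp) = T*-Ramsey , F*-Ramsey
  where open RamseyClasses P adm p Pp
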